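{- Let $n$ be an almost-prime number, let $p$ be a prime divisor of $n$, and let $s=q^{\nu}$ be a divisor of $p-1$, where $q$ is an odd prime and $\nu\ge 1$. Let $g$ be a generator of the cyclic group $(\mathbb{Z}/s\mathbb{Z})^{*}$, and for each integer $r$ let $\omega_r$ denote the number of distinct prime divisors of $n$ that are congruent to $r$ modulo $s$. Let $\zeta$ be a primitive $\varphi(s)$-th root of unity, $K=\mathbb{Q}(\zeta)$, and $\mathcal{O}_K=\mathbb{Z}[\zeta]$ its ring of integers. Define $$f(x)=\prod_{l=1}^{\varphi(s)}\left(1+x^l\right)^{\omega_{g^l}}.$$ Then for every $\varphi(s)$-th root of unity $\eta$ we have $f(\eta)\equiv d(n)\pmod{p}$ in $\mathcal{O}_K$, i.e. $f(\eta)-d(n)\in p\mathcal{O}_K$.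
   Context: For a positive integer $n$ with positive divisors $1=d_1<d_2<\dots<d_k=n$, define the polynomial $T_n(x)=x^{d_1}+x^{d_2}+\dots+x^{d_k}-kx$. A positive integer $n$ is called weakly almost-prime if $n\mid T_n(x)$ for all integers $x$; it is called almost-prime if it is weakly almost-prime and square-free. $d(n)$ denotes the number of positive divisors of $n$, and $\varphi$ is Euler's totient function. -}

module Defs where

open import Data.Nat as ℕ using (ℕ; zero; suc; _<?_)
open import Data.Nat.Divisibility using (_∣?_) renaming (_∣_ to _∣ℕ_)
open import Data.Nat.Coprimality using (Coprime; coprime?)
open import Data.Nat.Primality using (Prime; prime?)
open import Data.Integer as ℤ using (ℤ; +_; ∣_∣)
open import Data.Integer.Divisibility using () renaming (_∣_ to _∣ℤ_)
open import Data.List using (List; []; _∷_; filter; length; map; upTo; foldr; reverse; replicate; _++_)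
open import Data.Product using (Σ; ∃; _×_; _,_)
open import Relation.Nullary using (¬_)
open import Relation.Nullary.Decidable using (_×-dec_)
open import Relation.Binary.PropositionalEquality using (_≡_)

range1 : ℕ → List ℕ
range1 n = map suc (upTo n)

divisors : ℕ → List ℕ
divisors n = filter (_∣? n) (range1 n)

numDiv : ℕ → ℕ
numDiv n = length (divisors n)

totient : ℕ → ℕ
totient m = length (filter (λ k → coprime? k m) (range1 m))

_≡_[mod_] : ℕ → ℕ → ℕ → Set
a ≡ b [mod s ] = s ∣ℕ ∣ (+ a) ℤ.- (+ b) ∣

T : ℕ → ℤ → ℤ
T n x = foldr (λ d acc → (x ℤ.^ d) ℤ.+ acc) (+ 0) (divisors n) ℤ.- (+ numDiv n) ℤ.* x

WeaklyAlmostPrime : ℕ → Set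
WeaklyAlmostPrime n = 1 ℕ.≤ n × ((x : ℤ) → (+ n) ∣ℤ T n x)

SquareFree : ℕ → Set
SquareFree n = (p : ℕ) → Prime p → ¬ ((p ℕ.* p) ∣ℕ n)

AlmostPrime : ℕ → Set
AlmostPrime n = WeaklyAlmostPrime n × SquareFree n

omega : ℕ → ℕ → ℕ → ℕ
omega n s r = length (filter (λ p → prime? p ×-dec (p ∣? n) ×-dec (s ∣? ∣ (+ p) ℤ.- (+ r) ∣)) (range1 n))

IsGenerator : ℕ → ℕ → Set
IsGenerator s g = Coprime g s × ((a : ℕ) → Coprime a s → ∃ λ l → (g ℕ.^ l) ≡ a [mod s ])

-- Integer polynomials, coefficient lists (lowest degree first)

Poly : Set
Poly = List ℤ

coeff : Poly → ℕ → ℤ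
coeff []       _       = + 0
coeff (c ∷ _)  zero    = c
coeff (_ ∷ cs) (suc i) = coeff cs i

-- equality of polynomials (ignores trailing zero coefficients)
_≈ₚ_ : Poly → Poly → Set
P ≈ₚ Q = (i : ℕ) → coeff P i ≡ coeff Q i

_+ₚ_ : Poly → Poly → Poly
[]       +ₚ Q        = Q
(a ∷ P)  +ₚ []       = a ∷ P
(a ∷ P)  +ₚ (b ∷ Q)  = (a ℤ.+ b) ∷ (P +ₚ Q)

scaleₚ : ℤ → Poly → Poly
scaleₚ c = map (c ℤ.*_)

negₚ : Poly → Poly
negₚ = scaleₚ (ℤ.- (+ 1))

_*ₚ_ : Poly → Poly → Poly
[]      *ₚ Q = []
(a ∷ P) *ₚ Q = scaleₚ a Q +ₚ (+ 0 ∷ (P *ₚ Q))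

constₚ : ℤ → Poly
constₚ c = c ∷ []

monoₚ : ℕ → Poly
monoₚ k = replicate k (+ 0) ++ (+ 1 ∷ [])

_^ₚ_ : Poly → ℕ → Poly
P ^ₚ zero  = constₚ (+ 1)
P ^ₚ suc k = P *ₚ (P ^ₚ k)

prodₚ : List Poly → Poly
prodₚ = foldr _*ₚ_ (constₚ (+ 1))

private
  subPrefix : List ℤ → List ℤ → List ℤ
  subPrefix (a ∷ as) (b ∷ bs) = (a ℤ.- b) ∷ subPrefix as bs
  subPrefix as       []       = as
  subPrefix []       bs       = map ℤ.-_ bs

  -- highest degree first; ds = the non-leading coefficients of the monic divisor
  divH : ℕ → List ℤ → List ℤ → List ℤ
  divH zero    ds ns       = []
  divH (suc f) ds []       = []
  divH (suc f) ds (c ∷ ns) with length ns <? length ds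
  ... | Relation.Nullary.yes _ = []
  ... | Relation.Nullary.no  _ = c ∷ divH f ds (subPrefix ns (map (c ℤ.*_) ds))

divMonicₚ : Poly → Poly → Poly
divMonicₚ N D with reverse D
... | []     = []
... | _ ∷ ds = reverse (divH (length N) ds (reverse N))

-- cyclotomic polynomials, via x^m - 1 = ∏_{d ∣ m} Φ_d (fuel-bounded recursion)
private
  cycloF : ℕ → ℕ → Poly
  cycloF zero    m = constₚ (+ 1)
  cycloF (suc f) m =
    divMonicₚ (monoₚ m +ₚ constₚ (ℤ.- (+ 1)))
              (prodₚ (map (cycloF f) (filter (λ d → d <? m) (divisors m))))

cyclotomic : ℕ → Poly
cyclotomic m = cycloF m m

-- O_K = ℤ[ζ] ≅ ℤ[x]/(Φ_m) for ζ a primitive m-th root of unity;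
-- an element is represented by an integer polynomial F (standing for F(ζ)).
-- F(ζ) ∈ p O_K  iff  F ∈ (p, Φ_m) ⊆ ℤ[x].
InPIdeal : ℕ → ℕ → Poly → Set
InPIdeal m p F = Σ Poly λ A → Σ Poly λ B →
  F ≈ₚ ((scaleₚ (+ p) A) +ₚ (cyclotomic m *ₚ B))

-- f(x) = ∏_{l=1}^{φ(s)} (1 + x^l)^{ω_{g^l}}, evaluated at η = ζ^j,
-- i.e. the polynomial ∏_{l=1}^{φ(s)} (1 + x^{j l})^{ω_{g^l}}
fAtPow : ℕ → ℕ → ℕ → ℕ → Poly
fAtPow n s g j =
  prodₚ (map (λ l → (constₚ (+ 1) +ₚ monoₚ (j ℕ.* l)) ^ₚ omega n s (g ℕ.^ l))
             (range1 (totient s)))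

{-# OPTIONS --safe #-}

-- Put m = φ(s), A = ℤ[x]/(p, Φ_m), and let χ : ℕ → A be the character modulo s that is 0 off the
-- units and sends g^l to x^(jl). As n is square-free,
--   f(x^j) = ∏_{r ∣ n prime} (1 + χ(r)) = ∑_{d ∣ n} χ(d).
-- Since p ∣ n, the polynomial ∑_{d ∣ n} X^(d mod (p-1)) - d(n) X vanishes at all nonzero residues
-- modulo p by Fermat; its degree is less than p - 1, so its coefficients vanish modulo p. The function
-- χ has period s ∣ p - 1, so applying X^i ↦ χ(i) gives ∑_{d ∣ n} χ(d) ≡ d(n) χ(1) = d(n).
--
-- That χ is well defined needs x^m = 1 in A, that is, that Φ_m divides x^m - 1 modulo p, where Φ_m is
-- the quotient of x^m - 1 by the product of the Φ_d with d ∣ m, d < m. This division is exact modulo p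
-- because the factors Φ_a, Φ_b (a ≠ b) are comaximal there: for t = gcd(a, b) < a, say, Φ_a divides
-- (x^a - 1)/(x^t - 1) ≡ a/t modulo x^t - 1, both x^t - 1 and hence a/t lie in (Φ_a, Φ_b), and a/t is
-- invertible modulo p because a ≤ m < p.

module Submission where

-- The definition of `cyclotomic` discards the remainder of every division, so nothing is known of
-- Φ_m beforehand, not even that it is monic. Exactness is obtained only modulo p. There it is a
-- matter of comparing coefficients: the integer quotient by a monic D is determined modulo p by the
-- coefficients of the dividend in degrees from deg D upward, which the remainder does not reach.
-- Monicity of Φ_m travels through the same strong induction, because the next division presupposes
-- a monic divisor.
--
-- The quotient is formed in two stages, by p and then by Φ_m, and each congruence keeps its
-- cofactor as data; the final congruence thus already contains the two polynomials that membership
-- in the ideal asks for.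
--
-- Exponents are reduced modulo p - 1 before coefficients are compared, since reduction modulo s
-- would change the values x^d at residues modulo p; the passage to s is made by the periodicity of
-- χ alone.
--
-- A generator is given only as a unit whose powers reach every unit. That its order is exactly φ(s)
-- comes from counting in both directions.

open import Defs
open import Data.Nat using (ℕ; _≤_; _^_; _∸_; _<_)
open import Data.Nat.Divisibility using (_∣_)
open import Data.Nat.Primality using (Prime)
open import Data.Empty using (⊥-elim)
open import Data.Fin using (Fin; toℕ; fromℕ; fromℕ<; inject₁)
import Data.Fin as Fin
import Data.Fin.Properties as Fin
open import Data.Nat.Primality.Factorisation using (PrimeFactorisation; factorise; factorisationHasAllPrimeFactors)
open import Data.Integer using (ℤ; +_)
open import Relation.Binary.PropositionalEquality using (_≡_)

open import Algebra.Bundles using (CommutativeMonoid; CommutativeRing; Monoid; Semiring)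
open import Data.Bool using (Bool; true; false; _∧_; if_then_else_)
import Data.Nat as ℕ
import Data.Nat.Properties as ℕₚ
import Data.Nat.DivMod as ℕ
import Data.Nat.Divisibility as ℕ
import Data.Nat.GCD as ℕ
open import Data.Nat using (zero; suc; z≤n; s≤s; NonZero)
open import Data.Nat.ListAction using (product)
open import Data.Nat.ListAction.Properties using (∈⇒∣product)
open import Data.Nat.Induction using (<-rec)
open import Data.Nat.Coprimality using (Coprime; coprime?; coprime-divisor; coprime-Bézout; prime⇒coprime)
open import Data.Nat.Primality using (prime?; euclidsLemma; prime⇒nonZero; prime⇒nonTrivial; prime⇒irreducible)
import Data.Integer as ℤ
import Data.Integer.Properties as ℤₚ
open import Data.Integer.Divisibility.Signed using (divides) renaming (_∣_ to _∣ᶻ_)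
import Data.Integer.Divisibility.Signed as ℤ∣
open import Data.List using (List; []; _∷_; _++_; map; foldr; filter; length; reverse; replicate)
import Data.List as List
import Data.List.Properties as List
open import Data.List.Membership.Propositional using (_∈_)
open import Data.List.Membership.Propositional.Properties using (∈-map⁺; ∈-map⁻; ∈-filter⁺; ∈-filter⁻; ∈-upTo⁺; ∈-upTo⁻; ∈-∃++; ∈-++⁺ˡ; ∈-++⁺ʳ; ∈-++⁻; ∈-lookup)
open import Data.List.Membership.Propositional.Properties.WithK using (unique∧set⇒bag)
open import Data.List.Relation.Binary.BagAndSetEquality using (∼bag⇒↭)
open import Data.List.Relation.Binary.Permutation.Propositional using (_↭_; refl; prep; swap; trans)
open import Data.List.Relation.Unary.All using (All; []; _∷_)
import Data.List.Relation.Unary.All as All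
import Data.List.Relation.Unary.All.Properties as All
open import Data.List.Relation.Unary.AllPairs using (AllPairs; []; _∷_)
open import Data.List.Relation.Unary.Any using (here; there)
import Data.List.Relation.Unary.Any as Any
open import Data.List.Relation.Unary.Any.Properties using (lookup-index)
open import Data.List.Relation.Unary.Unique.Propositional using (Unique)
import Data.List.Relation.Unary.Unique.Propositional.Properties as Unique
open import Data.Product using (∃; ∃₂; _×_; _,_; proj₁; proj₂)
open import Data.Sum using (_⊎_; inj₁; inj₂; [_,_]′)
open import Function using (_∘_; mk⇔)
open import Level using (_⊔_; 0ℓ)
open import Relation.Binary.PropositionalEquality using (_≢_; subst; subst₂; cong; cong₂; module ≡-Reasoning)
import Relation.Binary.PropositionalEquality as ≡
open import Relation.Nullary using (¬_; Dec; yes; no; does; contradiction)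
open import Relation.Nullary.Decidable using (_×-dec_; dec-true; dec-false)
open import Relation.Unary using (Pred; Decidable)

-- Finite products over lists

module BigOperator {c ℓ} (M : CommutativeMonoid c ℓ) {a} {A : Set a} where
  open CommutativeMonoid M
  open import Algebra.Properties.CommutativeSemigroup commutativeSemigroup using (interchange; x∙yz≈y∙xz)

  ⨀ : (A → Carrier) → List A → Carrier
  ⨀ f xs = foldr _∙_ ε (map f xs)

  ⨀-cong : ∀ {f g} xs → (∀ {x} → x ∈ xs → f x ≈ g x) → ⨀ f xs ≈ ⨀ g xs
  ⨀-cong []       eq = CommutativeMonoid.refl M
  ⨀-cong (x ∷ xs) eq = ∙-cong (eq (here ≡.refl)) (⨀-cong xs (eq ∘ there))

  ⨀-↭ : ∀ f {xs ys} → xs ↭ ys → ⨀ f xs ≈ ⨀ f ys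
  ⨀-↭ f refl           = CommutativeMonoid.refl M
  ⨀-↭ f (prep x p)     = ∙-congˡ (⨀-↭ f p)
  ⨀-↭ f (swap x y p)   = CommutativeMonoid.trans M (x∙yz≈y∙xz _ _ _) (∙-congˡ (∙-congˡ (⨀-↭ f p)))
  ⨀-↭ f (trans p q)    = CommutativeMonoid.trans M (⨀-↭ f p) (⨀-↭ f q)

  ⨀-++ : ∀ f xs ys → ⨀ f (xs ++ ys) ≈ ⨀ f xs ∙ ⨀ f ys
  ⨀-++ f []       ys = sym (identityˡ _)
  ⨀-++ f (x ∷ xs) ys = CommutativeMonoid.trans M (∙-congˡ (⨀-++ f xs ys)) (sym (assoc _ _ _))

  ⨀-∙ : ∀ f g xs → ⨀ (λ x → f x ∙ g x) xs ≈ ⨀ f xs ∙ ⨀ g xs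
  ⨀-∙ f g []       = sym (identityˡ ε)
  ⨀-∙ f g (x ∷ xs) = CommutativeMonoid.trans M (∙-congˡ (⨀-∙ f g xs)) (interchange _ _ _ _)

  ⨀-ε : ∀ {f} xs → (∀ {x} → x ∈ xs → f x ≈ ε) → ⨀ f xs ≈ ε
  ⨀-ε []       eq = CommutativeMonoid.refl M
  ⨀-ε (x ∷ xs) eq = CommutativeMonoid.trans M (∙-cong (eq (here ≡.refl)) (⨀-ε xs (eq ∘ there))) (identityˡ ε)

  ⨀-filter : ∀ {p} {P : Pred A p} (P? : Decidable P) f xs →
    ⨀ f (filter P? xs) ≈ ⨀ (λ x → if does (P? x) then f x else ε) xs
  ⨀-filter P? f [] = CommutativeMonoid.refl M
  ⨀-filter P? f (x ∷ xs) with does (P? x)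
  ... | true  = ∙-congˡ (⨀-filter P? f xs)
  ... | false = CommutativeMonoid.trans M (⨀-filter P? f xs) (sym (identityˡ _))

  ⨀-single : ∀ {f x xs} → Unique xs → x ∈ xs → (∀ {y} → y ∈ xs → y ≢ x → f y ≈ ε) → ⨀ f xs ≈ f x
  ⨀-single {xs = x ∷ xs} (x∉ ∷ u) (here ≡.refl) eq =
    CommutativeMonoid.trans M (∙-congˡ (⨀-ε xs λ y∈ → eq (there y∈) (All.lookup x∉ y∈ ∘ ≡.sym))) (identityʳ _)
  ⨀-single {xs = x ∷ xs} (x∉ ∷ u) (there y∈) eq =
    CommutativeMonoid.trans M (∙-cong (eq (here ≡.refl) (All.lookup x∉ y∈)) (⨀-single u y∈ (eq ∘ there))) (identityˡ _)

module _ {c ℓ} (M : CommutativeMonoid c ℓ) {a b} {A : Set a} {B : Set b} where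
  open CommutativeMonoid M
  open BigOperator M
  open import Relation.Binary.Reasoning.Setoid setoid

  ⨀-swap : ∀ (f : A → B → Carrier) xs ys →
    ⨀ (λ x → ⨀ (f x) ys) xs ≈ ⨀ (λ y → ⨀ (λ x → f x y) xs) ys
  ⨀-swap f []       ys = sym (⨀-ε ys λ _ → CommutativeMonoid.refl M)
  ⨀-swap f (x ∷ xs) ys = begin
    _ ≈⟨ ∙-congˡ (⨀-swap f xs ys) ⟩
    _ ≈⟨ ⨀-∙ (f x) _ ys ⟨
    _ ∎

↭-fromSet : ∀ {a} {A : Set a} {xs ys : List A} → Unique xs → Unique ys →
  (∀ {x} → x ∈ xs → x ∈ ys) → (∀ {x} → x ∈ ys → x ∈ xs) → xs ↭ ys
↭-fromSet uxs uys f g = ∼bag⇒↭ (unique∧set⇒bag uxs uys (mk⇔ f g))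

-- Quotient rings and comaximal elements

module Quotient {c ℓ} (R : CommutativeRing c ℓ) (g : CommutativeRing.Carrier R) where
  open CommutativeRing R renaming (refl to ≈-refl; trans to ≈-trans; sym to ≈-sym)
  open import Algebra.Properties.Ring ring using (-‿distribʳ-*; -‿+-comm)
  open import Algebra.Solver.Ring.NaturalCoefficients.Default commutativeSemiring
  open import Relation.Binary.Reasoning.Setoid setoid

  infix 4 _∼_

  -- The cofactor is a field because it is read off at the end: the construction is applied twice,
  -- with `constₚ (+ p)` and then with the cyclotomic polynomial, and the two cofactors are the
  -- witnesses of `InPIdeal`.
  record _∼_ (x y : Carrier) : Set (c ⊔ ℓ) where
    constructor congruent
    field
      factor   : Carrier
      equality : x ≈ y + g * factor

  ≈⇒∼ : ∀ {x y} → x ≈ y → x ∼ y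
  ≈⇒∼ {x} {y} x≈y = congruent 0# (begin
    x           ≈⟨ x≈y ⟩
    y           ≈⟨ +-identityʳ y ⟨
    y + 0#      ≈⟨ +-congˡ (zeroʳ g) ⟨
    y + g * 0#  ∎)

  cancelʳ : ∀ y a → (y + g * a) + g * (- a) ≈ y
  cancelʳ y a = begin
    (y + g * a) + g * (- a)  ≈⟨ solve 4 (λ y g a b → (y :+ g :* a) :+ g :* b := y :+ g :* (a :+ b)) ≈-refl y g a (- a) ⟩
    y + g * (a + - a)        ≈⟨ +-congˡ (*-congˡ (-‿inverseʳ a)) ⟩
    y + g * 0#               ≈⟨ +-congˡ (zeroʳ g) ⟩
    y + 0#                   ≈⟨ +-identityʳ y ⟩
    y                        ∎

  ∼-sym : ∀ {x y} → x ∼ y → y ∼ x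
  ∼-sym {x} {y} (congruent a x≈) = congruent (- a) (begin
    y                        ≈⟨ cancelʳ y a ⟨
    (y + g * a) + g * (- a)  ≈⟨ +-congʳ x≈ ⟨
    x + g * (- a)            ∎)

  ∼-trans : ∀ {x y z} → x ∼ y → y ∼ z → x ∼ z
  ∼-trans {x} {y} {z} (congruent a x≈) (congruent b y≈) = congruent (b + a) (begin
    x                    ≈⟨ x≈ ⟩
    y + g * a            ≈⟨ +-congʳ y≈ ⟩
    (z + g * b) + g * a  ≈⟨ solve 4 (λ z g a b → (z :+ g :* b) :+ g :* a := z :+ g :* (b :+ a)) ≈-refl z g a b ⟩
    z + g * (b + a)      ∎)

  +-cong-∼ : ∀ {x y u v} → x ∼ y → u ∼ v → (x + u) ∼ (y + v)
  +-cong-∼ {x} {y} {u} {v} (congruent a x≈) (congruent b u≈) = congruent (a + b) (begin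
    x + u                      ≈⟨ +-cong x≈ u≈ ⟩
    (y + g * a) + (v + g * b)  ≈⟨ solve 5 (λ y v g a b → (y :+ g :* a) :+ (v :+ g :* b) := (y :+ v) :+ g :* (a :+ b)) ≈-refl y v g a b ⟩
    (y + v) + g * (a + b)      ∎)

  *-cong-∼ : ∀ {x y u v} → x ∼ y → u ∼ v → (x * u) ∼ (y * v)
  *-cong-∼ {x} {y} {u} {v} (congruent a x≈) (congruent b u≈) = congruent (y * b + a * v + g * a * b) (begin
    x * u                                    ≈⟨ *-cong x≈ u≈ ⟩
    (y + g * a) * (v + g * b)                ≈⟨ solve 5 (λ y v g a b → (y :+ g :* a) :* (v :+ g :* b) := (y :* v) :+ g :* (y :* b :+ a :* v :+ g :* a :* b)) ≈-refl y v g a b ⟩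
    y * v + g * (y * b + a * v + g * a * b)  ∎)

  -‿cong-∼ : ∀ {x y} → x ∼ y → (- x) ∼ (- y)
  -‿cong-∼ {x} {y} (congruent a x≈) = congruent (- a) (begin
    - x              ≈⟨ -‿cong x≈ ⟩
    - (y + g * a)    ≈⟨ -‿+-comm y (g * a) ⟨
    - y + - (g * a)  ≈⟨ +-congˡ (-‿distribʳ-* g a) ⟩
    - y + g * - a    ∎)

  quotient : CommutativeRing c (c ⊔ ℓ)
  quotient = record
    { Carrier = Carrier
    ; _≈_     = _∼_
    ; _+_     = _+_
    ; _*_     = _*_
    ; -_      = -_
    ; 0#      = 0#
    ; 1#      = 1#
    ; isCommutativeRing = record
      { isRing = record
        { +-isAbelianGroup = record
          { isGroup = record
            { isMonoid = record
              { isSemigroup = record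
                { isMagma = record
                  { isEquivalence = record { refl = ≈⇒∼ ≈-refl ; sym = ∼-sym ; trans = ∼-trans }
                  ; ∙-cong = +-cong-∼
                  }
                ; assoc = λ x y z → ≈⇒∼ (+-assoc x y z)
                }
              ; identity = (λ x → ≈⇒∼ (+-identityˡ x)) , λ x → ≈⇒∼ (+-identityʳ x)
              }
            ; inverse = (λ x → ≈⇒∼ (-‿inverseˡ x)) , λ x → ≈⇒∼ (-‿inverseʳ x)
            ; ⁻¹-cong = -‿cong-∼
            }
          ; comm = λ x y → ≈⇒∼ (+-comm x y)
          }
        ; *-cong = *-cong-∼
        ; *-assoc = λ x y z → ≈⇒∼ (*-assoc x y z)
        ; *-identity = (λ x → ≈⇒∼ (*-identityˡ x)) , λ x → ≈⇒∼ (*-identityʳ x)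
        ; distrib = (λ x y z → ≈⇒∼ (distribˡ x y z)) , λ x y z → ≈⇒∼ (distribʳ x y z)
        }
      ; *-comm = λ x y → ≈⇒∼ (*-comm x y)
      }
    }

module Comaximality {c ℓ} (R : CommutativeRing c ℓ) where
  open CommutativeRing R renaming (refl to ≈-refl; trans to ≈-trans; sym to ≈-sym)
  open import Algebra.Properties.Ring ring using (-‿distribˡ-*; -‿+-comm)
  open import Algebra.Solver.Ring.NaturalCoefficients.Default commutativeSemiring
  open import Relation.Binary.Reasoning.Setoid setoid
  open BigOperator *-commutativeMonoid renaming (⨀ to ∏; ⨀-↭ to ∏-↭) using () public

  infix 4 _∣ᴿ_ _∈⟨_,_⟩

  _∣ᴿ_ : Carrier → Carrier → Set (c ⊔ ℓ)
  u ∣ᴿ w = ∃ λ q → w ≈ q * u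

  _∈⟨_,_⟩ : Carrier → Carrier → Carrier → Set (c ⊔ ℓ)
  w ∈⟨ u , v ⟩ = ∃₂ λ a b → w ≈ a * u + b * v

  Comaximal : Carrier → Carrier → Set (c ⊔ ℓ)
  Comaximal u v = 1# ∈⟨ u , v ⟩

  ∣ᴿ-trans : ∀ {u v w} → u ∣ᴿ v → v ∣ᴿ w → u ∣ᴿ w
  ∣ᴿ-trans (q , v≈) (r , w≈) = r * q , ≈-trans w≈ (≈-trans (*-congˡ v≈) (≈-sym (*-assoc _ _ _)))

  ∈⟨⟩-resp-≈ : ∀ {u v w w′} → w ≈ w′ → w ∈⟨ u , v ⟩ → w′ ∈⟨ u , v ⟩
  ∈⟨⟩-resp-≈ eq (a , b , w≈) = a , b , ≈-trans (≈-sym eq) w≈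

  ∈⟨⟩-+ : ∀ {u v x y} → x ∈⟨ u , v ⟩ → y ∈⟨ u , v ⟩ → (x + y) ∈⟨ u , v ⟩
  ∈⟨⟩-+ {u} {v} (a , b , x≈) (a′ , b′ , y≈) = a + a′ , b + b′ , ≈-trans (+-cong x≈ y≈)
    (solve 6 (λ u v a b c d → (a :* u :+ b :* v) :+ (c :* u :+ d :* v) := (a :+ c) :* u :+ (b :+ d) :* v) ≈-refl u v a b a′ b′)

  ∈⟨⟩-* : ∀ {u v x} r → x ∈⟨ u , v ⟩ → (r * x) ∈⟨ u , v ⟩
  ∈⟨⟩-* {u} {v} r (a , b , x≈) = r * a , r * b , ≈-trans (*-congˡ x≈)
    (solve 5 (λ u v a b r → r :* (a :* u :+ b :* v) := (r :* a) :* u :+ (r :* b) :* v) ≈-refl u v a b r)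

  ∈⟨⟩-neg : ∀ {u v x} → x ∈⟨ u , v ⟩ → (- x) ∈⟨ u , v ⟩
  ∈⟨⟩-neg {u} {v} {x} (a , b , x≈) = - a , - b , (begin
    - x                    ≈⟨ -‿cong x≈ ⟩
    - (a * u + b * v)      ≈⟨ -‿+-comm (a * u) (b * v) ⟨
    - (a * u) + - (b * v)  ≈⟨ +-cong (-‿distribˡ-* a u) (-‿distribˡ-* b v) ⟩
    - a * u + - b * v      ∎)

  ∈⟨⟩-cancelʳ : ∀ {u v x y} → (x + y) ∈⟨ u , v ⟩ → y ∈⟨ u , v ⟩ → x ∈⟨ u , v ⟩
  ∈⟨⟩-cancelʳ {x = x} {y} x+y∈ y∈ = ∈⟨⟩-resp-≈ (begin
    (x + y) + - y  ≈⟨ +-assoc x y (- y) ⟩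
    x + (y + - y)  ≈⟨ +-congˡ (-‿inverseʳ y) ⟩
    x + 0#         ≈⟨ +-identityʳ x ⟩
    x              ∎) (∈⟨⟩-+ x+y∈ (∈⟨⟩-neg y∈))

  ∈⟨⟩-∣ˡ : ∀ {u v x} → u ∣ᴿ x → x ∈⟨ u , v ⟩
  ∈⟨⟩-∣ˡ {u} {v} (q , x≈) = q , 0# , ≈-trans x≈ (solve 3 (λ u v q → q :* u := q :* u :+ con 0 :* v) ≈-refl u v q)

  ∈⟨⟩-swap : ∀ {u v x} → x ∈⟨ u , v ⟩ → x ∈⟨ v , u ⟩
  ∈⟨⟩-swap (a , b , x≈) = b , a , ≈-trans x≈ (+-comm _ _)

  comaximal-1# : ∀ u → Comaximal u 1#
  comaximal-1# u = 0# , 1# , solve 1 (λ u → con 1 := con 0 :* u :+ con 1 :* con 1) ≈-refl u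

  comaximal-* : ∀ {u v w} → Comaximal u v → Comaximal u w → Comaximal u (v * w)
  comaximal-* {u} {v} {w} (a , b , p) (a′ , b′ , q) = a * (a′ * u + b′ * w) + b * v * a′ , b * b′ , (begin
    1#                                     ≈⟨ *-identityˡ 1# ⟨
    1# * 1#                                ≈⟨ *-cong p q ⟩
    (a * u + b * v) * (a′ * u + b′ * w)    ≈⟨ solve 7 (λ u v w a b c d → (a :* u :+ b :* v) :* (c :* u :+ d :* w)
                                                := (a :* (c :* u :+ d :* w) :+ b :* v :* c) :* u :+ b :* d :* (v :* w))
                                                ≈-refl u v w a b a′ b′ ⟩
    (a * (a′ * u + b′ * w) + b * v * a′) * u + b * b′ * (v * w) ∎)

  -- In w = a u w + b v w, the first `w` is replaced by a multiple of `v` and the second by a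
  -- multiple of `u`.
  comaximal-∣ : ∀ {u v w} → Comaximal u v → u ∣ᴿ w → v ∣ᴿ w → (u * v) ∣ᴿ w
  comaximal-∣ {u} {v} {w} (a , b , p) (q , w≈qu) (r , w≈rv) = a * r + b * q , (begin
    w                              ≈⟨ *-identityˡ w ⟨
    1# * w                         ≈⟨ *-congʳ p ⟩
    (a * u + b * v) * w            ≈⟨ distribʳ w (a * u) (b * v) ⟩
    a * u * w + b * v * w          ≈⟨ +-cong (*-congˡ w≈rv) (*-congˡ w≈qu) ⟩
    a * u * (r * v) + b * v * (q * u) ≈⟨ solve 6 (λ u v a b q r → a :* u :* (r :* v) :+ b :* v :* (q :* u) := (a :* r :+ b :* q) :* (u :* v)) ≈-refl u v a b q r ⟩
    (a * r + b * q) * (u * v)      ∎)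

  module _ {i} {I : Set i} (f : I → Carrier) where

    comaximal-∏ : ∀ {u} is → All (Comaximal u ∘ f) is → Comaximal u (∏ f is)
    comaximal-∏ []       []       = comaximal-1# _
    comaximal-∏ (i ∷ is) (p ∷ ps) = comaximal-* p (comaximal-∏ is ps)

    ∏-∣ : ∀ {w} {is} → AllPairs (λ i j → Comaximal (f i) (f j)) is → All ((_∣ᴿ w) ∘ f) is → ∏ f is ∣ᴿ w
    ∏-∣ {w} []         []        = w , ≈-sym (*-identityʳ w)
    ∏-∣ (pi ∷ ps) (q ∷ qs) = comaximal-∣ (comaximal-∏ _ pi) q (∏-∣ ps qs)

    -- Each entry of `is` is removed once from `js`; since `is` has no repetitions, the removal
    -- never takes away an entry that is still to be matched.
    ∏-⊆-∣ : ∀ {is js} → Unique is → (∀ {i} → i ∈ is → i ∈ js) → ∏ f is ∣ᴿ ∏ f js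
    ∏-⊆-∣ {[]}     {js} []       sub = ∏ f js , ≈-sym (*-identityʳ _)
    ∏-⊆-∣ {i ∷ is} {js} (i∉ ∷ u) sub with ∈-∃++ (sub (here ≡.refl))
    ... | ys , zs , ≡.refl = q , (begin
      ∏ f (ys ++ i ∷ zs)   ≈⟨ ∏-↭ f (shift i ys zs) ⟩
      f i * ∏ f (ys ++ zs) ≈⟨ *-congˡ eq ⟩
      f i * (q * ∏ f is)   ≈⟨ solve 3 (λ a b c → a :* (b :* c) := b :* (a :* c)) ≈-refl _ _ _ ⟩
      q * (f i * ∏ f is)   ∎)
      where
      open import Data.List.Relation.Binary.Permutation.Propositional.Properties using (shift)
      drop-i : ∀ {j} → j ∈ is → j ∈ ys ++ zs
      drop-i {j} j∈ with ∈-++⁻ ys (sub (there j∈))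
      ... | inj₁ j∈ys            = ∈-++⁺ˡ j∈ys
      ... | inj₂ (here j≡i)      = contradiction (≡.sym j≡i) (All.lookup i∉ j∈)
      ... | inj₂ (there j∈zs)    = ∈-++⁺ʳ ys j∈zs
      rest : ∏ f is ∣ᴿ ∏ f (ys ++ zs)
      rest = ∏-⊆-∣ u drop-i
      q = proj₁ rest
      eq = proj₂ rest

-- The ring ℤ[x]

coeff-+ : ∀ P Q i → coeff (P +ₚ Q) i ≡ coeff P i ℤ.+ coeff Q i
coeff-+ []      Q       i       = ≡.sym (ℤₚ.+-identityˡ _)
coeff-+ (a ∷ P) []      i       = ≡.sym (ℤₚ.+-identityʳ _)
coeff-+ (a ∷ P) (b ∷ Q) zero    = ≡.refl
coeff-+ (a ∷ P) (b ∷ Q) (suc i) = coeff-+ P Q i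

coeff-scale : ∀ c P i → coeff (scaleₚ c P) i ≡ c ℤ.* coeff P i
coeff-scale c []      i       = ≡.sym (ℤₚ.*-zeroʳ c)
coeff-scale c (a ∷ P) zero    = ≡.refl
coeff-scale c (a ∷ P) (suc i) = coeff-scale c P i

coeff-*-zero : ∀ a P Q → coeff ((a ∷ P) *ₚ Q) 0 ≡ a ℤ.* coeff Q 0
coeff-*-zero a P Q = begin
  coeff (scaleₚ a Q +ₚ (+ 0 ∷ P *ₚ Q)) 0  ≡⟨ coeff-+ (scaleₚ a Q) (+ 0 ∷ P *ₚ Q) 0 ⟩
  coeff (scaleₚ a Q) 0 ℤ.+ + 0            ≡⟨ ℤₚ.+-identityʳ _ ⟩
  coeff (scaleₚ a Q) 0                    ≡⟨ coeff-scale a Q 0 ⟩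
  a ℤ.* coeff Q 0                         ∎
  where open ≡-Reasoning

coeff-*-suc : ∀ a P Q i → coeff ((a ∷ P) *ₚ Q) (suc i) ≡ a ℤ.* coeff Q (suc i) ℤ.+ coeff (P *ₚ Q) i
coeff-*-suc a P Q i =
  ≡.trans (coeff-+ (scaleₚ a Q) (+ 0 ∷ P *ₚ Q) (suc i)) (cong (ℤ._+ coeff (P *ₚ Q) i) (coeff-scale a Q (suc i)))

infix 4 _≋_

-- _≈ₚ_ computes to a family of integer equations, from which the two polynomials cannot be
-- inferred; the record makes them inferable.
record _≋_ (P Q : Poly) : Set where
  constructor pointwise
  field at : P ≈ₚ Q

open _≋_ public

module PolyRing where
  open ≡-Reasoning
  open import Data.Integer.Tactic.RingSolver using (solve-∀)

  refl-≋ : ∀ P → P ≋ P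
  refl-≋ P .at i = ≡.refl

  +ₚ-cong : ∀ {P P′ Q Q′} → P ≋ P′ → Q ≋ Q′ → (P +ₚ Q) ≋ (P′ +ₚ Q′)
  +ₚ-cong {P} {P′} {Q} {Q′} eq eq′ .at i = begin
    coeff (P +ₚ Q) i            ≡⟨ coeff-+ P Q i ⟩
    coeff P i ℤ.+ coeff Q i     ≡⟨ cong₂ ℤ._+_ (eq .at i) (eq′ .at i) ⟩
    coeff P′ i ℤ.+ coeff Q′ i   ≡⟨ coeff-+ P′ Q′ i ⟨
    coeff (P′ +ₚ Q′) i          ∎

  scaleₚ-cong : ∀ c {P P′} → P ≋ P′ → scaleₚ c P ≋ scaleₚ c P′
  scaleₚ-cong c {P} {P′} eq .at i = begin
    coeff (scaleₚ c P) i   ≡⟨ coeff-scale c P i ⟩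
    c ℤ.* coeff P i        ≡⟨ cong (c ℤ.*_) (eq .at i) ⟩
    c ℤ.* coeff P′ i       ≡⟨ coeff-scale c P′ i ⟨
    coeff (scaleₚ c P′) i  ∎

  ∷-cong : ∀ c {P P′} → P ≋ P′ → (c ∷ P) ≋ (c ∷ P′)
  ∷-cong c eq .at zero = ≡.refl
  ∷-cong c eq .at (suc i) = eq .at i

  +ₚ-comm : ∀ P Q → (P +ₚ Q) ≋ (Q +ₚ P)
  +ₚ-comm P Q .at i = begin
    coeff (P +ₚ Q) i          ≡⟨ coeff-+ P Q i ⟩
    coeff P i ℤ.+ coeff Q i   ≡⟨ ℤₚ.+-comm (coeff P i) (coeff Q i) ⟩
    coeff Q i ℤ.+ coeff P i   ≡⟨ coeff-+ Q P i ⟨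
    coeff (Q +ₚ P) i          ∎

  +ₚ-assoc : ∀ P Q S → ((P +ₚ Q) +ₚ S) ≋ (P +ₚ (Q +ₚ S))
  +ₚ-assoc P Q S .at i = begin
    coeff ((P +ₚ Q) +ₚ S) i                   ≡⟨ coeff-+ (P +ₚ Q) S i ⟩
    coeff (P +ₚ Q) i ℤ.+ coeff S i            ≡⟨ cong (ℤ._+ coeff S i) (coeff-+ P Q i) ⟩
    coeff P i ℤ.+ coeff Q i ℤ.+ coeff S i     ≡⟨ ℤₚ.+-assoc (coeff P i) (coeff Q i) (coeff S i) ⟩
    coeff P i ℤ.+ (coeff Q i ℤ.+ coeff S i)   ≡⟨ cong (λ z → coeff P i ℤ.+ z) (coeff-+ Q S i) ⟨
    coeff P i ℤ.+ coeff (Q +ₚ S) i            ≡⟨ coeff-+ P (Q +ₚ S) i ⟨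
    coeff (P +ₚ (Q +ₚ S)) i                   ∎

  +ₚ-identityʳ : ∀ P → (P +ₚ []) ≋ P
  +ₚ-identityʳ P .at i = ≡.trans (coeff-+ P [] i) (ℤₚ.+-identityʳ _)

  negₚ-inverseʳ : ∀ P → (P +ₚ negₚ P) ≋ []
  negₚ-inverseʳ P .at i = begin
    coeff (P +ₚ negₚ P) i                        ≡⟨ coeff-+ P (negₚ P) i ⟩
    coeff P i ℤ.+ coeff (negₚ P) i               ≡⟨ cong (λ z → coeff P i ℤ.+ z) (coeff-scale (ℤ.- (+ 1)) P i) ⟩
    coeff P i ℤ.+ (ℤ.- (+ 1)) ℤ.* coeff P i      ≡⟨ lemma (coeff P i) ⟩
    + 0                                          ∎
    where
    lemma : ∀ x → x ℤ.+ (ℤ.- (+ 1)) ℤ.* x ≡ + 0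
    lemma = solve-∀

  *ₚ-congˡ : ∀ P {Q Q′} → Q ≋ Q′ → (P *ₚ Q) ≋ (P *ₚ Q′)
  *ₚ-congˡ []      eq = refl-≋ []
  *ₚ-congˡ (a ∷ P) eq = +ₚ-cong (scaleₚ-cong a eq) (∷-cong (+ 0) (*ₚ-congˡ P eq))

  *ₚ-zeroʳ : ∀ P → (P *ₚ []) ≋ []
  *ₚ-zeroʳ [] .at i = ≡.refl
  *ₚ-zeroʳ (a ∷ P) .at zero = ≡.refl
  *ₚ-zeroʳ (a ∷ P) .at (suc i) = *ₚ-zeroʳ P .at i

  *ₚ-distribˡ : ∀ P Q S → (P *ₚ (Q +ₚ S)) ≋ ((P *ₚ Q) +ₚ (P *ₚ S))
  *ₚ-distribˡ []      Q S .at i = ≡.refl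
  *ₚ-distribˡ (a ∷ P) Q S .at zero = begin
    coeff ((a ∷ P) *ₚ (Q +ₚ S)) 0                     ≡⟨ coeff-*-zero a P (Q +ₚ S) ⟩
    a ℤ.* coeff (Q +ₚ S) 0                            ≡⟨ cong (a ℤ.*_) (coeff-+ Q S 0) ⟩
    a ℤ.* (coeff Q 0 ℤ.+ coeff S 0)                   ≡⟨ ℤₚ.*-distribˡ-+ a (coeff Q 0) (coeff S 0) ⟩
    a ℤ.* coeff Q 0 ℤ.+ a ℤ.* coeff S 0               ≡⟨ cong₂ ℤ._+_ (coeff-*-zero a P Q) (coeff-*-zero a P S) ⟨
    coeff ((a ∷ P) *ₚ Q) 0 ℤ.+ coeff ((a ∷ P) *ₚ S) 0 ≡⟨ coeff-+ ((a ∷ P) *ₚ Q) ((a ∷ P) *ₚ S) 0 ⟨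
    coeff (((a ∷ P) *ₚ Q) +ₚ ((a ∷ P) *ₚ S)) 0        ∎
  *ₚ-distribˡ (a ∷ P) Q S .at (suc i) = begin
    coeff ((a ∷ P) *ₚ (Q +ₚ S)) (suc i)
      ≡⟨ coeff-*-suc a P (Q +ₚ S) i ⟩
    a ℤ.* coeff (Q +ₚ S) (suc i) ℤ.+ coeff (P *ₚ (Q +ₚ S)) i
      ≡⟨ cong₂ (λ y z → a ℤ.* y ℤ.+ z) (coeff-+ Q S (suc i)) (≡.trans (*ₚ-distribˡ P Q S .at i) (coeff-+ (P *ₚ Q) (P *ₚ S) i)) ⟩
    a ℤ.* (coeff Q (suc i) ℤ.+ coeff S (suc i)) ℤ.+ (coeff (P *ₚ Q) i ℤ.+ coeff (P *ₚ S) i)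
      ≡⟨ lemma a _ _ _ _ ⟩
    (a ℤ.* coeff Q (suc i) ℤ.+ coeff (P *ₚ Q) i) ℤ.+ (a ℤ.* coeff S (suc i) ℤ.+ coeff (P *ₚ S) i)
      ≡⟨ cong₂ ℤ._+_ (coeff-*-suc a P Q i) (coeff-*-suc a P S i) ⟨
    coeff ((a ∷ P) *ₚ Q) (suc i) ℤ.+ coeff ((a ∷ P) *ₚ S) (suc i)
      ≡⟨ coeff-+ ((a ∷ P) *ₚ Q) ((a ∷ P) *ₚ S) (suc i) ⟨
    coeff (((a ∷ P) *ₚ Q) +ₚ ((a ∷ P) *ₚ S)) (suc i) ∎
    where
    lemma : ∀ a q s u v → a ℤ.* (q ℤ.+ s) ℤ.+ (u ℤ.+ v) ≡ (a ℤ.* q ℤ.+ u) ℤ.+ (a ℤ.* s ℤ.+ v)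
    lemma = solve-∀

  -- The mirror image of the recursion of `_*ₚ_`, which runs along the left factor. It is the
  -- inductive step of commutativity, from which right distributivity and congruence in the left
  -- factor follow.
  *ₚ-∷ʳ : ∀ P b Q → (P *ₚ (b ∷ Q)) ≋ (scaleₚ b P +ₚ (+ 0 ∷ P *ₚ Q))
  *ₚ-∷ʳ []      b Q .at zero = ≡.refl
  *ₚ-∷ʳ []      b Q .at (suc i) = ≡.refl
  *ₚ-∷ʳ (a ∷ P) b Q .at zero = cong (ℤ._+ + 0) (ℤₚ.*-comm a b)
  *ₚ-∷ʳ (a ∷ P) b Q .at (suc i) = begin
    coeff ((a ∷ P) *ₚ (b ∷ Q)) (suc i)
      ≡⟨ coeff-*-suc a P (b ∷ Q) i ⟩
    a ℤ.* coeff Q i ℤ.+ coeff (P *ₚ (b ∷ Q)) i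
      ≡⟨ cong (λ z → a ℤ.* coeff Q i ℤ.+ z) (≡.trans (*ₚ-∷ʳ P b Q .at i) (coeff-+ (scaleₚ b P) _ i)) ⟩
    a ℤ.* coeff Q i ℤ.+ (coeff (scaleₚ b P) i ℤ.+ coeff (+ 0 ∷ P *ₚ Q) i)
      ≡⟨ lemma (a ℤ.* coeff Q i) (coeff (scaleₚ b P) i) (coeff (+ 0 ∷ P *ₚ Q) i) ⟩
    coeff (scaleₚ b P) i ℤ.+ (a ℤ.* coeff Q i ℤ.+ coeff (+ 0 ∷ P *ₚ Q) i)
      ≡⟨ cong (λ z → coeff (scaleₚ b P) i ℤ.+ (z ℤ.+ coeff (+ 0 ∷ P *ₚ Q) i)) (coeff-scale a Q i) ⟨
    coeff (scaleₚ b P) i ℤ.+ (coeff (scaleₚ a Q) i ℤ.+ coeff (+ 0 ∷ P *ₚ Q) i)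
      ≡⟨ cong (λ z → coeff (scaleₚ b P) i ℤ.+ z) (coeff-+ (scaleₚ a Q) _ i) ⟨
    coeff (scaleₚ b P) i ℤ.+ coeff ((a ∷ P) *ₚ Q) i
      ≡⟨ coeff-+ (scaleₚ b P) _ i ⟨
    coeff (scaleₚ b P +ₚ ((a ∷ P) *ₚ Q)) i ∎
    where
    lemma : ∀ x y z → x ℤ.+ (y ℤ.+ z) ≡ y ℤ.+ (x ℤ.+ z)
    lemma = solve-∀

  trans-≋ : ∀ {P Q S} → P ≋ Q → Q ≋ S → P ≋ S
  trans-≋ p q .at i = ≡.trans (p .at i) (q .at i)

  sym-≋ : ∀ {P Q} → P ≋ Q → Q ≋ P
  sym-≋ p .at i = ≡.sym (p .at i)

  *ₚ-comm : ∀ P Q → (P *ₚ Q) ≋ (Q *ₚ P)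
  *ₚ-comm []      Q = sym-≋ (*ₚ-zeroʳ Q)
  *ₚ-comm (a ∷ P) Q = trans-≋ (+ₚ-cong (refl-≋ (scaleₚ a Q)) (∷-cong (+ 0) (*ₚ-comm P Q))) (sym-≋ (*ₚ-∷ʳ Q a P))

  *ₚ-distribʳ : ∀ P Q S → ((Q +ₚ S) *ₚ P) ≋ ((Q *ₚ P) +ₚ (S *ₚ P))
  *ₚ-distribʳ P Q S = trans-≋ (*ₚ-comm (Q +ₚ S) P) (trans-≋ (*ₚ-distribˡ P Q S) (+ₚ-cong (*ₚ-comm P Q) (*ₚ-comm P S)))

  *ₚ-cong : ∀ {P P′ Q Q′} → P ≋ P′ → Q ≋ Q′ → (P *ₚ Q) ≋ (P′ *ₚ Q′)
  *ₚ-cong {P} {P′} {Q} {Q′} eq eq′ = trans-≋ (*ₚ-congˡ P eq′)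
    (trans-≋ (*ₚ-comm P Q′) (trans-≋ (*ₚ-congˡ Q′ eq) (*ₚ-comm Q′ P′)))

  scaleₚ-*ₚ : ∀ c P Q → (scaleₚ c P *ₚ Q) ≋ scaleₚ c (P *ₚ Q)
  scaleₚ-*ₚ c []      Q .at i = ≡.refl
  scaleₚ-*ₚ c (a ∷ P) Q .at zero = begin
    coeff (scaleₚ c (a ∷ P) *ₚ Q) 0   ≡⟨ coeff-*-zero (c ℤ.* a) (scaleₚ c P) Q ⟩
    c ℤ.* a ℤ.* coeff Q 0             ≡⟨ ℤₚ.*-assoc c a (coeff Q 0) ⟩
    c ℤ.* (a ℤ.* coeff Q 0)           ≡⟨ cong (c ℤ.*_) (coeff-*-zero a P Q) ⟨
    c ℤ.* coeff ((a ∷ P) *ₚ Q) 0      ≡⟨ coeff-scale c ((a ∷ P) *ₚ Q) 0 ⟨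
    coeff (scaleₚ c ((a ∷ P) *ₚ Q)) 0 ∎
  scaleₚ-*ₚ c (a ∷ P) Q .at (suc i) = begin
    coeff (scaleₚ c (a ∷ P) *ₚ Q) (suc i)
      ≡⟨ coeff-*-suc (c ℤ.* a) (scaleₚ c P) Q i ⟩
    c ℤ.* a ℤ.* coeff Q (suc i) ℤ.+ coeff (scaleₚ c P *ₚ Q) i
      ≡⟨ cong (λ z → c ℤ.* a ℤ.* coeff Q (suc i) ℤ.+ z) (≡.trans (scaleₚ-*ₚ c P Q .at i) (coeff-scale c (P *ₚ Q) i)) ⟩
    c ℤ.* a ℤ.* coeff Q (suc i) ℤ.+ c ℤ.* coeff (P *ₚ Q) i
      ≡⟨ lemma c a _ _ ⟩
    c ℤ.* (a ℤ.* coeff Q (suc i) ℤ.+ coeff (P *ₚ Q) i)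
      ≡⟨ cong (c ℤ.*_) (coeff-*-suc a P Q i) ⟨
    c ℤ.* coeff ((a ∷ P) *ₚ Q) (suc i)
      ≡⟨ coeff-scale c ((a ∷ P) *ₚ Q) (suc i) ⟨
    coeff (scaleₚ c ((a ∷ P) *ₚ Q)) (suc i) ∎
    where
    lemma : ∀ c a x y → c ℤ.* a ℤ.* x ℤ.+ c ℤ.* y ≡ c ℤ.* (a ℤ.* x ℤ.+ y)
    lemma = solve-∀

  0∷-*ₚ : ∀ P Q → ((+ 0 ∷ P) *ₚ Q) ≋ (+ 0 ∷ P *ₚ Q)
  0∷-*ₚ P Q .at zero = coeff-*-zero (+ 0) P Q
  0∷-*ₚ P Q .at (suc i) = ≡.trans (coeff-*-suc (+ 0) P Q i) (ℤₚ.+-identityˡ _)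

  *ₚ-assoc : ∀ P Q S → ((P *ₚ Q) *ₚ S) ≋ (P *ₚ (Q *ₚ S))
  *ₚ-assoc []      Q S = refl-≋ []
  *ₚ-assoc (a ∷ P) Q S = trans-≋ (*ₚ-distribʳ S (scaleₚ a Q) (+ 0 ∷ P *ₚ Q))
    (+ₚ-cong (scaleₚ-*ₚ a Q S) (trans-≋ (0∷-*ₚ (P *ₚ Q) S) (∷-cong (+ 0) (*ₚ-assoc P Q S))))

  constₚ-*ₚ : ∀ c P → (constₚ c *ₚ P) ≋ scaleₚ c P
  constₚ-*ₚ c P .at zero = ≡.trans (coeff-*-zero c [] P) (≡.sym (coeff-scale c P 0))
  constₚ-*ₚ c P .at (suc i) = ≡.trans (coeff-*-suc c [] P i) (≡.trans (ℤₚ.+-identityʳ _) (≡.sym (coeff-scale c P (suc i))))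

  *ₚ-identityˡ : ∀ P → (constₚ (+ 1) *ₚ P) ≋ P
  *ₚ-identityˡ P .at i = ≡.trans (constₚ-*ₚ (+ 1) P .at i) (≡.trans (coeff-scale (+ 1) P i) (ℤₚ.*-identityˡ _))

  ℤ[x] : CommutativeRing 0ℓ 0ℓ
  ℤ[x] = record
    { Carrier = Poly
    ; _≈_     = _≋_
    ; _+_     = _+ₚ_
    ; _*_     = _*ₚ_
    ; -_      = negₚ
    ; 0#      = []
    ; 1#      = constₚ (+ 1)
    ; isCommutativeRing = record
      { isRing = record
        { +-isAbelianGroup = record
          { isGroup = record
            { isMonoid = record
              { isSemigroup = record
                { isMagma = record
                  { isEquivalence = record { refl = refl-≋ _ ; sym = sym-≋ ; trans = trans-≋ }
                  ; ∙-cong = +ₚ-cong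
                  }
                ; assoc = +ₚ-assoc
                }
              ; identity = refl-≋ , +ₚ-identityʳ
              }
            ; inverse = (λ P → trans-≋ (+ₚ-comm (negₚ P) P) (negₚ-inverseʳ P)) , negₚ-inverseʳ
            ; ⁻¹-cong = scaleₚ-cong (ℤ.- (+ 1))
            }
          ; comm = +ₚ-comm
          }
        ; *-cong = *ₚ-cong
        ; *-assoc = *ₚ-assoc
        ; *-identity = *ₚ-identityˡ , λ P → trans-≋ (*ₚ-comm P (constₚ (+ 1))) (*ₚ-identityˡ P)
        ; distrib = *ₚ-distribˡ , *ₚ-distribʳ
        }
      ; *-comm = *ₚ-comm
      }
    }

open PolyRing using (ℤ[x]) public

-- Pairwise comaximality of the cyclotomic factors

∈-range1⁺ : ∀ {n d} → 1 ≤ d → d ≤ n → d ∈ range1 n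
∈-range1⁺ {d = suc d} _ d<n = ∈-map⁺ suc (∈-upTo⁺ d<n)

∈-range1⁻ : ∀ {n d} → d ∈ range1 n → 1 ≤ d × d ≤ n
∈-range1⁻ d∈ with ∈-map⁻ suc d∈
... | i , i∈ , ≡.refl = s≤s z≤n , ∈-upTo⁻ i∈

range1-unique : ∀ n → Unique (range1 n)
range1-unique n = Unique.map⁺ ℕₚ.suc-injective (Unique.upTo⁺ n)

∈-divisors⁺ : ∀ {n d} → 1 ≤ n → d ∣ n → d ∈ divisors n
∈-divisors⁺ {n} {zero} 1≤n d∣n = contradiction (ℕ.0∣⇒≡0 d∣n) (ℕₚ.m<n⇒n≢0 1≤n)
∈-divisors⁺ {suc n} {suc d} 1≤n d∣n = ∈-filter⁺ (ℕ._∣? suc n) (∈-range1⁺ (s≤s z≤n) (ℕ.∣⇒≤ d∣n)) d∣n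

∈-divisors⁻ : ∀ {n d} → d ∈ divisors n → 1 ≤ d × d ≤ n × d ∣ n
∈-divisors⁻ {n} d∈ with ∈-filter⁻ (ℕ._∣? n) {xs = range1 n} d∈
... | d∈range , d∣n = let 1≤d , d≤n = ∈-range1⁻ d∈range in 1≤d , d≤n , d∣n

divisors-unique : ∀ n → Unique (divisors n)
divisors-unique n = Unique.filter⁺ (ℕ._∣? n) (range1-unique n)

properDivisors : ℕ → List ℕ
properDivisors m = filter (λ d → d ℕ.<? m) (divisors m)

∈-properDivisors⁺ : ∀ {n d} → 1 ≤ n → d ∣ n → d < n → d ∈ properDivisors n
∈-properDivisors⁺ {n} 1≤n d∣n d<n = ∈-filter⁺ (λ d → d ℕ.<? n) (∈-divisors⁺ 1≤n d∣n) d<n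

∈-properDivisors⁻ : ∀ {n d} → d ∈ properDivisors n → 1 ≤ d × d < n × d ∣ n
∈-properDivisors⁻ {n} d∈ with ∈-filter⁻ (λ d → d ℕ.<? n) {xs = divisors n} d∈
... | d∈div , d<n = let 1≤d , _ , d∣n = ∈-divisors⁻ d∈div in 1≤d , d<n , d∣n

properDivisors-unique : ∀ n → Unique (properDivisors n)
properDivisors-unique n = Unique.filter⁺ (λ d → d ℕ.<? n) (divisors-unique n)

module PowersMinusOne {c ℓ} (R : CommutativeRing c ℓ) (x : CommutativeRing.Carrier R) where
  open CommutativeRing R renaming (refl to ≈-refl; trans to ≈-trans; sym to ≈-sym)
  open Comaximality R
  open import Algebra.Properties.Ring ring using (+-cancelʳ)
  open import Algebra.Definitions.RawSemiring (Semiring.rawSemiring semiring) using () renaming (_×_ to _·_; _^_ to _↑_)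
  open import Algebra.Properties.Semiring.Exp semiring using (^-homo-*)
  open import Algebra.Solver.Ring.NaturalCoefficients.Default commutativeSemiring
  open import Relation.Binary.Reasoning.Setoid setoid

  U : ℕ → Carrier
  U k = x ↑ k + - 1#

  U+1 : ∀ k → U k + 1# ≈ x ↑ k
  U+1 k = begin
    (x ↑ k + - 1#) + 1#  ≈⟨ +-assoc (x ↑ k) (- 1#) 1# ⟩
    x ↑ k + (- 1# + 1#)  ≈⟨ +-congˡ (-‿inverseˡ 1#) ⟩
    x ↑ k + 0#           ≈⟨ +-identityʳ (x ↑ k) ⟩
    x ↑ k                ∎

  U-zero : U 0 ≈ 0#
  U-zero = -‿inverseʳ 1#

  -- This is (u + 1)(v + 1) - 1 expanded; adding 1 to both sides removes the subtraction and leaves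
  -- an identity for the semiring solver.
  U-+ : ∀ b c → U (b ℕ.+ c) ≈ U c + (U c + 1#) * U b
  U-+ b c = +-cancelʳ 1# _ _ (begin
    U (b ℕ.+ c) + 1#             ≈⟨ U+1 (b ℕ.+ c) ⟩
    x ↑ (b ℕ.+ c)                ≈⟨ ^-homo-* x b c ⟩
    x ↑ b * x ↑ c                ≈⟨ *-cong (U+1 b) (U+1 c) ⟨
    (U b + 1#) * (U c + 1#)      ≈⟨ solve 2 (λ u v → (u :+ con 1) :* (v :+ con 1) := (v :+ (v :+ con 1) :* u) :+ con 1) ≈-refl (U b) (U c) ⟩
    (U c + (U c + 1#) * U b) + 1# ∎)

  -- `e` is the geometric sum 1 + x^g + ... + x^((t-1)g). Each of its `t` terms is 1 modulo x^g - 1,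
  -- which gives the second equation.
  U-geometric : ∀ g t → ∃₂ λ e e′ → U (t ℕ.* g) ≈ U g * e × e ≈ t · 1# + U g * e′
  U-geometric g zero = 0# , 0# , ≈-trans U-zero (≈-sym (zeroʳ (U g))) ,
    solve 1 (λ u → con 0 := con 0 :+ u :* con 0) ≈-refl (U g)
  U-geometric g (suc t) with U-geometric g t
  -- `U g * e + 1#` is the next term x^(tg) of the geometric sum.
  ... | e , e′ , Utg≈ , e≈ = e + (U g * e + 1#) , e′ + e ,
    (begin
      U (g ℕ.+ t ℕ.* g)                          ≈⟨ U-+ g (t ℕ.* g) ⟩
      U (t ℕ.* g) + (U (t ℕ.* g) + 1#) * U g     ≈⟨ +-cong Utg≈ (*-congʳ (+-congʳ Utg≈)) ⟩
      U g * e + (U g * e + 1#) * U g             ≈⟨ solve 2 (λ u e → u :* e :+ (u :* e :+ con 1) :* u := u :* (e :+ (u :* e :+ con 1))) ≈-refl (U g) e ⟩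
      U g * (e + (U g * e + 1#))                 ∎) ,
    (begin
      e + (U g * e + 1#)                         ≈⟨ +-congʳ e≈ ⟩
      (t · 1# + U g * e′) + (U g * e + 1#)       ≈⟨ solve 4 (λ n u e e′ → (n :+ u :* e′) :+ (u :* e :+ con 1) := (con 1 :+ n) :+ u :* (e′ :+ e)) ≈-refl (t · 1#) (U g) e e′ ⟩
      (1# + t · 1#) + U g * (e′ + e)             ∎)

  U-∣ : ∀ {d m} → d ∣ m → U d ∣ᴿ U m
  U-∣ {d} (ℕ.divides t ≡.refl) = let e , _ , eq , _ = U-geometric d t in e , ≈-trans eq (*-comm (U d) e)

  module _ {u v : Carrier} where

    U-∈-multiple : ∀ k b → U b ∈⟨ u , v ⟩ → U (k ℕ.* b) ∈⟨ u , v ⟩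
    U-∈-multiple k b Ub∈ = let e , _ , eq , _ = U-geometric b k in
      ∈⟨⟩-resp-≈ (≈-trans (*-comm e (U b)) (≈-sym eq)) (∈⟨⟩-* e Ub∈)

    U-∈-difference : ∀ b c {k} → c ℕ.+ b ≡ k → U k ∈⟨ u , v ⟩ → U b ∈⟨ u , v ⟩ → U c ∈⟨ u , v ⟩
    U-∈-difference b c ≡.refl Uk∈ Ub∈ =
      ∈⟨⟩-cancelʳ (∈⟨⟩-resp-≈ (≈-trans (reflexive (cong U (ℕₚ.+-comm c b))) (U-+ b c)) Uk∈) (∈⟨⟩-* (U c + 1#) Ub∈)

    -- The exponents k with x^k - 1 in a given ideal are closed under multiples and differences, and
    -- Bézout's identity writes the gcd as a difference of multiples of `a` and `b`, in one order or
    -- the other.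
    U-∈-gcd : ∀ a b → U a ∈⟨ u , v ⟩ → U b ∈⟨ u , v ⟩ → U (ℕ.gcd a b) ∈⟨ u , v ⟩
    U-∈-gcd a b Ua∈ Ub∈ with ℕ.Bézout.identity (ℕ.gcd-GCD a b)
    ... | ℕ.Bézout.+- y z eq = U-∈-difference (z ℕ.* b) (ℕ.gcd a b) eq (U-∈-multiple y a Ua∈) (U-∈-multiple z b Ub∈)
    ... | ℕ.Bézout.-+ y z eq = U-∈-difference (y ℕ.* a) (ℕ.gcd a b) eq (U-∈-multiple z b Ub∈) (U-∈-multiple y a Ua∈)

  -- The induction is kept apart from polynomial division. `divide` is the only access to the
  -- division: it turns divisibility of x^m - 1 by the product of the lower factors into a
  -- factorisation with `Φ m`. `Q` is what the division must know of those factors; it becomes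
  -- monicity.
  module CyclotomicFactors
    (Φ : ℕ → Carrier) (M : ℕ) {q} (Q : ℕ → Set q)
    (U-cancel : ∀ {k y z} → 1 ≤ k → U k * y ≈ U k * z → y ≈ z)
    (invertible : ∀ {k} → 1 ≤ k → k ≤ M → ∃ λ i → i * (k · 1#) ≈ 1#)
    (divide : ∀ {m} → 1 ≤ m → (∀ {d} → d ∈ properDivisors m → Q d) → ∏ Φ (properDivisors m) ∣ᴿ U m →
      U m ≈ Φ m * ∏ Φ (properDivisors m) × Q m)
    where

    Factors : ℕ → Set _
    Factors m = U m ≈ Φ m * ∏ Φ (properDivisors m) × Q m

    Φ∣U : ∀ m → Factors m → Φ m ∣ᴿ U m
    Φ∣U m (eq , _) = _ , ≈-trans eq (*-comm _ _)

    -- With a = t g, Φ a divides U a / U g, which is congruent to t modulo U g.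
    comaximal-below : ∀ {a b} → 1 ≤ a → a ≤ M → Factors a → Factors b → Factors (ℕ.gcd a b) → 1 ≤ ℕ.gcd a b → ℕ.gcd a b < a →
      Comaximal (Φ a) (Φ b)
    comaximal-below {a} {b} 1≤a a≤M Fa Fb Fg 1≤g g<a with ℕ.gcd a b in g≡ | ℕ.gcd[m,n]∣m a b
    ... | g | ℕ.divides t a≡tg = ∈⟨⟩-resp-≈ (proj₂ (invertible 1≤t t≤M)) (∈⟨⟩-* _ t∈)
      where
      1≤t : 1 ≤ t
      1≤t = ℕₚ.n≢0⇒n>0 λ { ≡.refl → ℕₚ.m<n⇒n≢0 1≤a a≡tg }
      t≤M : t ≤ M
      t≤M = ℕₚ.≤-trans (subst (t ≤_) (≡.sym a≡tg) (ℕₚ.m≤m*n t g {{ℕ.>-nonZero 1≤g}})) a≤M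
      e = proj₁ (U-geometric g t)
      e′ = proj₁ (proj₂ (U-geometric g t))
      e≈ = proj₂ (proj₂ (proj₂ (U-geometric g t)))
      -- All divisors of `g`, including `g`, are proper divisors of `a`. Their Φ multiply to `U g`,
      -- which is therefore a factor of the product by which `Φ a` is multiplied to give `U a`.
      g∷proper⊆ : ∀ {d} → d ∈ g ∷ properDivisors g → d ∈ properDivisors a
      g∷proper⊆ (here ≡.refl) = ∈-properDivisors⁺ 1≤a (ℕ.divides t a≡tg) g<a
      g∷proper⊆ (there d∈) = let _ , d<g , d∣g = ∈-properDivisors⁻ d∈ in
        ∈-properDivisors⁺ 1≤a (ℕ.∣-trans d∣g (ℕ.divides t a≡tg)) (ℕₚ.<-trans d<g g<a)
      g∷proper-unique : Unique (g ∷ properDivisors g)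
      g∷proper-unique = All.tabulate (λ d∈ g≡d → ℕₚ.<⇒≢ (proj₁ (proj₂ (∈-properDivisors⁻ d∈))) (≡.sym g≡d)) ∷ properDivisors-unique g
      sub : ∏ Φ (g ∷ properDivisors g) ∣ᴿ ∏ Φ (properDivisors a)
      sub = ∏-⊆-∣ Φ g∷proper-unique g∷proper⊆
      Φa∣e : Φ a ∣ᴿ e
      -- Two expressions for `U a` are compared, U g · e and Φ a times a multiple of `U g`, and
      -- `U g` is cancelled.
      Φa∣e = proj₁ sub , U-cancel 1≤g (begin
        U g * e                                          ≈⟨ proj₁ (proj₂ (proj₂ (U-geometric g t))) ⟨
        U (t ℕ.* g)                                      ≈⟨ reflexive (cong U a≡tg) ⟨
        U a                                              ≈⟨ proj₁ Fa ⟩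
        Φ a * ∏ Φ (properDivisors a)                     ≈⟨ *-congˡ (proj₂ sub) ⟩
        Φ a * (proj₁ sub * ∏ Φ (g ∷ properDivisors g))   ≈⟨ *-congˡ (*-congˡ (proj₁ Fg)) ⟨
        Φ a * (proj₁ sub * U g)                          ≈⟨ solve 3 (λ a s u → a :* (s :* u) := u :* (s :* a)) ≈-refl (Φ a) (proj₁ sub) (U g) ⟩
        U g * (proj₁ sub * Φ a)                          ∎)
      Ug∈ : U g ∈⟨ Φ a , Φ b ⟩
      Ug∈ = subst (λ k → U k ∈⟨ Φ a , Φ b ⟩) g≡ (U-∈-gcd a b (∈⟨⟩-∣ˡ (Φ∣U a Fa)) (∈⟨⟩-swap (∈⟨⟩-∣ˡ (Φ∣U b Fb))))
      t∈ : (t · 1#) ∈⟨ Φ a , Φ b ⟩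
      t∈ = ∈⟨⟩-cancelʳ (∈⟨⟩-resp-≈ e≈ (∈⟨⟩-∣ˡ Φa∣e)) (∈⟨⟩-resp-≈ (*-comm _ _) (∈⟨⟩-* e′ Ug∈))

    -- The gcd of distinct numbers is strictly below at least one of them: if it equals `a`, then
    -- `a` properly divides `b` and the roles are exchanged.
    comaximal-distinct : ∀ {a b} → 1 ≤ a → a ≤ M → 1 ≤ b → b ≤ M → (∀ {d} → 1 ≤ d → d ≤ a ⊎ d ≤ b → Factors d) → a ≢ b →
      Comaximal (Φ a) (Φ b)
    comaximal-distinct {a} {b} 1≤a a≤M 1≤b b≤M F a≢b with ℕ.gcd a b ℕ.<? a
    ... | yes g<a = comaximal-below 1≤a a≤M (F 1≤a (inj₁ ℕₚ.≤-refl)) (F 1≤b (inj₂ ℕₚ.≤-refl)) (F 1≤g (inj₁ (ℕₚ.<⇒≤ g<a))) 1≤g g<a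
      where
      1≤g : 1 ≤ ℕ.gcd a b
      1≤g = ℕₚ.n≢0⇒n>0 (ℕ.gcd[m,n]≢0 a b (inj₁ (ℕₚ.m<n⇒n≢0 1≤a)))
    ... | no g≮a = ∈⟨⟩-swap (comaximal-below 1≤b b≤M (F 1≤b (inj₂ ℕₚ.≤-refl)) (F 1≤a (inj₁ ℕₚ.≤-refl)) (F 1≤g (inj₂ (ℕₚ.<⇒≤ g<b))) 1≤g g<b)
      where
      instance
        a≢0 : NonZero a
        a≢0 = ℕ.>-nonZero 1≤a
        b≢0 : NonZero b
        b≢0 = ℕ.>-nonZero 1≤b
      g≡a : ℕ.gcd a b ≡ a
      g≡a = ℕₚ.≤-antisym (ℕ.∣⇒≤ (ℕ.gcd[m,n]∣m a b)) (ℕₚ.≮⇒≥ g≮a)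
      g′≡a : ℕ.gcd b a ≡ a
      g′≡a = ≡.trans (ℕ.gcd-comm b a) g≡a
      1≤g : 1 ≤ ℕ.gcd b a
      1≤g = subst (1 ≤_) (≡.sym g′≡a) 1≤a
      g<b : ℕ.gcd b a < b
      g<b = subst (_< b) (≡.sym g′≡a) (ℕₚ.≤∧≢⇒< (ℕ.∣⇒≤ (subst (_∣ b) g≡a (ℕ.gcd[m,n]∣n a b))) a≢b)

    pairwise-comaximal : ∀ {ds} → Unique ds → (∀ {a b} → a ∈ ds → b ∈ ds → a ≢ b → Comaximal (Φ a) (Φ b)) →
      AllPairs (λ a b → Comaximal (Φ a) (Φ b)) ds
    pairwise-comaximal []       h = []
    pairwise-comaximal (a∉ ∷ u) h = All.tabulate (λ b∈ → h (here ≡.refl) (there b∈) (All.lookup a∉ b∈)) ∷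
      pairwise-comaximal u (λ a∈ b∈ → h (there a∈) (there b∈))

    -- Below `m` the factorisations make the Φ of the proper divisors pairwise comaximal divisors of
    -- x^m - 1; hence their product divides it, as `divide` demands.
    factors : ∀ m → 1 ≤ m → m ≤ M → Factors m
    factors = <-rec (λ m → 1 ≤ m → m ≤ M → Factors m) induct
      where
      induct : ∀ m → (∀ {d} → d < m → 1 ≤ d → d ≤ M → Factors d) → 1 ≤ m → m ≤ M → Factors m
      induct m rec 1≤m m≤M = divide 1≤m
        (λ d∈ → let 1≤d , d<m , _ = ∈-properDivisors⁻ d∈ in proj₂ (below 1≤d d<m))
        (∏-∣ Φ
          (pairwise-comaximal (properDivisors-unique m) λ a∈ b∈ →
            let 1≤a , a<m , _ = ∈-properDivisors⁻ a∈ ; 1≤b , b<m , _ = ∈-properDivisors⁻ b∈ in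
            comaximal-distinct 1≤a (below-M a<m) 1≤b (below-M b<m)
              λ 1≤d → [ (λ d≤a → below 1≤d (ℕₚ.≤-<-trans d≤a a<m)) , (λ d≤b → below 1≤d (ℕₚ.≤-<-trans d≤b b<m)) ]′)
          (All.tabulate λ d∈ → let 1≤d , d<m , d∣m = ∈-properDivisors⁻ d∈ in
            ∣ᴿ-trans (Φ∣U _ (below 1≤d d<m)) (U-∣ d∣m)))
        where
        below-M : ∀ {d} → d < m → d ≤ M
        below-M d<m = ℕₚ.≤-trans (ℕₚ.<⇒≤ d<m) m≤M
        below : ∀ {d} → 1 ≤ d → d < m → Factors d
        below 1≤d d<m = rec d<m 1≤d (below-M d<m)

-- Division by a monic polynomial

DegreeBelow : ℕ → Poly → Set
DegreeBelow e P = ∀ i → e ≤ i → coeff P i ≡ + 0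

LeadingOne : ℕ → Poly → Set
LeadingOne e P = coeff P e ≡ + 1 × DegreeBelow (suc e) P

degreeBelow-length : ∀ P → DegreeBelow (length P) P
degreeBelow-length []      i       _       = ≡.refl
degreeBelow-length (a ∷ P) (suc i) (s≤s h) = degreeBelow-length P i h

-- A condition on the list itself: its last entry is 1, with no zeros after it. `divMonicₚ` reverses
-- the list and drops the head as the leading coefficient, so trailing zeros would falsify its
-- result.
data Monic : Poly → Set where
  one : Monic (+ 1 ∷ [])
  _∷_ : ∀ a {P} → Monic P → Monic (a ∷ P)

monic-∷ʳ : ∀ P → Monic (P ++ + 1 ∷ [])
monic-∷ʳ []      = one
monic-∷ʳ (a ∷ P) = a ∷ monic-∷ʳ P

monic-reverse : ∀ {P} → Monic P → ∃ λ ds → reverse P ≡ + 1 ∷ ds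
monic-reverse one = [] , ≡.refl
monic-reverse (_∷_ a {P} M) with monic-reverse M
... | ds , eq = ds ++ a ∷ [] , ≡.trans (List.unfold-reverse a P) (cong (_++ a ∷ []) eq)

monic-leadingOne : ∀ {P e} → Monic P → length P ≡ suc e → LeadingOne e P
monic-leadingOne one ≡.refl = ≡.refl , λ { (suc i) _ → ≡.refl }
monic-leadingOne (a ∷ one) ≡.refl = ≡.refl , λ { (suc (suc i)) _ → ≡.refl ; (suc zero) (s≤s ()) }
monic-leadingOne (a ∷ M@(_ ∷ _)) ≡.refl with monic-leadingOne M ≡.refl
... | lead , below = lead , λ { (suc i) (s≤s h) → below i h }

length-+ₚˡ : ∀ P Q → length P ≤ length (P +ₚ Q)
length-+ₚˡ []      Q       = z≤n
length-+ₚˡ (a ∷ P) []      = ℕₚ.≤-refl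
length-+ₚˡ (a ∷ P) (b ∷ Q) = s≤s (length-+ₚˡ P Q)

monic-+ₚ : ∀ P {Q} → Monic Q → length P < length Q → Monic (P +ₚ Q)
monic-+ₚ []          M       _       = M
monic-+ₚ (a ∷ [])    one     (s≤s ())
monic-+ₚ (a ∷ _ ∷ _) one     (s≤s ())
monic-+ₚ (a ∷ P)     (b ∷ M) (s≤s h) = (a ℤ.+ b) ∷ monic-+ₚ P M h

monic-scale1 : ∀ {P} → Monic P → Monic (scaleₚ (+ 1) P)
monic-scale1 one     = one
monic-scale1 (a ∷ M) = _ ∷ monic-scale1 M

monic-+ₚ[] : ∀ {P} → Monic P → Monic (P +ₚ [])
monic-+ₚ[] one     = one
monic-+ₚ[] (a ∷ M) = a ∷ M

-- When `P` has more than one entry, the shifted summand of the product is longer than the scaled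
-- copy of `Q` and alone supplies the last entry.
monic-*ₚ : ∀ {P Q} → Monic P → Monic Q → Monic (P *ₚ Q)
monic-*ₚ one one     = one
monic-*ₚ one (a ∷ M) = _ ∷ monic-+ₚ[] (monic-scale1 M)
monic-*ₚ {a ∷ P} {Q} (.a ∷ M) N = monic-+ₚ (scaleₚ a Q) (+ 0 ∷ monic-*ₚ M N)
  (s≤s (subst (_≤ length (P *ₚ Q)) (≡.sym (List.length-map (a ℤ.*_) Q)) (length-*ₚ M)))
  where
  length-*ₚ : ∀ {P} → Monic P → length Q ≤ length (P *ₚ Q)
  length-*ₚ {b ∷ P} _ = subst (_≤ length ((b ∷ P) *ₚ Q)) (List.length-map (b ℤ.*_) Q) (length-+ₚˡ (scaleₚ b Q) _)

monic-prodₚ : ∀ {Ps} → All Monic Ps → Monic (prodₚ Ps)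
monic-prodₚ []       = one
monic-prodₚ (M ∷ Ms) = monic-*ₚ M (monic-prodₚ Ms)

monic-monoₚ : ∀ k → Monic (monoₚ k)
monic-monoₚ k = monic-∷ʳ (replicate k (+ 0))

-- The helpers divH and subPrefix of divMonicₚ are private. Unification recovers the composite
-- reverse ∘ divH, but cannot see through reverse, a left fold. So the list is read off by the monoid
-- solver from a monoid whose product is that fold, and in whose proofs the atoms are recorded.
module FoldArgument where
  open import Tactic.MonoidSolver using (solve)

  infix 4 _≈_

  data _≈_ (xs ys : List ℤ) : Set where
    atoms : List (List ℤ) → xs ≈ ys

  combine : ∀ {u v x y w z} → u ≈ v → x ≈ y → w ≈ z
  combine (atoms as) (atoms bs) = atoms (as ++ bs)

  reverseFold : Monoid 0ℓ 0ℓ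
  reverseFold = record
    { Carrier  = List ℤ
    ; _≈_      = _≈_
    ; _∙_      = List.foldl (λ ys y → y ∷ ys)
    ; ε        = []
    ; isMonoid = record
      { isSemigroup = record
        { isMagma = record
          { isEquivalence = record { refl = atoms [] ; sym = λ { (atoms as) → atoms as } ; trans = combine }
          ; ∙-cong = combine
          }
        ; assoc = λ _ _ _ → atoms []
        }
      ; identity = (λ _ → atoms []) , λ xs → atoms (xs ∷ [])
      }
    }

  lastAtom : ∀ {xs ys} → xs ≈ ys → List ℤ
  lastAtom (atoms as) = List.foldl (λ _ a → a) [] as

  mutual
    reverseDivH : ℕ → List ℤ → List ℤ → List ℤ
    reverseDivH = _

    divMonicₚ-reverseDivH : ∀ N D {d ds} → reverse D ≡ d ∷ ds → divMonicₚ N D ≡ reverseDivH (length N) ds (reverse N)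
    divMonicₚ-reverseDivH N D eq with reverse D | eq
    -- With these arguments abstracted, the unknown is applied to distinct variables, so that
    -- unification determines it.
    ... | _ | ≡.refl with length N | reverse N
    ... | f | ns = ≡.refl

  divH : ℕ → List ℤ → List ℤ → List ℤ
  divH f ds ns = lastAtom {reverseDivH f ds ns} (solve reverseFold)

  mutual
    subPrefix : List ℤ → List ℤ → List ℤ
    subPrefix = _

    divH-∷ : ∀ f ds c ns → length ds ≤ length ns →
      divH (suc f) ds (c ∷ ns) ≡ c ∷ divH f ds (subPrefix ns (map (c ℤ.*_) ds))
    divH-∷ f ds c ns h with length ns ℕ.<? length ds
    ... | yes h′ = contradiction h (ℕₚ.<⇒≱ h′)
    ... | no _ with map (c ℤ.*_) ds
    ... | cds = ≡.refl

open FoldArgument using (divH; subPrefix; divH-∷) public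

divMonicₚ-unfold : ∀ N D {d ds} → reverse D ≡ d ∷ ds → divMonicₚ N D ≡ reverse (divH (length N) ds (reverse N))
divMonicₚ-unfold = FoldArgument.divMonicₚ-reverseDivH

module DivisionIdentities {c ℓ} (R : CommutativeRing c ℓ) where
  open CommutativeRing R renaming (refl to ≈-refl; trans to ≈-trans; sym to ≈-sym)
  open import Algebra.Solver.Ring.NaturalCoefficients.Default commutativeSemiring
  open import Relation.Binary.Reasoning.Setoid setoid

  -- The algebra of the inductive step of `reverse-subPrefix`. `n` stands for -1, and the
  -- polynomials are variables so that the semiring solver applies.
  subtract-step : ∀ {r′ r d k a b n m l M L e} →
    r′ ≈ r + n * (m * k) → d ≈ a + n * b → M ≈ m * l → L ≈ m * l → e ≈ k + b * l →
    r′ + d * M ≈ (r + a * L) + n * (m * e)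
  subtract-step {r′} {r} {d} {k} {a} {b} {n} {m} {l} {M} {L} {e} r′≈ d≈ M≈ L≈ e≈ = begin
    r′ + d * M                                       ≈⟨ +-cong r′≈ (*-cong d≈ M≈) ⟩
    (r + n * (m * k)) + (a + n * b) * (m * l)        ≈⟨ solve 7 (λ r n m k a b l → (r :+ n :* (m :* k)) :+ (a :+ n :* b) :* (m :* l)
                                                          := (r :+ a :* (m :* l)) :+ n :* (m :* (k :+ b :* l))) ≈-refl r n m k a b l ⟩
    (r + a * (m * l)) + n * (m * (k + b * l))        ≈⟨ +-cong (+-congˡ (*-congˡ L≈)) (*-congˡ (*-congˡ e≈)) ⟨
    (r + a * L) + n * (m * e)                        ∎

  -- One step of long division. `s` is the dividend without its leading term c L, `m` is the power
  -- of x by which the divisor D = d + l is shifted, `n` is -1, and s′ = N - c m D is what remains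
  -- to be divided.
  division-step : ∀ {N s c m l L s′ e d n D q r Q} →
    N ≈ s + c * L → L ≈ m * l → s′ ≈ s + n * (m * e) → e ≈ c * d → n + 1# ≈ 0# → D ≈ d + 1# * l →
    s′ ≈ q * D + r → Q ≈ q + c * m → N ≈ Q * D + r
  division-step {N} {s} {c} {m} {l} {L} {s′} {e} {d} {n} {D} {q} {r} {Q} N≈ L≈ s′≈ e≈ n+1≈0 D≈ s′≈qD+r Q≈ = begin
    N                                                              ≈⟨ N≈ ⟩
    s + c * L                                                      ≈⟨ +-congˡ (*-congˡ L≈) ⟩
    s + c * (m * l)                                                ≈⟨ solve 5 (λ s c m l d → s :+ c :* (m :* l) := s :+ (c :* (m :* l) :+ con 0 :* (m :* (c :* d)))) ≈-refl s c m l d ⟩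
    s + (c * (m * l) + 0# * (m * (c * d)))                         ≈⟨ +-congˡ (+-congˡ (*-congʳ n+1≈0)) ⟨
    s + (c * (m * l) + (n + 1#) * (m * (c * d)))                   ≈⟨ solve 6 (λ s c m l d n → s :+ (c :* (m :* l) :+ (n :+ con 1) :* (m :* (c :* d)))
                                                                        := (s :+ n :* (m :* (c :* d))) :+ c :* m :* (d :+ con 1 :* l)) ≈-refl s c m l d n ⟩
    (s + n * (m * (c * d))) + c * m * (d + 1# * l)                 ≈⟨ +-cong (+-congˡ (*-congˡ (*-congˡ e≈))) (*-congˡ D≈) ⟨
    (s + n * (m * e)) + c * m * D                                  ≈⟨ +-congʳ s′≈ ⟨
    s′ + c * m * D                                                 ≈⟨ +-congʳ s′≈qD+r ⟩
    (q * D + r) + c * m * D                                        ≈⟨ solve 5 (λ q D r c m → (q :* D :+ r) :+ c :* m :* D := (q :+ c :* m) :* D :+ r) ≈-refl q D r c m ⟩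
    (q + c * m) * D + r                                            ≈⟨ +-congʳ (*-congʳ Q≈) ⟨
    Q * D + r                                                      ∎

module _ where
  open CommutativeRing ℤ[x] renaming (refl to ≋-refl; trans to ≋-trans; sym to ≋-sym)
  open DivisionIdentities ℤ[x]
  open import Relation.Binary.Reasoning.Setoid setoid
  open PolyRing using (constₚ-*ₚ; 0∷-*ₚ; *ₚ-identityˡ; ∷-cong)

  X : Poly
  X = monoₚ 1

  X-*ₚ : ∀ P → X *ₚ P ≋ (+ 0 ∷ P)
  X-*ₚ P = ≋-trans (0∷-*ₚ (constₚ (+ 1)) P) (∷-cong (+ 0) (*ₚ-identityˡ P))

  monoₚ-+ : ∀ k l → monoₚ (k ℕ.+ l) ≋ monoₚ k *ₚ monoₚ l
  monoₚ-+ zero    l = ≋-sym (*ₚ-identityˡ (monoₚ l))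
  monoₚ-+ (suc k) l = ≋-trans (∷-cong (+ 0) (monoₚ-+ k l)) (≋-sym (0∷-*ₚ (monoₚ k) (monoₚ l)))

  ++-monoₚ : ∀ P c → P ++ c ∷ [] ≋ P +ₚ (constₚ c *ₚ monoₚ (length P))
  ++-monoₚ []      c = pointwise λ { zero → ≡.sym (≡.trans (ℤₚ.+-identityʳ _) (ℤₚ.*-identityʳ c)) ; (suc i) → ≡.refl }
  ++-monoₚ (a ∷ P) c = ≋-trans (∷-cong a (++-monoₚ P c)) (pointwise λ
    { zero    → ≡.sym (≡.trans (coeff-+ (a ∷ P) (constₚ c *ₚ (+ 0 ∷ monoₚ (length P))) 0)
                  (≡.trans (cong (ℤ._+_ a) (≡.trans (coeff-*-zero c [] (+ 0 ∷ monoₚ (length P))) (ℤₚ.*-zeroʳ c))) (ℤₚ.+-identityʳ a)))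
    ; (suc i) → ≡.trans (coeff-+ P _ i) (≡.trans (cong (ℤ._+_ (coeff P i)) (shifted i)) (≡.sym (coeff-+ (a ∷ P) (constₚ c *ₚ (+ 0 ∷ monoₚ (length P))) (suc i))))
    })
    where
    shifted : ∀ i → coeff (constₚ c *ₚ monoₚ (length P)) i ≡ coeff (constₚ c *ₚ (+ 0 ∷ monoₚ (length P))) (suc i)
    shifted i = ≡.trans (constₚ-*ₚ c (monoₚ (length P)) .at i) (≡.trans (coeff-scale c (monoₚ (length P)) i)
      (≡.sym (≡.trans (constₚ-*ₚ c (+ 0 ∷ monoₚ (length P)) .at (suc i)) (coeff-scale c (+ 0 ∷ monoₚ (length P)) (suc i)))))

  reverse-∷ : ∀ c ns → reverse (c ∷ ns) ≋ reverse ns +ₚ (constₚ c *ₚ monoₚ (length ns))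
  reverse-∷ c ns = begin
    reverse (c ∷ ns)                                           ≡⟨ List.unfold-reverse c ns ⟩
    reverse ns ++ c ∷ []                                       ≈⟨ ++-monoₚ (reverse ns) c ⟩
    reverse ns +ₚ (constₚ c *ₚ monoₚ (length (reverse ns)))    ≡⟨ cong (λ k → reverse ns +ₚ (constₚ c *ₚ monoₚ k)) (List.length-reverse ns) ⟩
    reverse ns +ₚ (constₚ c *ₚ monoₚ (length ns))              ∎

  length-subPrefix : ∀ as bs → length bs ≤ length as → length (subPrefix as bs) ≡ length as
  length-subPrefix []       []       _       = ≡.refl
  length-subPrefix (a ∷ as) []       _       = ≡.refl
  length-subPrefix (a ∷ as) (b ∷ bs) (s≤s h) = cong suc (length-subPrefix as bs h)

  -- Aligning two lists at their highest coefficients multiplies the polynomial of the shorter one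
  -- by x^k, where `k` is the difference of the lengths.
  reverse-subPrefix : ∀ k as bs → length as ≡ k ℕ.+ length bs →
    reverse (subPrefix as bs) ≋ reverse as +ₚ (constₚ (ℤ.- (+ 1)) *ₚ (monoₚ k *ₚ reverse bs))
  reverse-subPrefix k as [] eq = begin
    reverse (subPrefix as [])      ≡⟨ cong reverse (subPrefix-[] as) ⟩
    reverse as                     ≈⟨ +-identityʳ (reverse as) ⟨
    reverse as +ₚ []               ≈⟨ PolyRing.+ₚ-cong (≋-refl {reverse as}) (≋-trans (*-cong (≋-refl {constₚ (ℤ.- (+ 1))}) (zeroʳ (monoₚ k))) (zeroʳ (constₚ (ℤ.- (+ 1))))) ⟨
    reverse as +ₚ (constₚ (ℤ.- (+ 1)) *ₚ (monoₚ k *ₚ [])) ∎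
    where
    subPrefix-[] : ∀ as → subPrefix as [] ≡ as
    subPrefix-[] []       = ≡.refl
    subPrefix-[] (a ∷ as) = ≡.refl
  reverse-subPrefix k []       (b ∷ bs) eq = contradiction (≡.trans eq (ℕₚ.+-suc k _)) λ ()
  reverse-subPrefix k (a ∷ as) (b ∷ bs) eq = begin
    reverse ((a ℤ.- b) ∷ subPrefix as bs)
      ≈⟨ reverse-∷ (a ℤ.- b) (subPrefix as bs) ⟩
    reverse (subPrefix as bs) +ₚ (constₚ (a ℤ.- b) *ₚ monoₚ (length (subPrefix as bs)))
      ≈⟨ subtract-step {r = reverse as} {k = reverse bs} {a = constₚ a} {b = constₚ b} {n = n} {m = m} {l = l}
           (reverse-subPrefix k as bs length-as) const-difference mono-length mono-as (reverse-∷ b bs) ⟩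
    (reverse as +ₚ (constₚ a *ₚ monoₚ (length as))) +ₚ (n *ₚ (m *ₚ reverse (b ∷ bs)))
      ≈⟨ PolyRing.+ₚ-cong (reverse-∷ a as) (≋-refl {n *ₚ (m *ₚ reverse (b ∷ bs))}) ⟨
    reverse (a ∷ as) +ₚ (n *ₚ (m *ₚ reverse (b ∷ bs))) ∎
    where
    n = constₚ (ℤ.- (+ 1))
    m = monoₚ k
    l = monoₚ (length bs)
    length-as : length as ≡ k ℕ.+ length bs
    length-as = ℕₚ.suc-injective (≡.trans eq (ℕₚ.+-suc k _))
    mono-as : monoₚ (length as) ≋ m *ₚ l
    mono-as = ≋-trans (reflexive (cong monoₚ length-as)) (monoₚ-+ k (length bs))
    mono-length : monoₚ (length (subPrefix as bs)) ≋ m *ₚ l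
    mono-length = ≋-trans (reflexive (cong monoₚ (length-subPrefix as bs (subst (length bs ≤_) (≡.sym length-as) (ℕₚ.m≤n+m _ k))))) mono-as
    const-difference : constₚ (a ℤ.- b) ≋ constₚ a +ₚ (n *ₚ constₚ b)
    const-difference = pointwise λ { zero → cong (ℤ._+_ a) (≡.trans (≡.sym (ℤₚ.-1*i≡-i b)) (≡.sym (ℤₚ.+-identityʳ _))) ; (suc i) → ≡.refl }

  -- The exponent that a leading quotient coefficient receives under `reverse` is the length of the
  -- rest of the quotient, so this length must be known exactly.
  length-divH : ∀ f ds ns → length ns ≤ f → length ds ≤ length ns → length (divH f ds ns) ℕ.+ length ds ≡ length ns
  length-divH zero    ds []       _       h = ℕₚ.n≤0⇒n≡0 h
  length-divH (suc f) ds []       _       h = ℕₚ.n≤0⇒n≡0 h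
  length-divH (suc f) ds (c ∷ ns) (s≤s l) h with length ns ℕ.<? length ds
  ... | yes short = ℕₚ.≤-antisym h short
  ... | no long = cong suc (≡.trans
      (length-divH f ds (subPrefix ns cds) (subst (_≤ f) (≡.sym length-sub) l) (subst (length ds ≤_) (≡.sym length-sub) (ℕₚ.≮⇒≥ long)))
      length-sub)
    where
    cds = map (c ℤ.*_) ds
    length-sub : length (subPrefix ns cds) ≡ length ns
    length-sub = length-subPrefix ns cds (subst (_≤ length ns) (≡.sym (List.length-map _ ds)) (ℕₚ.≮⇒≥ long))

  -- The remainder is reconstructed here, as `divH` throws it away. `length ds` is the degree of the
  -- divisor because `ds` omits the leading 1.
  divH-spec : ∀ f ds ns → length ns ≤ f →
    ∃ λ r → reverse ns ≋ (reverse (divH f ds ns) *ₚ reverse (+ 1 ∷ ds)) +ₚ r × DegreeBelow (length ds) r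
  divH-spec zero    ds []       _ = [] , ≋-refl , λ _ _ → ≡.refl
  divH-spec (suc f) ds []       _ = [] , ≋-refl , λ _ _ → ≡.refl
  divH-spec (suc f) ds (c ∷ ns) (s≤s h) with length ns ℕ.<? length ds
  ... | yes short = reverse (c ∷ ns) , ≋-refl ,
    λ i le → degreeBelow-length (reverse (c ∷ ns)) i (subst (_≤ i) (≡.sym (List.length-reverse (c ∷ ns))) (ℕₚ.≤-trans short le))
  ... | no long = r , (begin
      reverse (c ∷ ns)
        ≈⟨ division-step {s = reverse ns} {c = constₚ c} {m = m} {l = l} {s′ = reverse ns′} {d = reverse ds} {n = n} {q = reverse q} {r = r}
             (reverse-∷ c ns) mono-ns
             (reverse-subPrefix k ns cds (≡.trans length-ns (cong (k ℕ.+_) (≡.sym (List.length-map (c ℤ.*_) ds)))))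
             reverse-cds (-‿inverseˡ 1#) (reverse-∷ (+ 1) ds) (proj₁ (proj₂ rec))
             (≋-trans (reverse-∷ c q) (reflexive (cong (λ k → reverse q +ₚ (constₚ c *ₚ monoₚ k)) length-q))) ⟩
      (reverse (c ∷ q) *ₚ D) +ₚ r ∎) , proj₂ (proj₂ rec)
    where
    k = length ns ∸ length ds
    n = constₚ (ℤ.- (+ 1))
    m = monoₚ k
    l = monoₚ (length ds)
    D = reverse (+ 1 ∷ ds)
    cds = map (c ℤ.*_) ds
    ns′ = subPrefix ns cds
    q = divH f ds ns′
    length-ns : length ns ≡ k ℕ.+ length ds
    length-ns = ≡.sym (ℕₚ.m∸n+n≡m (ℕₚ.≮⇒≥ long))
    length-ns′ : length ns′ ≡ length ns
    length-ns′ = length-subPrefix ns cds (subst (_≤ length ns) (≡.sym (List.length-map _ ds)) (ℕₚ.≮⇒≥ long))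
    mono-ns : monoₚ (length ns) ≋ m *ₚ l
    mono-ns = ≋-trans (reflexive (cong monoₚ length-ns)) (monoₚ-+ k (length ds))
    reverse-cds : reverse cds ≋ constₚ c *ₚ reverse ds
    reverse-cds = ≋-trans (reflexive (≡.sym (List.reverse-map (c ℤ.*_) ds))) (≋-sym (constₚ-*ₚ c (reverse ds)))
    rec = divH-spec f ds ns′ (subst (_≤ f) (≡.sym length-ns′) h)
    r = proj₁ rec
    length-q : length q ≡ k
    length-q = ℕₚ.+-cancelʳ-≡ (length ds) _ _ (≡.trans
      (length-divH f ds ns′ (subst (_≤ f) (≡.sym length-ns′) h) (subst (length ds ≤_) (≡.sym length-ns′) (ℕₚ.≮⇒≥ long)))
      (≡.trans length-ns′ length-ns))

  divMonicₚ-spec : ∀ N D {ds} → reverse D ≡ + 1 ∷ ds →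
    ∃ λ r → N ≋ (divMonicₚ N D *ₚ D) +ₚ r × DegreeBelow (length ds) r
  divMonicₚ-spec N D {ds} eq with divH-spec (length N) ds (reverse N) (ℕₚ.≤-reflexive (List.length-reverse N))
  ... | r , N≋ , below = r , (begin
      N                                                                                ≡⟨ List.reverse-involutive N ⟨
      reverse (reverse N)                                                              ≈⟨ N≋ ⟩
      (reverse (divH (length N) ds (reverse N)) *ₚ reverse (+ 1 ∷ ds)) +ₚ r            ≡⟨ cong₂ (λ q d → (q *ₚ d) +ₚ r) (divMonicₚ-unfold N D eq) (≡.trans (≡.sym (List.reverse-involutive D)) (cong reverse eq)) ⟨
      (divMonicₚ N D *ₚ D) +ₚ r                                                        ∎) , below

  monic-divMonicₚ : ∀ N D {ns ds} → reverse N ≡ + 1 ∷ ns → reverse D ≡ + 1 ∷ ds → length ds ≤ length ns → Monic (divMonicₚ N D)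
  monic-divMonicₚ N D {ns} {ds} eqN eqD h = subst Monic (≡.sym (≡.trans (divMonicₚ-unfold N D eqD) (cong reverse head-one)))
      (subst Monic (≡.sym (List.unfold-reverse (+ 1) q)) (monic-∷ʳ (reverse q)))
    where
    length-N : length N ≡ suc (length ns)
    length-N = ≡.trans (≡.sym (List.length-reverse N)) (cong length eqN)
    q = divH (length ns) ds (subPrefix ns (map (+ 1 ℤ.*_) ds))
    head-one : divH (length N) ds (reverse N) ≡ + 1 ∷ q
    head-one = ≡.trans (cong₂ (λ f → divH f ds) length-N eqN) (divH-∷ (length ns) ds (+ 1) ns h)

-- Cyclotomic polynomials modulo p

module Modulo (p : ℕ) where
  open CommutativeRing ℤ[x] using () renaming (refl to ≋-refl)
  open Quotient ℤ[x] (constₚ (+ p)) public using (_∼_; module _∼_; congruent; ≈⇒∼; quotient)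
  open import Data.Integer.Tactic.RingSolver using (solve-∀)
  open PolyRing using (constₚ-*ₚ)

  coeff-constₚ-*ₚ : ∀ c P i → coeff (constₚ c *ₚ P) i ≡ c ℤ.* coeff P i
  coeff-constₚ-*ₚ c P i = ≡.trans (constₚ-*ₚ c P .at i) (coeff-scale c P i)

  ∣-coeff-*ₚ : ∀ C D → (∀ i → + p ∣ᶻ coeff C i) → ∀ i → + p ∣ᶻ coeff (C *ₚ D) i
  ∣-coeff-*ₚ []      D h i       = divides (+ 0) ≡.refl
  ∣-coeff-*ₚ (c ∷ C) D h zero    = subst (+ p ∣ᶻ_) (≡.sym (coeff-*-zero c C D)) (ℤ∣.∣m⇒∣m*n (coeff D 0) (h 0))
  ∣-coeff-*ₚ (c ∷ C) D h (suc i) = subst (+ p ∣ᶻ_) (≡.sym (coeff-*-suc c C D i))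
    (ℤ∣.∣m∣n⇒∣m+n (ℤ∣.∣m⇒∣m*n (coeff D (suc i)) (h 0)) (∣-coeff-*ₚ C D (h ∘ suc) i))

  -- Above degree `e` the constant term `c` contributes nothing to the product, so the hypothesis
  -- passes to the tail of the left factor. Once that tail vanishes modulo `p`, the coefficient in
  -- degree `e` is congruent to `c`.
  leading-cancel : ∀ {e} C D → LeadingOne e D → (∀ i → e ≤ i → + p ∣ᶻ coeff (C *ₚ D) i) → ∀ i → + p ∣ᶻ coeff C i
  leading-cancel []      D lead h i = divides (+ 0) ≡.refl
  leading-cancel {e} (c ∷ C) D (lead , below) h = λ { zero → head-∣ e lead (h e ℕₚ.≤-refl) ; (suc i) → tail-∣ i }
    where
    tail-∣ : ∀ i → + p ∣ᶻ coeff C i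
    tail-∣ = leading-cancel C D (lead , below) λ i e≤i → subst (+ p ∣ᶻ_)
      (≡.trans (coeff-*-suc c C D i) (≡.trans (cong (λ d → c ℤ.* d ℤ.+ coeff (C *ₚ D) i) (below (suc i) (s≤s e≤i)))
        (≡.trans (cong (ℤ._+ coeff (C *ₚ D) i) (ℤₚ.*-zeroʳ c)) (ℤₚ.+-identityˡ _))))
      (h (suc i) (ℕₚ.m≤n⇒m≤1+n e≤i))
    head-∣ : ∀ e → coeff D e ≡ + 1 → + p ∣ᶻ coeff ((c ∷ C) *ₚ D) e → + p ∣ᶻ c
    head-∣ zero    eq h₀ = subst (+ p ∣ᶻ_) (≡.trans (coeff-*-zero c C D) (≡.trans (cong (c ℤ.*_) eq) (ℤₚ.*-identityʳ c))) h₀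
    head-∣ (suc e) eq hₑ = ℤ∣.∣m+n∣n⇒∣m
      (subst (+ p ∣ᶻ_) (≡.trans (coeff-*-suc c C D e) (cong (ℤ._+ coeff (C *ₚ D) e) (≡.trans (cong (c ℤ.*_) eq) (ℤₚ.*-identityʳ c)))) hₑ)
      (∣-coeff-*ₚ C D tail-∣ e)

  ∣-coeff⇒multiple : ∀ A → (∀ i → + p ∣ᶻ coeff A i) → ∃ λ B → A ≋ constₚ (+ p) *ₚ B
  ∣-coeff⇒multiple A h = quotients A h , pointwise λ i → ≡.trans (coeff-quotients A h i) (≡.sym (coeff-constₚ-*ₚ (+ p) (quotients A h) i))
    where
    quotients : ∀ A → (∀ i → + p ∣ᶻ coeff A i) → Poly
    quotients []      h = []
    quotients (a ∷ A) h = ℤ∣._∣_.quotient (h 0) ∷ quotients A (h ∘ suc)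
    coeff-quotients : ∀ A h i → coeff A i ≡ + p ℤ.* coeff (quotients A h) i
    coeff-quotients []      h i       = ≡.sym (ℤₚ.*-zeroʳ (+ p))
    coeff-quotients (a ∷ A) h zero    = ≡.trans (ℤ∣._∣_.equality (h 0)) (ℤₚ.*-comm _ (+ p))
    coeff-quotients (a ∷ A) h (suc i) = coeff-quotients A (h ∘ suc) i

  ∼⇒coeff : ∀ {A B} → A ∼ B → ∀ i → + p ∣ᶻ coeff A i ℤ.- coeff B i
  ∼⇒coeff {A} {B} (congruent C A≋) i = divides (coeff C i) (begin
    coeff A i ℤ.- coeff B i                              ≡⟨ cong (ℤ._- coeff B i) (A≋ .at i) ⟩
    coeff (B +ₚ (constₚ (+ p) *ₚ C)) i ℤ.- coeff B i     ≡⟨ cong (ℤ._- coeff B i) (≡.trans (coeff-+ B _ i) (cong (λ z → coeff B i ℤ.+ z) (coeff-constₚ-*ₚ (+ p) C i))) ⟩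
    coeff B i ℤ.+ + p ℤ.* coeff C i ℤ.- coeff B i        ≡⟨ lemma (coeff B i) (+ p) (coeff C i) ⟩
    coeff C i ℤ.* + p                                    ∎)
    where
    open ≡-Reasoning
    lemma : ∀ b q c → b ℤ.+ q ℤ.* c ℤ.- b ≡ c ℤ.* q
    lemma = solve-∀

  coeff⇒∼ : ∀ {A B} → (∀ i → + p ∣ᶻ coeff A i ℤ.- coeff B i) → A ∼ B
  coeff⇒∼ {A} {B} h = congruent C (pointwise λ i → begin
    coeff A i                                                              ≡⟨ lemma (coeff A i) (coeff B i) ⟩
    coeff B i ℤ.+ (coeff A i ℤ.+ (ℤ.- (+ 1)) ℤ.* coeff B i)                ≡⟨ cong (λ z → coeff B i ℤ.+ z) (coeff-difference i) ⟨
    coeff B i ℤ.+ coeff (A +ₚ negₚ B) i                                    ≡⟨ cong (λ z → coeff B i ℤ.+ z) (A-B≋ .at i) ⟩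
    coeff B i ℤ.+ coeff (constₚ (+ p) *ₚ C) i                              ≡⟨ coeff-+ B _ i ⟨
    coeff (B +ₚ (constₚ (+ p) *ₚ C)) i                                     ∎)
    where
    open ≡-Reasoning
    lemma : ∀ a b → a ≡ b ℤ.+ (a ℤ.+ (ℤ.- (+ 1)) ℤ.* b)
    lemma = solve-∀
    minus : ∀ a b → a ℤ.- b ≡ a ℤ.+ (ℤ.- (+ 1)) ℤ.* b
    minus = solve-∀
    coeff-difference : ∀ i → coeff (A +ₚ negₚ B) i ≡ coeff A i ℤ.+ (ℤ.- (+ 1)) ℤ.* coeff B i
    coeff-difference i = ≡.trans (coeff-+ A (negₚ B) i) (cong (λ z → coeff A i ℤ.+ z) (coeff-scale (ℤ.- (+ 1)) B i))
    multiple : ∃ λ C → A +ₚ negₚ B ≋ constₚ (+ p) *ₚ C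
    multiple = ∣-coeff⇒multiple (A +ₚ negₚ B) λ i → subst (+ p ∣ᶻ_) (≡.trans (minus (coeff A i) (coeff B i)) (≡.sym (coeff-difference i))) (h i)
    C = proj₁ multiple
    A-B≋ = proj₂ multiple

  -- Only degrees from `e` on are compared, so that the products may differ by a remainder of
  -- smaller degree: this is uniqueness of the quotient modulo `p`.
  ∼-cancel-leading : ∀ {e} B C D → LeadingOne e D → (∀ i → e ≤ i → + p ∣ᶻ coeff (B *ₚ D) i ℤ.- coeff (C *ₚ D) i) → B ∼ C
  ∼-cancel-leading B C D lead h = coeff⇒∼ {B} {C} λ i → subst (+ p ∣ᶻ_) (difference B C i)
    (leading-cancel (B +ₚ negₚ C) D lead (λ i e≤i → subst (+ p ∣ᶻ_) (≡.sym (product-coeff i)) (h i e≤i)) i)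
    where
    open ≡-Reasoning
    minus : ∀ a b → a ℤ.+ (ℤ.- (+ 1)) ℤ.* b ≡ a ℤ.- b
    minus = solve-∀
    difference : ∀ B C i → coeff (B +ₚ negₚ C) i ≡ coeff B i ℤ.- coeff C i
    difference B C i = begin
      coeff (B +ₚ negₚ C) i                        ≡⟨ coeff-+ B (negₚ C) i ⟩
      coeff B i ℤ.+ coeff (negₚ C) i               ≡⟨ cong (λ z → coeff B i ℤ.+ z) (coeff-scale (ℤ.- (+ 1)) C i) ⟩
      coeff B i ℤ.+ (ℤ.- (+ 1)) ℤ.* coeff C i      ≡⟨ minus (coeff B i) (coeff C i) ⟩
      coeff B i ℤ.- coeff C i                      ∎
    product-coeff : ∀ i → coeff ((B +ₚ negₚ C) *ₚ D) i ≡ coeff (B *ₚ D) i ℤ.- coeff (C *ₚ D) i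
    product-coeff i = begin
      coeff ((B +ₚ negₚ C) *ₚ D) i                       ≡⟨ PolyRing.*ₚ-distribʳ D B (negₚ C) .at i ⟩
      coeff ((B *ₚ D) +ₚ (negₚ C *ₚ D)) i                ≡⟨ PolyRing.+ₚ-cong (≋-refl {B *ₚ D}) (PolyRing.scaleₚ-*ₚ (ℤ.- (+ 1)) C D) .at i ⟩
      coeff ((B *ₚ D) +ₚ negₚ (C *ₚ D)) i                ≡⟨ difference (B *ₚ D) (C *ₚ D) i ⟩
      coeff (B *ₚ D) i ℤ.- coeff (C *ₚ D) i              ∎

mutual
  -- The recursion behind `cyclotomic` is private. Its name is recovered by unification: the
  -- reflexivity proof of `cyclotomic-suc` determines the placeholder.
  cycloF : ℕ → ℕ → Poly
  cycloF = _

  cyclotomic-suc : ∀ m → cyclotomic (suc m) ≡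
    divMonicₚ (monoₚ (suc m) +ₚ constₚ (ℤ.- (+ 1))) (prodₚ (map (cycloF m) (properDivisors (suc m))))
  cyclotomic-suc m = ≡.refl

-- `cyclotomic (suc m)` evaluates its factors with fuel `m`, whereas `cyclotomic d` uses fuel `d`.
-- Both suffice, since proper divisors are smaller.
cycloF-fuel : ∀ m f → 1 ≤ m → m ≤ f → cycloF f m ≡ cyclotomic m
cycloF-fuel = <-rec (λ m → ∀ f → 1 ≤ m → m ≤ f → cycloF f m ≡ cyclotomic m) λ
  { (suc m) rec (suc f) _ (s≤s m≤f) → cong (λ Ps → divMonicₚ (monoₚ (suc m) +ₚ constₚ (ℤ.- (+ 1))) (prodₚ Ps))
      (List.map-cong-local (All.tabulate λ d∈ → let 1≤d , d<1+m , _ = ∈-properDivisors⁻ {suc m} d∈ ; d≤m = ℕₚ.≤-pred d<1+m in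
        ≡.trans (rec d<1+m f 1≤d (ℕₚ.≤-trans d≤m m≤f)) (≡.sym (rec d<1+m m 1≤d d≤m)))) }

cyclotomic-unfold : ∀ {m} → 1 ≤ m → cyclotomic m ≡
  divMonicₚ (monoₚ m +ₚ constₚ (ℤ.- (+ 1))) (prodₚ (map cyclotomic (properDivisors m)))
cyclotomic-unfold {suc m} _ = ≡.trans (cyclotomic-suc m) (cong (λ Ps → divMonicₚ (monoₚ (suc m) +ₚ constₚ (ℤ.- (+ 1))) (prodₚ Ps))
  (List.map-cong-local (All.tabulate λ d∈ → let 1≤d , d<1+m , _ = ∈-properDivisors⁻ {suc m} d∈ in cycloF-fuel _ m 1≤d (ℕₚ.≤-pred d<1+m))))

monic-mono-1 : ∀ {m} → 1 ≤ m → Monic (monoₚ m +ₚ constₚ (ℤ.- (+ 1)))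
monic-mono-1 {suc m} _ = _ ∷ monic-+ₚ[] (monic-monoₚ m)

length-mono-1 : ∀ {m} → 1 ≤ m → length (monoₚ m +ₚ constₚ (ℤ.- (+ 1))) ≡ suc m
length-mono-1 {suc m} _ = cong suc (length-+ₚ[] m)
  where
  length-+ₚ[] : ∀ m → length (monoₚ m +ₚ []) ≡ suc m
  length-+ₚ[] zero    = ≡.refl
  length-+ₚ[] (suc m) = cong suc (≡.trans (List.length-++ (replicate m (+ 0))) (≡.trans (cong (ℕ._+ 1) (List.length-replicate m)) (ℕₚ.+-comm m 1)))

module CyclotomicModulo (p : ℕ) (prime : Prime p) where
  open Modulo p public
  open CommutativeRing ℤ[x] using () renaming (refl to ≋-refl; trans to ≋-trans; sym to ≋-sym; reflexive to ≋-reflexive; *-comm to *ₚ-comm)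
  private
    module F = CommutativeRing quotient
  open PowersMinusOne quotient X
  open Comaximality quotient
  open import Algebra.Definitions.RawSemiring (Semiring.rawSemiring F.semiring) using () renaming (_×_ to _·_; _^_ to _↑_)
  open import Data.Integer.Tactic.RingSolver using (solve-∀)

  instance
    p≢0 : NonZero p
    p≢0 = prime⇒nonZero prime

  1<p : 1 < p
  1<p = ℕ.nonTrivial⇒n>1 p {{prime⇒nonTrivial prime}}

  p∤1 : ¬ (+ p ∣ᶻ + 1)
  p∤1 p∣1 = ℕₚ.<⇒≱ 1<p (ℕ.∣⇒≤ (ℤ∣.∣⇒∣ᵤ p∣1))

  N : ℕ → Poly
  N m = monoₚ m +ₚ constₚ (ℤ.- (+ 1))

  monoₚ≋↑ : ∀ m → monoₚ m ≋ X ↑ m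
  monoₚ≋↑ zero    = ≋-refl
  monoₚ≋↑ (suc m) = ≋-trans (≋-sym (X-*ₚ (monoₚ m))) (PolyRing.*ₚ-cong (≋-refl {X}) (monoₚ≋↑ m))

  N≋U : ∀ m → N m ≋ U m
  N≋U m = PolyRing.+ₚ-cong (monoₚ≋↑ m) (≋-refl {constₚ (ℤ.- (+ 1))})

  N-leading : ∀ {m} → 1 ≤ m → LeadingOne m (N m)
  N-leading 1≤m = monic-leadingOne (monic-mono-1 1≤m) (length-mono-1 1≤m)

  ·1≋constₚ : ∀ k → k · F.1# ≋ constₚ (+ k)
  ·1≋constₚ zero    = pointwise λ { zero → ≡.refl ; (suc i) → ≡.refl }
  ·1≋constₚ (suc k) = PolyRing.+ₚ-cong (≋-refl {constₚ (+ 1)}) (·1≋constₚ k)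

  constₚ-∼ : ∀ a b → + p ∣ᶻ a ℤ.- b → constₚ a ∼ constₚ b
  constₚ-∼ a b h = coeff⇒∼ λ { zero → h ; (suc i) → divides (+ 0) ≡.refl }

  constₚ-·1 : ∀ {k} a → + p ∣ᶻ a ℤ.* + k ℤ.- + 1 → (constₚ a *ₚ (k · F.1#)) ∼ F.1#
  constₚ-·1 {k} a h = F.trans (≈⇒∼ (≋-trans (PolyRing.*ₚ-cong (≋-refl {constₚ a}) (·1≋constₚ k)) (PolyRing.constₚ-*ₚ a (constₚ (+ k))))) (constₚ-∼ (a ℤ.* + k) (+ 1) h)

  invertible : ∀ {k} → 1 ≤ k → k < p → ∃ λ i → (i *ₚ (k · F.1#)) ∼ F.1#
  invertible {k} 1≤k k<p with coprime-Bézout (prime⇒coprime prime {{ℕ.>-nonZero 1≤k}} k<p)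
  ... | ℕ.Bézout.+- x y eq = constₚ (ℤ.- (+ y)) , constₚ-·1 (ℤ.- (+ y)) (divides (ℤ.- (+ x)) (lemma (cong +_ eq)))
    where
    lemma : + (1 ℕ.+ y ℕ.* k) ≡ + (x ℕ.* p) → (ℤ.- (+ y)) ℤ.* + k ℤ.- + 1 ≡ (ℤ.- (+ x)) ℤ.* + p
    lemma eq = begin
      (ℤ.- (+ y)) ℤ.* + k ℤ.- + 1          ≡⟨ negate (+ y) (+ k) ⟩
      ℤ.- (+ 1 ℤ.+ + y ℤ.* + k)            ≡⟨ cong (λ z → ℤ.- (+ 1 ℤ.+ z)) (ℤₚ.pos-* y k) ⟨
      ℤ.- (+ (1 ℕ.+ y ℕ.* k))              ≡⟨ cong ℤ.-_ (≡.trans eq (ℤₚ.pos-* x p)) ⟩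
      ℤ.- (+ x ℤ.* + p)                    ≡⟨ ℤₚ.neg-distribˡ-* (+ x) (+ p) ⟩
      (ℤ.- (+ x)) ℤ.* + p                  ∎
      where
      open ≡-Reasoning
      negate : ∀ y k → (ℤ.- y) ℤ.* k ℤ.- + 1 ≡ ℤ.- (+ 1 ℤ.+ y ℤ.* k)
      negate = solve-∀
  ... | ℕ.Bézout.-+ x y eq = constₚ (+ y) , constₚ-·1 (+ y) (divides (+ x) (lemma (cong +_ eq)))
    where
    lemma : + (1 ℕ.+ x ℕ.* p) ≡ + (y ℕ.* k) → + y ℤ.* + k ℤ.- + 1 ≡ + x ℤ.* + p
    lemma eq = begin
      + y ℤ.* + k ℤ.- + 1                  ≡⟨ cong (ℤ._- + 1) (≡.trans (≡.sym (ℤₚ.pos-* y k)) (≡.sym eq)) ⟩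
      + 1 ℤ.+ + (x ℕ.* p) ℤ.- + 1          ≡⟨ cong (λ z → + 1 ℤ.+ z ℤ.- + 1) (ℤₚ.pos-* x p) ⟩
      + 1 ℤ.+ + x ℤ.* + p ℤ.- + 1          ≡⟨ cancel (+ x ℤ.* + p) ⟩
      + x ℤ.* + p                          ∎
      where
      open ≡-Reasoning
      cancel : ∀ z → + 1 ℤ.+ z ℤ.- + 1 ≡ z
      cancel = solve-∀

  -- For positive `k` the leading coefficient of x^k - 1 is 1, so it is no zero divisor modulo `p`.
  U-cancel : ∀ {k y z} → 1 ≤ k → (U k *ₚ y) ∼ (U k *ₚ z) → y ∼ z
  U-cancel {k} {y} {z} 1≤k eq = ∼-cancel-leading y z (N k) (N-leading 1≤k) λ i _ → ∼⇒coeff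
    (F.trans (commute y) (F.trans eq (F.sym (commute z)))) i
    where
    commute : ∀ w → (w *ₚ N k) ∼ (U k *ₚ w)
    commute w = ≈⇒∼ (≋-trans (*ₚ-comm w (N k)) (PolyRing.*ₚ-cong (N≋U k) (≋-refl {w})))

  -- The integer division gives N = Φ D + r, while N is congruent to B D. In the degrees that `r`
  -- does not reach, B D and Φ D agree modulo `p`, and this already forces B and Φ to agree. The
  -- remainder thus vanishes modulo `p` without being computed.
  divide : ∀ {m} → 1 ≤ m → (∀ {d} → d ∈ properDivisors m → Monic (cyclotomic d)) → ∏ cyclotomic (properDivisors m) ∣ᴿ U m →
    U m ∼ (cyclotomic m *ₚ ∏ cyclotomic (properDivisors m)) × Monic (cyclotomic m)
  divide {m} 1≤m monic (B , U∼BD) =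
    F.trans U∼BD (F.*-cong B∼Φ F.refl) ,
    subst Monic (≡.sym (cyclotomic-unfold 1≤m)) (monic-divMonicₚ (N m) D eqN eqD degree≤)
    where
    D = ∏ cyclotomic (properDivisors m)
    Φ = cyclotomic m
    monicD : Monic D
    monicD = monic-prodₚ (All.map⁺ (All.tabulate monic))
    ds = proj₁ (monic-reverse monicD)
    eqD : reverse D ≡ + 1 ∷ ds
    eqD = proj₂ (monic-reverse monicD)
    ns = proj₁ (monic-reverse (monic-mono-1 1≤m))
    eqN : reverse (N m) ≡ + 1 ∷ ns
    eqN = proj₂ (monic-reverse (monic-mono-1 1≤m))
    leadD : LeadingOne (length ds) D
    leadD = monic-leadingOne monicD (≡.trans (≡.sym (List.length-reverse D)) (cong length eqD))
    length-ns : length ns ≡ m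
    length-ns = ℕₚ.suc-injective (≡.trans (≡.sym (≡.trans (≡.sym (List.length-reverse (N m))) (cong length eqN))) (length-mono-1 1≤m))
    N∼BD : N m ∼ (B *ₚ D)
    N∼BD = F.trans (≈⇒∼ (N≋U m)) U∼BD
    spec = divMonicₚ-spec (N m) D eqD
    r = proj₁ spec
    N≋ΦD+r : N m ≋ (Φ *ₚ D) +ₚ r
    N≋ΦD+r = ≋-trans (proj₁ (proj₂ spec)) (≋-reflexive (cong (λ Q → (Q *ₚ D) +ₚ r) (≡.sym (cyclotomic-unfold 1≤m))))
    B∼Φ : B ∼ Φ
    B∼Φ = ∼-cancel-leading B Φ D leadD λ i e≤i → subst (λ z → + p ∣ᶻ coeff (B *ₚ D) i ℤ.- z)
      (≡.trans (N≋ΦD+r .at i) (≡.trans (coeff-+ (Φ *ₚ D) r i) (≡.trans (cong (λ z → coeff (Φ *ₚ D) i ℤ.+ z) (proj₂ (proj₂ spec) i e≤i)) (ℤₚ.+-identityʳ _))))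
      (∼⇒coeff (F.sym N∼BD) i)
    -- If D had larger degree than N, then B D would vanish modulo `p` from deg D upward, so B would
    -- vanish modulo `p` and with it N, whose leading coefficient is 1.
    degree≤ : length ds ≤ length ns
    degree≤ = ℕₚ.≮⇒≥ λ ns<ds →
      let p∣BD : ∀ i → length ds ≤ i → + p ∣ᶻ coeff (B *ₚ D) i
          p∣BD = λ i ds≤i → subst (+ p ∣ᶻ_)
            (≡.trans (cong (λ z → coeff (B *ₚ D) i ℤ.- z) (proj₂ (N-leading 1≤m) i (ℕₚ.≤-trans (subst (λ k → suc k ≤ length ds) length-ns ns<ds) ds≤i))) (ℤₚ.+-identityʳ _))
            (∼⇒coeff (F.sym N∼BD) i)
      in p∤1 (subst (+ p ∣ᶻ_) (proj₁ (N-leading 1≤m)) (ℤ∣.∣m+n∣n⇒∣m (∼⇒coeff N∼BD m)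
        (ℤ∣.∣m⇒∣-m (∣-coeff-*ₚ B D (leading-cancel B D leadD p∣BD) m))))

  cyclotomic-∣ : ∀ {m} → 1 ≤ m → m < p → cyclotomic m ∣ᴿ U m
  cyclotomic-∣ {m} 1≤m m<p = CF.Φ∣U m (CF.factors m 1≤m ℕₚ.≤-refl)
    where
    module CF = CyclotomicFactors cyclotomic m (Monic ∘ cyclotomic) U-cancel (λ 1≤k k≤m → invertible 1≤k (ℕₚ.≤-<-trans k≤m m<p)) divide

-- Fermat's little theorem and Lagrange's bound on the number of roots

module FermatLagrange (p : ℕ) (prime : Prime p) where
  open CyclotomicModulo p prime using (p≢0; 1<p)
  open import Data.Nat.Combinatorics using (_C_; nCn≡1; nCk≡n!/k![n-k]!; k![n∸k]!∣n!)
  open import Data.Nat using (_!)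
  open import Algebra.Properties.Monoid.Sum ℕₚ.+-0-monoid using (sum; sum-init-last)
  open import Algebra.Definitions.RawSemiring ℕ.+-*-rawSemiring using () renaming (_×_ to _·_; _^_ to _↑_)
  import Algebra.Properties.CommutativeSemiring.Binomial ℕₚ.+-*-commutativeSemiring as Binomial
  open import Data.Integer.Tactic.RingSolver using (solve-∀)

  ∤-! : ∀ m → m < p → ¬ (p ∣ m !)
  ∤-! zero    _   p∣1 = ℕₚ.<⇒≱ 1<p (ℕ.∣⇒≤ p∣1)
  ∤-! (suc m) m<p p∣  with euclidsLemma (suc m) (m !) prime p∣
  ... | inj₁ p∣1+m = ℕₚ.<⇒≱ m<p (ℕ.∣⇒≤ p∣1+m)
  ... | inj₂ p∣m!  = ∤-! m (ℕₚ.<⇒≤ m<p) p∣m!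

  ∣-factorial : ∀ n .{{_ : NonZero n}} → n ∣ n !
  ∣-factorial (suc n) = ℕ.m∣m*n (n !)

  factorial-binomial : ∀ {n k} → k ≤ n → n ! ≡ (n C k) ℕ.* (k ! ℕ.* (n ∸ k) !)
  factorial-binomial {n} {k} k≤n =
    ≡.sym (≡.trans (cong (ℕ._* (k ! ℕ.* (n ∸ k) !)) (nCk≡n!/k![n-k]! k≤n)) (ℕ.m/n*n≡m (k![n∸k]!∣n! k≤n)))
    where
    instance
      denominator≢0 : NonZero (k ! ℕ.* (n ∸ k) !)
      denominator≢0 = k ℕₚ.!* (n ∸ k) !≢0

  -- The prime divides p! = (p C k) k! (p - k)! but neither of the last two factorials, both
  -- arguments being below `p`.
  ∣-binomial : ∀ k → 0 < k → k < p → p ∣ p C k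
  ∣-binomial k 0<k k<p with euclidsLemma (p C k) (k ! ℕ.* (p ∸ k) !) prime (subst (p ∣_) (factorial-binomial (ℕₚ.<⇒≤ k<p)) (∣-factorial p))
  ... | inj₁ p∣pCk = p∣pCk
  ... | inj₂ p∣k![p-k]! with euclidsLemma (k !) ((p ∸ k) !) prime p∣k![p-k]!
  ...   | inj₁ p∣k!     = contradiction p∣k! (∤-! k k<p)
  ...   | inj₂ p∣[p-k]! = contradiction p∣[p-k]! (∤-! (p ∸ k) (ℕₚ.∸-monoʳ-< 0<k (ℕₚ.<⇒≤ k<p)))

  ↑≡^ : ∀ a n → a ↑ n ≡ a ^ n
  ↑≡^ a zero    = ≡.refl
  ↑≡^ a (suc n) = cong (a ℕ.*_) (↑≡^ a n)

  ·≡* : ∀ n a → n · a ≡ n ℕ.* a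
  ·≡* zero    a = ≡.refl
  ·≡* (suc n) a = cong (a ℕ.+_) (·≡* n a)

  ∣-sum : ∀ {n} (t : Fin n → ℕ) → (∀ i → p ∣ t i) → p ∣ sum t
  ∣-sum {zero}  t h = p ℕ.∣0
  ∣-sum {suc n} t h = ℕ.∣m∣n⇒∣m+n (h Fin.zero) (∣-sum (t ∘ Fin.suc) (h ∘ Fin.suc))

  [1+a]^p : ∀ a → ∃ λ c → suc a ^ p ≡ suc (a ^ p ℕ.+ c ℕ.* p)
  [1+a]^p a = go p ≡.refl
    where
    -- `p` is exposed as a successor so that the binomial sum splits into its first term, its last
    -- term and `q` middle terms.
    go : ∀ q → q ≡ p → ∃ λ c → suc a ^ p ≡ suc (a ^ p ℕ.+ c ℕ.* p)
    go zero    q≡p = contradiction (≡.sym q≡p) (ℕ.≢-nonZero⁻¹ p)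
    go (suc q) ≡.refl = c , (begin
      suc a ^ p                                                        ≡⟨ ↑≡^ (suc a) p ⟨
      suc a ↑ p                                                        ≡⟨ cong (_↑ p) (ℕₚ.+-comm 1 a) ⟩
      (a ℕ.+ 1) ↑ p                                                    ≡⟨ Binomial.theorem p a 1 ⟩
      term Fin.zero ℕ.+ sum (term ∘ Fin.suc)                           ≡⟨ cong₂ ℕ._+_ first (sum-init-last (term ∘ Fin.suc)) ⟩
      1 ℕ.+ (sum middle ℕ.+ term (Fin.suc (fromℕ q)))                  ≡⟨ cong₂ (λ x y → suc (x ℕ.+ y)) (ℕ.m∣n⇒n≡quotient*m p∣middle) last-term ⟩
      1 ℕ.+ (c ℕ.* p ℕ.+ a ^ p)                                        ≡⟨ cong suc (ℕₚ.+-comm (c ℕ.* p) (a ^ p)) ⟩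
      suc (a ^ p ℕ.+ c ℕ.* p)                                          ∎)
      where
      open ≡-Reasoning
      term : Fin (suc p) → ℕ
      term k = (p C toℕ k) · (a ↑ toℕ k ℕ.* 1 ↑ (p ∸ toℕ k))
      middle : Fin q → ℕ
      middle i = term (Fin.suc (inject₁ i))
      1↑ : ∀ n → 1 ↑ n ≡ 1
      1↑ n = ≡.trans (↑≡^ 1 n) (ℕₚ.^-zeroˡ n)
      term≡ : ∀ k → term k ≡ (p C toℕ k) ℕ.* a ^ toℕ k
      term≡ k = ≡.trans (·≡* (p C toℕ k) _) (cong ((p C toℕ k) ℕ.*_)
        (≡.trans (cong₂ ℕ._*_ (↑≡^ a (toℕ k)) (1↑ (p ∸ toℕ k))) (ℕₚ.*-identityʳ _)))
      first : term Fin.zero ≡ 1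
      first = ≡.trans (term≡ Fin.zero) ≡.refl
      last-term : term (Fin.suc (fromℕ q)) ≡ a ^ p
      last-term = ≡.trans (term≡ (Fin.suc (fromℕ q))) (≡.trans
        (cong (λ k → (p C suc k) ℕ.* a ^ suc k) (Fin.toℕ-fromℕ q))
        (≡.trans (cong (ℕ._* a ^ p) (nCn≡1 p)) (ℕₚ.*-identityˡ _)))
      p∣middle : p ∣ sum middle
      p∣middle = ∣-sum middle λ i → subst (p ∣_) (≡.sym (term≡ (Fin.suc (inject₁ i))))
        (ℕ.∣m⇒∣m*n _ (∣-binomial _ (s≤s z≤n) (s≤s (subst (_< q) (≡.sym (Fin.toℕ-inject₁ i)) (Fin.toℕ<n i)))))
      c = ℕ.quotient p∣middle

  pos-^ : ∀ a n → + (a ^ n) ≡ (+ a) ℤ.^ n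
  pos-^ a zero    = ≡.refl
  pos-^ a (suc n) = ≡.trans (ℤₚ.pos-* a (a ^ n)) (cong (+ a ℤ.*_) (pos-^ a n))

  frobenius : ∀ a → + p ∣ᶻ (+ a) ℤ.^ p ℤ.- + a
  frobenius a = subst (λ z → + p ∣ᶻ z ℤ.- + a) (pos-^ a p) (go a)
    where
    open ≡-Reasoning
    lemma : ∀ x y c → + 1 ℤ.+ (x ℤ.+ c) ℤ.- (+ 1 ℤ.+ y) ≡ x ℤ.- y ℤ.+ c
    lemma = solve-∀
    go : ∀ a → + p ∣ᶻ + (a ^ p) ℤ.- + a
    go zero    = subst (λ k → + p ∣ᶻ + k ℤ.- + 0) (≡.sym (0^p p)) (divides (+ 0) ≡.refl)
      where
      0^p : ∀ p .{{_ : NonZero p}} → 0 ^ p ≡ 0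
      0^p (suc p) = ≡.refl
    go (suc a) with [1+a]^p a
    ... | c , eq = subst (+ p ∣ᶻ_) (≡.sym (begin
      + (suc a ^ p) ℤ.- + suc a                                ≡⟨ cong (λ k → + k ℤ.- + suc a) eq ⟩
      + 1 ℤ.+ (+ (a ^ p) ℤ.+ + (c ℕ.* p)) ℤ.- (+ 1 ℤ.+ + a)    ≡⟨ lemma (+ (a ^ p)) (+ a) (+ (c ℕ.* p)) ⟩
      + (a ^ p) ℤ.- + a ℤ.+ + (c ℕ.* p)                        ∎))
      (ℤ∣.∣m∣n⇒∣m+n (go a) (divides (+ c) (ℤₚ.pos-* c p)))

  euclidᶻ : ∀ a b → + p ∣ᶻ a ℤ.* b → + p ∣ᶻ a ⊎ + p ∣ᶻ b
  euclidᶻ a b p∣ab with euclidsLemma ℤ.∣ a ∣ ℤ.∣ b ∣ prime (subst (p ∣_) (ℤₚ.abs-* a b) (ℤ∣.∣⇒∣ᵤ p∣ab))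
  ... | inj₁ p∣a = inj₁ (ℤ∣.∣ᵤ⇒∣ p∣a)
  ... | inj₂ p∣b = inj₂ (ℤ∣.∣ᵤ⇒∣ p∣b)

  ∤-small : ∀ {x} → 1 ≤ x → x < p → ¬ (+ p ∣ᶻ + x)
  ∤-small 1≤x x<p p∣x = ℕₚ.<⇒≱ x<p (ℕ.∣⇒≤ {{ℕ.>-nonZero 1≤x}} (ℤ∣.∣⇒∣ᵤ p∣x))

  power-factor : ∀ x n .{{_ : NonZero n}} → x ℤ.^ n ℤ.- x ≡ x ℤ.* (x ℤ.^ (n ∸ 1) ℤ.- + 1)
  power-factor x (suc n) = lemma x (x ℤ.^ n)
    where
    lemma : ∀ x y → x ℤ.* y ℤ.- x ≡ x ℤ.* (y ℤ.- + 1)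
    lemma = solve-∀

  fermat : ∀ {x} → 1 ≤ x → x < p → + p ∣ᶻ (+ x) ℤ.^ (p ∸ 1) ℤ.- + 1
  fermat {x} 1≤x x<p with euclidᶻ (+ x) _ (subst (+ p ∣ᶻ_) (power-factor (+ x) p) (frobenius x))
  ... | inj₁ p∣x = contradiction p∣x (∤-small 1≤x x<p)
  ... | inj₂ p∣  = p∣

  eval : Poly → ℤ → ℤ
  eval []      x = + 0
  eval (c ∷ P) x = c ℤ.+ x ℤ.* eval P x

  eval-+ : ∀ P Q x → eval (P +ₚ Q) x ≡ eval P x ℤ.+ eval Q x
  eval-+ []      Q       x = ≡.sym (ℤₚ.+-identityˡ _)
  eval-+ (a ∷ P) []      x = ≡.sym (ℤₚ.+-identityʳ _)
  eval-+ (a ∷ P) (b ∷ Q) x = ≡.trans (cong (λ z → a ℤ.+ b ℤ.+ x ℤ.* z) (eval-+ P Q x)) (lemma a b x (eval P x) (eval Q x))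
    where
    lemma : ∀ a b x y z → a ℤ.+ b ℤ.+ x ℤ.* (y ℤ.+ z) ≡ a ℤ.+ x ℤ.* y ℤ.+ (b ℤ.+ x ℤ.* z)
    lemma = solve-∀

  eval-mono : ∀ k x → eval (monoₚ k) x ≡ x ℤ.^ k
  eval-mono zero    x = ≡.trans (cong (λ z → + 1 ℤ.+ z) (ℤₚ.*-zeroʳ x)) ≡.refl
  eval-mono (suc k) x = ≡.trans (ℤₚ.+-identityˡ _) (cong (x ℤ.*_) (eval-mono k x))

  -- Synthetic division of `c ∷ P` by x - r: the Horner values at `r` of the successive tails are
  -- the coefficients of the quotient.
  divideByRoot : ℤ → Poly → ℤ → Poly
  divideByRoot c []       r = []
  divideByRoot c (c′ ∷ P) r = eval (c′ ∷ P) r ∷ divideByRoot c′ P r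

  length-divideByRoot : ∀ c P r → length (divideByRoot c P r) ≡ length P
  length-divideByRoot c []       r = ≡.refl
  length-divideByRoot c (c′ ∷ P) r = cong suc (length-divideByRoot c′ P r)

  eval-divideByRoot : ∀ c P r x → eval (c ∷ P) x ℤ.- eval (c ∷ P) r ≡ (x ℤ.- r) ℤ.* eval (divideByRoot c P r) x
  eval-divideByRoot c []       r x = lemma c x r
    where
    lemma : ∀ c x r → c ℤ.+ x ℤ.* + 0 ℤ.- (c ℤ.+ r ℤ.* + 0) ≡ (x ℤ.- r) ℤ.* + 0
    lemma = solve-∀
  eval-divideByRoot c (c′ ∷ P) r x = begin
    c ℤ.+ x ℤ.* u ℤ.- (c ℤ.+ r ℤ.* v)          ≡⟨ lemma₁ c x u r v ⟩
    (x ℤ.- r) ℤ.* v ℤ.+ x ℤ.* (u ℤ.- v)        ≡⟨ cong (λ z → (x ℤ.- r) ℤ.* v ℤ.+ x ℤ.* z) (eval-divideByRoot c′ P r x) ⟩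
    (x ℤ.- r) ℤ.* v ℤ.+ x ℤ.* ((x ℤ.- r) ℤ.* w) ≡⟨ lemma₂ x r v w ⟩
    (x ℤ.- r) ℤ.* (v ℤ.+ x ℤ.* w)              ∎
    where
    open ≡-Reasoning
    u = eval (c′ ∷ P) x
    v = eval (c′ ∷ P) r
    w = eval (divideByRoot c′ P r) x
    lemma₁ : ∀ c x u r v → c ℤ.+ x ℤ.* u ℤ.- (c ℤ.+ r ℤ.* v) ≡ (x ℤ.- r) ℤ.* v ℤ.+ x ℤ.* (u ℤ.- v)
    lemma₁ = solve-∀
    lemma₂ : ∀ x r v w → (x ℤ.- r) ℤ.* v ℤ.+ x ℤ.* ((x ℤ.- r) ℤ.* w) ≡ (x ℤ.- r) ℤ.* (v ℤ.+ x ℤ.* w)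
    lemma₂ = solve-∀

  -- Each coefficient is a Horner value minus `r` times the next one. The first Horner value is the
  -- value at `r`, and the others are the coefficients of the quotient.
  ∣-divideByRoot : ∀ c P r → (∀ i → + p ∣ᶻ coeff (divideByRoot c P r) i) → + p ∣ᶻ eval (c ∷ P) r → ∀ i → + p ∣ᶻ coeff (c ∷ P) i
  ∣-divideByRoot c [] r h root zero    = subst (+ p ∣ᶻ_) (≡.trans (cong (λ z → c ℤ.+ z) (ℤₚ.*-zeroʳ r)) (ℤₚ.+-identityʳ c)) root
  ∣-divideByRoot c [] r h root (suc i) = divides (+ 0) ≡.refl
  ∣-divideByRoot c (c′ ∷ P) r h root zero    = ℤ∣.∣m+n∣n⇒∣m root (ℤ∣.∣n⇒∣m*n r (h 0))
  ∣-divideByRoot c (c′ ∷ P) r h root (suc i) = ∣-divideByRoot c′ P r (h ∘ suc) (h 0) i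

  -- The root `suc l` is divided out. A smaller root `x` survives in the quotient because `suc l`
  -- minus `x` lies between 1 and `l` and so is prime to `p`.
  lagrange : ∀ l P → length P ≤ l → l < p → (∀ x → 1 ≤ x → x ≤ l → + p ∣ᶻ eval P (+ x)) → ∀ i → + p ∣ᶻ coeff P i
  lagrange l       []      _       _   roots i = divides (+ 0) ≡.refl
  lagrange (suc l) (c ∷ P) (s≤s h) l<p roots =
    ∣-divideByRoot c P r (lagrange l H (subst (_≤ l) (≡.sym (length-divideByRoot c P r)) h) (ℕₚ.<⇒≤ l<p) roots′) (roots (suc l) (s≤s z≤n) ℕₚ.≤-refl)
    where
    r = + suc l
    H = divideByRoot c P r
    swap-sub : ∀ x r z → (r ℤ.- x) ℤ.* z ≡ ℤ.- ((x ℤ.- r) ℤ.* z)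
    swap-sub = solve-∀
    roots′ : ∀ x → 1 ≤ x → x ≤ l → + p ∣ᶻ eval H (+ x)
    roots′ x 1≤x x≤l with euclidᶻ (r ℤ.- + x) (eval H (+ x)) (subst (+ p ∣ᶻ_) (≡.sym (swap-sub (+ x) r (eval H (+ x))))
      (ℤ∣.∣m⇒∣-m (subst (+ p ∣ᶻ_) (eval-divideByRoot c P r (+ x))
        (ℤ∣.∣m∣n⇒∣m-n (roots x 1≤x (ℕₚ.m≤n⇒m≤1+n x≤l)) (roots (suc l) (s≤s z≤n) ℕₚ.≤-refl)))))
    ... | inj₂ p∣ = p∣
    ... | inj₁ p∣r-x = contradiction
      (subst (+ p ∣ᶻ_) (≡.trans (ℤₚ.m-n≡m⊖n (suc l) x) (ℤₚ.⊖-≥ (ℕₚ.m≤n⇒m≤1+n x≤l))) p∣r-x)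
      (∤-small (ℕₚ.m<n⇒0<n∸m (s≤s x≤l)) (ℕₚ.≤-<-trans (ℕₚ.m∸n≤m (suc l) x) l<p))

  e = p ∸ 1

  ∣-power-period : ∀ {x} → 1 ≤ x → x < p → ∀ q → + p ∣ᶻ (+ x) ℤ.^ (q ℕ.* e) ℤ.- + 1
  ∣-power-period         1≤x x<p zero    = divides (+ 0) ≡.refl
  ∣-power-period {x} 1≤x x<p (suc q) = subst (+ p ∣ᶻ_)
    (≡.trans (lemma ((+ x) ℤ.^ e) ((+ x) ℤ.^ (q ℕ.* e))) (cong (ℤ._- + 1) (≡.sym (ℤₚ.^-distribˡ-+-* (+ x) e (q ℕ.* e)))))
    (ℤ∣.∣m∣n⇒∣m+n (ℤ∣.∣n⇒∣m*n ((+ x) ℤ.^ e) (∣-power-period 1≤x x<p q)) (fermat 1≤x x<p))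
    where
    lemma : ∀ y z → y ℤ.* (z ℤ.- + 1) ℤ.+ (y ℤ.- + 1) ≡ y ℤ.* z ℤ.- + 1
    lemma = solve-∀

  module _ (2≤e : 2 ≤ e) where
    instance
      e≢0 : NonZero e
      e≢0 = ℕ.>-nonZero (ℕₚ.≤-trans (s≤s z≤n) 2≤e)

    residuePoly : List ℕ → Poly
    residuePoly []       = []
    residuePoly (d ∷ ds) = monoₚ (d ℕ.% e) +ₚ residuePoly ds

    length-+ₚ≤ : ∀ {l} P Q → length P ≤ l → length Q ≤ l → length (P +ₚ Q) ≤ l
    length-+ₚ≤ []      Q       _       h       = h
    length-+ₚ≤ (a ∷ P) []      h       _       = h
    length-+ₚ≤ (a ∷ P) (b ∷ Q) (s≤s h) (s≤s k) = s≤s (length-+ₚ≤ P Q h k)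

    length-monoₚ : ∀ k → length (monoₚ k) ≡ suc k
    length-monoₚ zero    = ≡.refl
    length-monoₚ (suc k) = cong suc (length-monoₚ k)

    length-residuePoly : ∀ ds → length (residuePoly ds) ≤ e
    length-residuePoly []       = z≤n
    length-residuePoly (d ∷ ds) = length-+ₚ≤ (monoₚ (d ℕ.% e)) (residuePoly ds)
      (subst (_≤ e) (≡.sym (length-monoₚ (d ℕ.% e))) (ℕ.m%n<n d e)) (length-residuePoly ds)

    power-residue : ∀ {x} → 1 ≤ x → x < p → ∀ d → + p ∣ᶻ (+ x) ℤ.^ (d ℕ.% e) ℤ.- (+ x) ℤ.^ d
    power-residue {x} 1≤x x<p d = subst (+ p ∣ᶻ_)
      (≡.trans (lemma y ((+ x) ℤ.^ (q ℕ.* e))) (cong (λ z → y ℤ.- z)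
        (≡.trans (≡.sym (ℤₚ.^-distribˡ-+-* (+ x) (d ℕ.% e) (q ℕ.* e))) (cong ((+ x) ℤ.^_) (≡.sym (ℕ.m≡m%n+[m/n]*n d e))))))
      (ℤ∣.∣n⇒∣m*n (ℤ.- y) (∣-power-period 1≤x x<p q))
      where
      q = d ℕ./ e
      y = (+ x) ℤ.^ (d ℕ.% e)
      lemma : ∀ y z → (ℤ.- y) ℤ.* (z ℤ.- + 1) ≡ y ℤ.- y ℤ.* z
      lemma = solve-∀

    eval-residuePoly : ∀ {x} → 1 ≤ x → x < p → ∀ ds →
      + p ∣ᶻ eval (residuePoly ds) (+ x) ℤ.- foldr (λ d acc → (+ x) ℤ.^ d ℤ.+ acc) (+ 0) ds
    eval-residuePoly 1≤x x<p [] = divides (+ 0) ≡.refl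
    eval-residuePoly {x} 1≤x x<p (d ∷ ds) = subst (+ p ∣ᶻ_)
      (≡.trans (lemma y z s t) (cong (λ w → w ℤ.- (z ℤ.+ t)) (≡.sym (≡.trans (eval-+ (monoₚ (d ℕ.% e)) (residuePoly ds) (+ x)) (cong (ℤ._+ s) (eval-mono (d ℕ.% e) (+ x)))))))
      (ℤ∣.∣m∣n⇒∣m+n (power-residue 1≤x x<p d) (eval-residuePoly 1≤x x<p ds))
      where
      y = (+ x) ℤ.^ (d ℕ.% e)
      z = (+ x) ℤ.^ d
      s = eval (residuePoly ds) (+ x)
      t = foldr (λ d acc → (+ x) ℤ.^ d ℤ.+ acc) (+ 0) ds
      lemma : ∀ y z s t → y ℤ.- z ℤ.+ (s ℤ.- t) ≡ y ℤ.+ s ℤ.- (z ℤ.+ t)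
      lemma = solve-∀

    -- As 2 ≤ p ∸ 1, the exponent 1 is its own residue.
    residuePoly-divisors : ∀ n → p ∣ n → WeaklyAlmostPrime n →
      ∀ i → + p ∣ᶻ coeff (residuePoly (divisors n)) i ℤ.- coeff (+ 0 ∷ constₚ (+ numDiv n)) i
    residuePoly-divisors n p∣n (_ , n∣T) i = subst (+ p ∣ᶻ_) (coeff-G i) (lagrange e G length-G e<p roots i)
      where
      k = + numDiv n
      S = residuePoly (divisors n)
      G = S +ₚ (+ 0 ∷ constₚ (ℤ.- k))
      e<p : e < p
      e<p = ℕₚ.∸-monoʳ-< {p} {1} {0} (s≤s z≤n) (ℕₚ.<⇒≤ 1<p)
      length-G : length G ≤ e
      length-G = length-+ₚ≤ S (+ 0 ∷ constₚ (ℤ.- k)) (length-residuePoly (divisors n)) 2≤e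
      coeff-G : ∀ i → coeff G i ≡ coeff S i ℤ.- coeff (+ 0 ∷ constₚ k) i
      coeff-G i = ≡.trans (coeff-+ S _ i) (cong (λ z → coeff S i ℤ.+ z) (negated i))
        where
        negated : ∀ i → coeff (+ 0 ∷ constₚ (ℤ.- k)) i ≡ ℤ.- coeff (+ 0 ∷ constₚ k) i
        negated zero          = ≡.refl
        negated (suc zero)    = ≡.refl
        negated (suc (suc i)) = ≡.refl
      roots : ∀ x → 1 ≤ x → x ≤ e → + p ∣ᶻ eval G (+ x)
      -- The value of `G` is the error of reducing the exponents, divisible by `p` by Fermat, plus
      -- `T n (+ x)`, divisible by `n` and hence by `p`.
      roots x 1≤x x≤e = subst (+ p ∣ᶻ_)
        (≡.trans (lemma s t k (+ x)) (≡.sym (eval-+ S (+ 0 ∷ constₚ (ℤ.- k)) (+ x))))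
        (ℤ∣.∣m∣n⇒∣m+n (eval-residuePoly 1≤x (ℕₚ.≤-<-trans x≤e e<p) (divisors n))
          (ℤ∣.∣-trans {+ p} {+ n} {T n (+ x)} (ℤ∣.∣ᵤ⇒∣ p∣n) (ℤ∣.∣ᵤ⇒∣ (n∣T (+ x)))))
        where
        s = eval S (+ x)
        t = foldr (λ d acc → (+ x) ℤ.^ d ℤ.+ acc) (+ 0) (divisors n)
        lemma : ∀ s t k x → s ℤ.- t ℤ.+ (t ℤ.- k ℤ.* x) ≡ s ℤ.+ (+ 0 ℤ.+ x ℤ.* (ℤ.- k ℤ.+ x ℤ.* + 0))
        lemma = solve-∀

-- Linear extension of a function of the exponent

module Characters (p : ℕ) (prime : Prime p) where
  open CyclotomicModulo p prime using (quotient; _∼_; ≈⇒∼; constₚ-∼)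
  open FermatLagrange p prime using (e; residuePoly; residuePoly-divisors)
  open CommutativeRing quotient using () renaming (refl to ∼-refl; trans to ∼-trans; sym to ∼-sym; +-cong to +-cong-∼; *-cong to *-cong-∼; +-commutativeMonoid to +-monoid-∼)
  open CommutativeRing ℤ[x] using () renaming (refl to ≋-refl; trans to ≋-trans; sym to ≋-sym; +-identityʳ to +ₚ-identityʳ)
  open PolyRing using (+ₚ-cong; *ₚ-cong; *ₚ-distribʳ; *ₚ-identityˡ)
  open BigOperator +-monoid-∼ renaming (⨀ to ∑) using ()

  -- The additive map X^i ↦ `χ i`. It is not multiplicative; its use is to carry congruences between
  -- coefficients to congruences between sums of values of `χ`.
  linear : (ℕ → Poly) → Poly → Poly
  linear χ []      = []
  linear χ (c ∷ P) = (constₚ c *ₚ χ 0) +ₚ linear (χ ∘ suc) P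

  constₚ0≋ : constₚ (+ 0) ≋ []
  constₚ0≋ = pointwise λ { zero → ≡.refl ; (suc i) → ≡.refl }

  constₚ0-*ₚ : ∀ P → constₚ (+ 0) *ₚ P ≋ []
  constₚ0-*ₚ P = *ₚ-cong constₚ0≋ (≋-refl {P})

  linear-zero : ∀ χ K → (∀ i → + p ∣ᶻ coeff K i) → linear χ K ∼ []
  linear-zero χ []      h = ∼-refl
  linear-zero χ (b ∷ K) h = +-cong-∼
    (∼-trans (*-cong-∼ (constₚ-∼ b (+ 0) (subst (+ p ∣ᶻ_) (≡.sym (ℤₚ.+-identityʳ b)) (h 0))) ∼-refl) (≈⇒∼ (constₚ0-*ₚ (χ 0))))
    (linear-zero (χ ∘ suc) K (h ∘ suc))

  linear-∼ : ∀ χ S K → (∀ i → + p ∣ᶻ coeff S i ℤ.- coeff K i) → linear χ S ∼ linear χ K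
  linear-∼ χ []      K       h = ∼-sym (linear-zero χ K λ i → subst (+ p ∣ᶻ_)
    (≡.trans (cong ℤ.-_ (ℤₚ.+-identityˡ _)) (ℤₚ.neg-involutive _)) (ℤ∣.∣m⇒∣-m (h i)))
  linear-∼ χ (a ∷ S) []      h = linear-zero χ (a ∷ S) λ i → subst (+ p ∣ᶻ_) (ℤₚ.+-identityʳ _) (h i)
  linear-∼ χ (a ∷ S) (b ∷ K) h = +-cong-∼ (*-cong-∼ (constₚ-∼ a b (h 0)) ∼-refl) (linear-∼ (χ ∘ suc) S K (h ∘ suc))

  linear-+ : ∀ χ P Q → linear χ (P +ₚ Q) ≋ linear χ P +ₚ linear χ Q
  linear-+ χ []      Q       = ≋-refl
  linear-+ χ (a ∷ P) []      = ≋-sym (+ₚ-identityʳ _)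
  linear-+ χ (a ∷ P) (b ∷ Q) = ≋-trans
    (+ₚ-cong (*ₚ-distribʳ (χ 0) (constₚ a) (constₚ b)) (linear-+ (χ ∘ suc) P Q))
    (interchange (constₚ a *ₚ χ 0) (constₚ b *ₚ χ 0) (linear (χ ∘ suc) P) (linear (χ ∘ suc) Q))
    where
    open import Algebra.Properties.CommutativeSemigroup (CommutativeRing.+-commutativeSemigroup ℤ[x]) using (interchange)

  linear-mono : ∀ χ k → linear χ (monoₚ k) ≋ χ k
  linear-mono χ zero    = ≋-trans (+ₚ-identityʳ _) (*ₚ-identityˡ (χ 0))
  linear-mono χ (suc k) = +ₚ-cong (constₚ0-*ₚ (χ 0)) (linear-mono (χ ∘ suc) k)

  module _ (2≤e : 2 ≤ e) where
    open FermatLagrange p prime using (e≢0)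
    private instance
      period≢0 : NonZero e
      period≢0 = e≢0 2≤e

    linear-residuePoly : ∀ χ ds → linear χ (residuePoly 2≤e ds) ≋ ∑ (λ d → χ (d ℕ.% e)) ds
    linear-residuePoly χ []       = ≋-refl
    linear-residuePoly χ (d ∷ ds) = ≋-trans (linear-+ χ (monoₚ (d ℕ.% e)) (residuePoly 2≤e ds))
      (+ₚ-cong (linear-mono χ (d ℕ.% e)) (linear-residuePoly χ ds))

    -- An identity for an arbitrary function `χ`: it is the coefficientwise congruence of
    -- `residuePoly-divisors` pushed through `linear χ`.
    ∑-divisors : ∀ χ n → p ∣ n → WeaklyAlmostPrime n → ∑ (λ d → χ (d ℕ.% e)) (divisors n) ∼ (constₚ (+ numDiv n) *ₚ χ 1)
    ∑-divisors χ n p∣n wap = ∼-trans (≈⇒∼ (≋-sym (linear-residuePoly χ (divisors n))))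
      (∼-trans (linear-∼ χ (residuePoly 2≤e (divisors n)) (+ 0 ∷ constₚ (+ numDiv n)) (residuePoly-divisors 2≤e n p∣n wap))
        (≈⇒∼ (+ₚ-cong (constₚ0-*ₚ (χ 0)) (+ₚ-identityʳ (constₚ (+ numDiv n) *ₚ χ 1)))))

-- Characters modulo s

list-pigeonhole : ∀ {a} {A : Set a} (xs : List A) (f : ℕ → A) → (∀ i → f i ∈ xs) →
  ∃₂ λ i j → i < j × j ≤ length xs × f i ≡ f j
list-pigeonhole xs f f∈ with Fin.pigeonhole (ℕₚ.n<1+n (length xs)) (λ i → Any.index (f∈ (toℕ i)))
... | i , j , i<j , eq = toℕ i , toℕ j , i<j , ℕₚ.≤-pred (Fin.toℕ<n j) ,
  ≡.trans (lookup-index (f∈ (toℕ i))) (≡.trans (cong (List.lookup xs) eq) (≡.sym (lookup-index (f∈ (toℕ j)))))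

lookup-unique : ∀ {a} {A : Set a} {xs : List A} → Unique xs → ∀ i j → List.lookup xs i ≡ List.lookup xs j → i ≡ j
lookup-unique (x∉ ∷ u) Fin.zero    Fin.zero    eq = ≡.refl
lookup-unique (x∉ ∷ u) Fin.zero    (Fin.suc j) eq = contradiction eq (All.lookup x∉ (∈-lookup j))
lookup-unique (x∉ ∷ u) (Fin.suc i) Fin.zero    eq = contradiction (≡.sym eq) (All.lookup x∉ (∈-lookup i))
lookup-unique (x∉ ∷ u) (Fin.suc i) (Fin.suc j) eq = cong Fin.suc (lookup-unique u i j eq)

module PrimitiveRoot (s g : ℕ) (1<s : 1 < s) (generator : IsGenerator s g) where
  import Data.Nat.Coprimality as Coprimality
  open import Data.Integer.Tactic.RingSolver using (solve-∀)

  infix 4 _≅_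

  -- The relation `_≡_[mod_]` in signed form, so that sums and products of divisible integers can be
  -- used without absolute values.
  record _≅_ (a b : ℕ) : Set where
    constructor congruent
    field ∣-difference : + s ∣ᶻ + a ℤ.- + b

  open _≅_

  instance
    s≢0 : NonZero s
    s≢0 = ℕ.>-nonZero (ℕₚ.<⇒≤ 1<s)

  ≅-refl : ∀ {a} → a ≅ a
  ≅-refl {a} = congruent (divides (+ 0) (ℤₚ.+-inverseʳ (+ a)))

  ≅-sym : ∀ {a b} → a ≅ b → b ≅ a
  ≅-sym {a} {b} (congruent h) = congruent (subst (+ s ∣ᶻ_) (lemma (+ a) (+ b)) (ℤ∣.∣m⇒∣-m h))
    where
    lemma : ∀ a b → ℤ.- (a ℤ.- b) ≡ b ℤ.- a
    lemma = solve-∀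

  ≅-trans : ∀ {a b c} → a ≅ b → b ≅ c → a ≅ c
  ≅-trans {a} {b} {c} (congruent h) (congruent k) = congruent (subst (+ s ∣ᶻ_) (lemma (+ a) (+ b) (+ c)) (ℤ∣.∣m∣n⇒∣m+n h k))
    where
    lemma : ∀ a b c → a ℤ.- b ℤ.+ (b ℤ.- c) ≡ a ℤ.- c
    lemma = solve-∀

  ≅-* : ∀ {a b c d} → a ≅ b → c ≅ d → (a ℕ.* c) ≅ (b ℕ.* d)
  ≅-* {a} {b} {c} {d} (congruent h) (congruent k) = congruent (subst (+ s ∣ᶻ_)
    (≡.trans (lemma (+ a) (+ b) (+ c) (+ d)) (≡.sym (cong₂ ℤ._-_ (ℤₚ.pos-* a c) (ℤₚ.pos-* b d))))
    (ℤ∣.∣m∣n⇒∣m+n (ℤ∣.∣m⇒∣m*n (+ c) h) (ℤ∣.∣n⇒∣m*n (+ b) k)))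
    where
    lemma : ∀ a b c d → (a ℤ.- b) ℤ.* c ℤ.+ b ℤ.* (c ℤ.- d) ≡ a ℤ.* c ℤ.- b ℤ.* d
    lemma = solve-∀

  ≅-+* : ∀ a q → (a ℕ.+ q ℕ.* s) ≅ a
  ≅-+* a q = congruent (divides (+ q) (≡.trans (cong (λ z → + a ℤ.+ z ℤ.- + a) (ℤₚ.pos-* q s)) (lemma (+ a) (+ q ℤ.* + s))))
    where
    lemma : ∀ a z → a ℤ.+ z ℤ.- a ≡ z
    lemma = solve-∀

  ≅-% : ∀ a → a ≅ (a ℕ.% s)
  ≅-% a = subst (_≅ (a ℕ.% s)) (≡.sym (ℕ.m≡m%n+[m/n]*n a s)) (≅-+* (a ℕ.% s) (a ℕ./ s))

  distance : ∀ {a b} → a ≤ b → ℤ.∣ + b ℤ.- + a ∣ ≡ b ∸ a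
  distance {a} {b} a≤b = cong ℤ.∣_∣ (≡.trans (ℤₚ.m-n≡m⊖n b a) (ℤₚ.⊖-≥ a≤b))

  ≅⇒∣ : ∀ {a b} → a ≤ b → b ≅ a → s ∣ b ∸ a
  ≅⇒∣ a≤b (congruent h) = subst (s ∣_) (distance a≤b) (ℤ∣.∣⇒∣ᵤ h)

  ≤∧≅⇒≡ : ∀ {a b} → a ≤ b → b < s → b ≅ a → a ≡ b
  ≤∧≅⇒≡ {a} {b} a≤b b<s b≅a with b ∸ a in eq | ≅⇒∣ a≤b b≅a
  ... | zero  | _   = ℕₚ.≤-antisym a≤b (ℕₚ.m∸n≡0⇒m≤n eq)
  ... | suc k | s∣k = contradiction (ℕₚ.≤-<-trans (subst (_≤ b) eq (ℕₚ.m∸n≤m b a)) b<s) (ℕₚ.≤⇒≯ (ℕ.∣⇒≤ s∣k))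

  ≅⇒≡ : ∀ {a b} → a < s → b < s → a ≅ b → a ≡ b
  ≅⇒≡ {a} {b} a<s b<s a≅b with ℕₚ.≤-total a b
  ... | inj₁ a≤b = ≤∧≅⇒≡ a≤b b<s (≅-sym a≅b)
  ... | inj₂ b≤a = ≡.sym (≤∧≅⇒≡ b≤a a<s a≅b)

  coprime-resp-≅ : ∀ {a b} → a ≅ b → Coprime a s → Coprime b s
  coprime-resp-≅ {a} {b} (congruent a≅b) c {d} (d∣b , d∣s) = c
    (ℤ∣.∣⇒∣ᵤ {+ d} {+ a} (ℤ∣.∣m+n∣n⇒∣m {+ d} {+ a} {ℤ.- (+ b)} (ℤ∣.∣-trans {+ d} {+ s} (ℤ∣.∣ᵤ⇒∣ d∣s) a≅b) (ℤ∣.∣m⇒∣-m (ℤ∣.∣ᵤ⇒∣ d∣b))) , d∣s)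

  coprime-* : ∀ {a b} → Coprime a s → Coprime b s → Coprime (a ℕ.* b) s
  coprime-* ca cb {d} (d∣ab , d∣s) = cb (coprime-divisor (λ { (k∣d , k∣a) → ca (k∣a , ℕ.∣-trans k∣d d∣s) }) d∣ab , d∣s)

  coprime-*ˡ : ∀ {a b} → Coprime (a ℕ.* b) s → Coprime a s
  coprime-*ˡ {a} {b} c {d} (d∣a , d∣s) = c (ℕ.∣m⇒∣m*n b d∣a , d∣s)

  coprime-*ʳ : ∀ {a b} → Coprime (a ℕ.* b) s → Coprime b s
  coprime-*ʳ {a} {b} c {d} (d∣b , d∣s) = c (ℕ.∣n⇒∣m*n a d∣b , d∣s)

  coprime-g^ : ∀ l → Coprime (g ^ l) s
  coprime-g^ zero    = Coprimality.1-coprimeTo s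
  coprime-g^ (suc l) = coprime-* (proj₁ generator) (coprime-g^ l)

  log : ∀ a → Coprime a s → ℕ
  log a c = proj₁ (proj₂ generator a c)

  g^log : ∀ a (c : Coprime a s) → (g ^ log a c) ≅ a
  g^log a c = congruent (ℤ∣.∣ᵤ⇒∣ (proj₂ (proj₂ generator a c)))

  ≅-cancel : ∀ i k → (g ^ (i ℕ.+ k)) ≅ (g ^ i) → (g ^ k) ≅ 1
  ≅-cancel i k (congruent h) = congruent (ℤ∣.∣ᵤ⇒∣ (coprime-divisor (Coprimality.sym (coprime-g^ i)) (subst (s ∣_) factored (ℤ∣.∣⇒∣ᵤ h))))
    where
    lemma : ∀ x y → x ℤ.* y ℤ.- x ≡ x ℤ.* (y ℤ.- + 1)
    lemma = solve-∀
    factored : ℤ.∣ + (g ^ (i ℕ.+ k)) ℤ.- + (g ^ i) ∣ ≡ g ^ i ℕ.* ℤ.∣ + (g ^ k) ℤ.- + 1 ∣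
    factored = ≡.trans (cong ℤ.∣_∣ (≡.trans
      (cong (ℤ._- + (g ^ i)) (≡.trans (cong +_ (ℕₚ.^-distribˡ-+-* g i k)) (ℤₚ.pos-* (g ^ i) (g ^ k))))
      (lemma (+ (g ^ i)) (+ (g ^ k)))))
      (ℤₚ.abs-* (+ (g ^ i)) (+ (g ^ k) ℤ.- + 1))

  g^-multiple : ∀ {k} → (g ^ k) ≅ 1 → ∀ q → (g ^ (q ℕ.* k)) ≅ 1
  g^-multiple     h zero    = ≅-refl
  g^-multiple {k} h (suc q) = subst (_≅ 1) (≡.sym (ℕₚ.^-distribˡ-+-* g k (q ℕ.* k))) (≅-* h (g^-multiple h q))

  g^-% : ∀ {k} .{{_ : NonZero k}} → (g ^ k) ≅ 1 → ∀ l → (g ^ l) ≅ (g ^ (l ℕ.% k))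
  g^-% {k} h l = subst₂ _≅_
    (≡.trans (≡.sym (ℕₚ.^-distribˡ-+-* g r q)) (cong (g ^_) (≡.sym (ℕ.m≡m%n+[m/n]*n l k)))) (ℕₚ.*-identityʳ (g ^ r))
    (≅-* (≅-refl {g ^ r}) (g^-multiple h (l ℕ./ k)))
    where
    r = l ℕ.% k
    q = l ℕ./ k ℕ.* k

  units : List ℕ
  units = filter (λ k → coprime? k s) (range1 s)

  m : ℕ
  m = totient s

  unit⁻ : ∀ {a} → a ∈ units → 1 ≤ a × a < s × Coprime a s
  unit⁻ {a} a∈ with ∈-filter⁻ (λ k → coprime? k s) {xs = range1 s} a∈
  ... | a∈range , c = proj₁ (∈-range1⁻ a∈range) , ℕₚ.≤∧≢⇒< (proj₂ (∈-range1⁻ a∈range)) a≢s , c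
    where
    a≢s : a ≢ s
    a≢s ≡.refl = ℕₚ.<⇒≢ 1<s (≡.sym (c (ℕ.∣-refl , ℕ.∣-refl)))

  unit⁺ : ∀ {a} → a < s → Coprime a s → a ∈ units
  unit⁺ {a} a<s c = ∈-filter⁺ (λ k → coprime? k s) (∈-range1⁺ (ℕₚ.n≢0⇒n>0 a≢0) (ℕₚ.<⇒≤ a<s)) c
    where
    a≢0 : a ≢ 0
    a≢0 ≡.refl = ℕₚ.<⇒≢ 1<s (≡.sym (Coprimality.0-coprimeTo-m⇒m≡1 c))

  units-unique : Unique units
  units-unique = Unique.filter⁺ (λ k → coprime? k s) (range1-unique s)

  abstract
    -- If g^k is 1, every unit is a power of `g` with exponent below `k`; sending a unit to that
    -- exponent is injective, so there are at most `k` units.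
    m≤order : ∀ {k} → 1 ≤ k → (g ^ k) ≅ 1 → m ≤ k
    m≤order {k} 1≤k h = Fin.injective⇒≤ {f = residue} residue-injective
      where
      instance
        k≢0 : NonZero k
        k≢0 = ℕ.>-nonZero 1≤k
      unit : Fin m → ℕ
      unit i = List.lookup units i
      coprime-unit : ∀ i → Coprime (unit i) s
      coprime-unit i = proj₂ (proj₂ (unit⁻ (∈-lookup i)))
      ℓ : Fin m → ℕ
      ℓ i = log (unit i) (coprime-unit i)
      residue : Fin m → Fin k
      residue i = fromℕ< (ℕ.m%n<n (ℓ i) k)
      unit≅ : ∀ i → (g ^ (ℓ i ℕ.% k)) ≅ unit i
      unit≅ i = ≅-trans (≅-sym (g^-% h (ℓ i))) (g^log (unit i) (coprime-unit i))
      residue-injective : ∀ {i j} → residue i ≡ residue j → i ≡ j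
      residue-injective {i} {j} eq = lookup-unique units-unique i j (≅⇒≡ (proj₁ (proj₂ (unit⁻ (∈-lookup i)))) (proj₁ (proj₂ (unit⁻ (∈-lookup j))))
        (≅-trans (≅-sym (subst (λ r → (g ^ r) ≅ unit i) same (unit≅ i))) (unit≅ j)))
        where
        same : ℓ i ℕ.% k ≡ ℓ j ℕ.% k
        same = ≡.trans (≡.sym (Fin.toℕ-fromℕ< (ℕ.m%n<n (ℓ i) k))) (≡.trans (cong toℕ eq) (Fin.toℕ-fromℕ< (ℕ.m%n<n (ℓ j) k)))

    g^%∈units : ∀ i → (g ^ i) ℕ.% s ∈ units
    g^%∈units i = unit⁺ (ℕ.m%n<n (g ^ i) s) (coprime-resp-≅ (≅-% (g ^ i)) (coprime-g^ i))

    -- Among the `m` + 1 powers g^0, ..., g^m, which lie in `m` unit classes, two coincide; `k` is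
    -- the difference of their exponents. With `m≤order` this makes the order equal to `m`.
    collision : ∃ λ k → 1 ≤ k × k ≤ m × (g ^ k) ≅ 1
    collision = let i , j , i<j , j≤m , same = list-pigeonhole units (λ i → (g ^ i) ℕ.% s) g^%∈units in
      j ∸ i , ℕₚ.m<n⇒0<n∸m i<j , ℕₚ.≤-trans (ℕₚ.m∸n≤m j i) j≤m ,
      ≅-cancel i (j ∸ i) (subst (λ k → (g ^ k) ≅ (g ^ i)) (≡.sym (ℕₚ.m+[n∸m]≡n (ℕₚ.<⇒≤ i<j)))
        (≅-trans (≅-% (g ^ j)) (subst (_≅ (g ^ i)) same (≅-sym (≅-% (g ^ i))))))

    1≤m : 1 ≤ m
    1≤m = let _ , 1≤k , k≤m , _ = collision in ℕₚ.≤-trans 1≤k k≤m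

  instance
    m≢0 : NonZero m
    m≢0 = ℕ.>-nonZero 1≤m

  abstract
    g^m≅1 : (g ^ m) ≅ 1
    g^m≅1 = let k , 1≤k , k≤m , h = collision in subst (λ k → (g ^ k) ≅ 1) (ℕₚ.≤-antisym k≤m (m≤order 1≤k h)) h

  order-∣ : ∀ k → (g ^ k) ≅ 1 → m ∣ k
  order-∣ k h with k ℕ.% m in eq
  ... | zero  = ℕ.m%n≡0⇒n∣m k m eq
  ... | suc r = contradiction (subst (_< m) eq (ℕ.m%n<n k m)) (ℕₚ.≤⇒≯ (m≤order (s≤s z≤n)
    (subst (λ r → (g ^ r) ≅ 1) eq (≅-trans (≅-sym (g^-% g^m≅1 k)) h))))

  exponents-∣ : ∀ {a b} → a ≤ b → (g ^ b) ≅ (g ^ a) → m ∣ b ∸ a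
  exponents-∣ {a} {b} a≤b h = order-∣ (b ∸ a) (≅-cancel a (b ∸ a) (subst (λ k → (g ^ k) ≅ (g ^ a)) (≡.sym (ℕₚ.m+[n∸m]≡n a≤b)) h))

  exponents-≡ : ∀ {a b} → a ∈ range1 m → b ∈ range1 m → (g ^ a) ≅ (g ^ b) → a ≡ b
  exponents-≡ {a} {b} a∈ b∈ h = [ (λ a≤b → ordered a∈ b∈ a≤b (≅-sym h)) , (λ b≤a → ≡.sym (ordered b∈ a∈ b≤a h)) ]′ (ℕₚ.≤-total a b)
    where
    ordered : ∀ {a b} → a ∈ range1 m → b ∈ range1 m → a ≤ b → (g ^ b) ≅ (g ^ a) → a ≡ b
    ordered {a} {b} a∈ b∈ a≤b h with b ∸ a in eq | exponents-∣ a≤b h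
    ... | zero  | _   = ℕₚ.≤-antisym a≤b (ℕₚ.m∸n≡0⇒m≤n eq)
    ... | suc k | m∣k = contradiction
      (subst (_< m) eq (ℕₚ.<-≤-trans (ℕₚ.∸-monoʳ-< (proj₁ (∈-range1⁻ a∈)) a≤b) (proj₂ (∈-range1⁻ b∈))))
      (ℕₚ.≤⇒≯ (ℕ.∣⇒≤ m∣k))

  log-range1 : ∀ a → Coprime a s → ∃ λ l → l ∈ range1 m × (g ^ l) ≅ a
  log-range1 a c with log a c ℕ.% m in eq
  ... | suc r = suc r , ∈-range1⁺ (s≤s z≤n) (ℕₚ.<⇒≤ (subst (_< m) eq (ℕ.m%n<n (log a c) m))) ,
    ≅-trans (≅-sym (subst (λ r → (g ^ log a c) ≅ (g ^ r)) eq (g^-% g^m≅1 (log a c)))) (g^log a c)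
  -- The exponents range over 1, ..., m as in the product defining f, so residue 0 is represented by
  -- `m`.
  ... | zero = m , ∈-range1⁺ 1≤m ℕₚ.≤-refl ,
    ≅-trans g^m≅1 (≅-trans (≅-sym (subst (λ r → (g ^ log a c) ≅ (g ^ r)) eq (g^-% g^m≅1 (log a c)))) (g^log a c))

  module Character {c ℓ} (R : CommutativeRing c ℓ) (ψ : ℕ → CommutativeRing.Carrier R)
    (ψ-0 : CommutativeRing._≈_ R (ψ 0) (CommutativeRing.1# R))
    (ψ-+ : ∀ a b → CommutativeRing._≈_ R (ψ (a ℕ.+ b)) (CommutativeRing._*_ R (ψ a) (ψ b)))
    (ψ-m : CommutativeRing._≈_ R (ψ m) (CommutativeRing.1# R))
    where
    open CommutativeRing R renaming (refl to ≈-refl; trans to ≈-trans; sym to ≈-sym)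
    open BigOperator *-commutativeMonoid renaming (⨀ to ∏; ⨀-single to ∏-single; ⨀-ε to ∏-1) using ()

    -- `log` returns whichever exponent the generator hypothesis supplies. The choice is immaterial
    -- by `ψ-cong`: exponents of equal powers differ by a multiple of `m`.
    χ : ℕ → Carrier
    χ a with coprime? a s
    ... | yes c = ψ (log a c)
    ... | no  _ = 0#

    ψ-multiple : ∀ q → ψ (q ℕ.* m) ≈ 1#
    ψ-multiple zero    = ψ-0
    ψ-multiple (suc q) = ≈-trans (ψ-+ m (q ℕ.* m)) (≈-trans (*-cong ψ-m (ψ-multiple q)) (*-identityˡ 1#))

    ψ-shift : ∀ {a b} → a ≤ b → (g ^ b) ≅ (g ^ a) → ψ b ≈ ψ a
    ψ-shift {a} {b} a≤b h with exponents-∣ a≤b h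
    ... | ℕ.divides q eq = ≈-trans (reflexive (cong ψ (≡.trans (≡.sym (ℕₚ.m+[n∸m]≡n a≤b)) (cong (a ℕ.+_) eq))))
      (≈-trans (ψ-+ a (q ℕ.* m)) (≈-trans (*-congˡ (ψ-multiple q)) (*-identityʳ (ψ a))))

    ψ-cong : ∀ {a b} → (g ^ a) ≅ (g ^ b) → ψ a ≈ ψ b
    ψ-cong {a} {b} h = [ (λ a≤b → ≈-sym (ψ-shift a≤b (≅-sym h))) , (λ b≤a → ψ-shift b≤a h) ]′ (ℕₚ.≤-total a b)

    χ-power : ∀ {a} l → (g ^ l) ≅ a → χ a ≈ ψ l
    χ-power {a} l h with coprime? a s
    ... | yes c = ψ-cong (≅-trans (g^log a c) (≅-sym h))
    ... | no ¬c = ⊥-elim (¬c (coprime-resp-≅ h (coprime-g^ l)))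

    χ-nonunit : ∀ {a} → ¬ Coprime a s → χ a ≈ 0#
    χ-nonunit {a} ¬c with coprime? a s
    ... | yes c = ⊥-elim (¬c c)
    ... | no _  = ≈-refl

    χ-cong : ∀ {a b} → a ≅ b → χ a ≈ χ b
    χ-cong {a} {b} a≅b = by-cases (coprime? a s)
      where
      by-cases : Dec (Coprime a s) → χ a ≈ χ b
      by-cases (yes c) = ≈-trans (χ-power (log a c) (g^log a c)) (≈-sym (χ-power (log a c) (≅-trans (g^log a c) a≅b)))
      by-cases (no ¬c) = ≈-trans (χ-nonunit ¬c) (≈-sym (χ-nonunit λ c → ¬c (coprime-resp-≅ (≅-sym a≅b) c)))

    χ-1 : χ 1 ≈ 1#
    χ-1 = ≈-trans (χ-power 0 (≅-refl)) ψ-0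

    χ-* : ∀ a b → χ (a ℕ.* b) ≈ χ a * χ b
    χ-* a b = by-cases (coprime? a s) (coprime? b s)
      where
      by-cases : Dec (Coprime a s) → Dec (Coprime b s) → χ (a ℕ.* b) ≈ χ a * χ b
      by-cases (yes ca) (yes cb) = ≈-trans
        (χ-power (log a ca ℕ.+ log b cb) (subst (_≅ (a ℕ.* b)) (≡.sym (ℕₚ.^-distribˡ-+-* g (log a ca) (log b cb)))
          (≅-* (g^log a ca) (g^log b cb))))
        (≈-trans (ψ-+ (log a ca) (log b cb)) (≈-sym (*-cong (χ-power (log a ca) (g^log a ca)) (χ-power (log b cb) (g^log b cb)))))
      by-cases (no ¬ca) _ = ≈-trans (χ-nonunit (¬ca ∘ coprime-*ˡ)) (≈-sym (≈-trans (*-congʳ (χ-nonunit ¬ca)) (zeroˡ (χ b))))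
      by-cases _ (no ¬cb) = ≈-trans (χ-nonunit (¬cb ∘ coprime-*ʳ {a})) (≈-sym (≈-trans (*-congˡ (χ-nonunit ¬cb)) (zeroʳ (χ a))))

    -- For a unit `r` exactly one `l` in the range has g^l congruent to `r`, and its factor is 1 + χ
    -- r. For a non-unit all factors are 1 and χ r is 0.
    1+χ≈∏ : ∀ r → 1# + χ r ≈ ∏ (λ l → if does (s ℕ.∣? ℤ.∣ + r ℤ.- + (g ^ l) ∣) then 1# + ψ l else 1#) (range1 m)
    1+χ≈∏ r = by-cases (coprime? r s)
      where
      factor : ℕ → Carrier
      factor l = if does (s ℕ.∣? ℤ.∣ + r ℤ.- + (g ^ l) ∣) then 1# + ψ l else 1#
      factor-yes : ∀ {l} → (g ^ l) ≅ r → factor l ≡ 1# + ψ l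
      factor-yes {l} h rewrite dec-true (s ℕ.∣? ℤ.∣ + r ℤ.- + (g ^ l) ∣) (ℤ∣.∣⇒∣ᵤ (∣-difference (≅-sym h))) = ≡.refl
      factor-no : ∀ {l} → ¬ ((g ^ l) ≅ r) → factor l ≡ 1#
      factor-no {l} ¬h rewrite dec-false (s ℕ.∣? ℤ.∣ + r ℤ.- + (g ^ l) ∣) (λ h → ¬h (≅-sym (congruent (ℤ∣.∣ᵤ⇒∣ h)))) = ≡.refl
      by-cases : Dec (Coprime r s) → 1# + χ r ≈ ∏ factor (range1 m)
      by-cases (yes c) with log-range1 r c
      ... | l , l∈ , h = ≈-sym (≈-trans
        (∏-single (range1-unique m) l∈ λ {k} k∈ k≢l → reflexive (factor-no λ h′ →
          k≢l (exponents-≡ k∈ l∈ (≅-trans h′ (≅-sym h)))))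
        (≈-trans (reflexive (factor-yes h)) (+-congˡ (≈-sym (χ-power l h)))))
      by-cases (no ¬c) = ≈-trans (≈-trans (+-congˡ (χ-nonunit ¬c)) (+-identityʳ 1#))
        (≈-sym (∏-1 (range1 m) λ {l} _ → reflexive (factor-no λ h → ¬c (coprime-resp-≅ h (coprime-g^ l)))))

-- Multiplicative functions on square-free numbers

subsetProducts : List ℕ → List ℕ
subsetProducts []       = 1 ∷ []
subsetProducts (r ∷ rs) = subsetProducts rs ++ map (r ℕ.*_) (subsetProducts rs)

subsetProducts-∣ : ∀ rs {d} → d ∈ subsetProducts rs → d ∣ product rs
subsetProducts-∣ []       (here ≡.refl) = ℕ.∣-refl
subsetProducts-∣ (r ∷ rs) d∈ with ∈-++⁻ (subsetProducts rs) d∈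
... | inj₁ d∈S = ℕ.∣n⇒∣m*n r (subsetProducts-∣ rs d∈S)
... | inj₂ d∈rS with ∈-map⁻ (r ℕ.*_) d∈rS
...   | c , c∈S , ≡.refl = ℕ.*-monoʳ-∣ r (subsetProducts-∣ rs c∈S)

-- Whether `r` divides `d` decides the half of the list: if it does, `r` is cancelled; if not, `d`
-- is coprime to the prime `r` and divides the remaining product.
∣-subsetProducts : ∀ {rs d} → All Prime rs → d ∣ product rs → d ∈ subsetProducts rs
∣-subsetProducts {[]}     []       d∣1 = here (ℕ.∣1⇒≡1 d∣1)
∣-subsetProducts {r ∷ rs} {d} (pr ∷ prs) d∣ with r ℕ.∣? d
... | yes (ℕ.divides c ≡.refl) = ∈-++⁺ʳ (subsetProducts rs) (subst (_∈ map (r ℕ.*_) (subsetProducts rs)) (ℕₚ.*-comm r c)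
  (∈-map⁺ (r ℕ.*_) (∣-subsetProducts prs (ℕ.*-cancelˡ-∣ r {{prime⇒nonZero pr}} (subst (_∣ r ℕ.* product rs) (ℕₚ.*-comm c r) d∣)))))
... | no r∤d = ∈-++⁺ˡ (∣-subsetProducts prs (coprime-divisor coprime d∣))
  where
  coprime : Coprime d r
  coprime {k} (k∣d , k∣r) with prime⇒irreducible pr k∣r
  ... | inj₁ k≡1    = k≡1
  ... | inj₂ ≡.refl = contradiction k∣d r∤d

-- An element common to both halves would make `r` divide `product rs`, and hence occur among the
-- primes `rs`.
subsetProducts-unique : ∀ {rs} → All Prime rs → Unique rs → Unique (subsetProducts rs)
subsetProducts-unique {[]}     []         []       = [] ∷ []
subsetProducts-unique {r ∷ rs} (pr ∷ prs) (r∉ ∷ u) = Unique.++⁺ uS (Unique.map⁺ (ℕₚ.*-cancelˡ-≡ _ _ r {{prime⇒nonZero pr}}) uS) disjoint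
  where
  uS = subsetProducts-unique prs u
  disjoint : ∀ {x} → ¬ (x ∈ subsetProducts rs × x ∈ map (r ℕ.*_) (subsetProducts rs))
  disjoint (x∈S , x∈rS) with ∈-map⁻ (r ℕ.*_) x∈rS
  ... | c , _ , ≡.refl = All.lookup r∉ (factorisationHasAllPrimeFactors pr (ℕ.∣-trans (ℕ.m∣m*n c) (subsetProducts-∣ rs x∈S)) prs) ≡.refl

primes-unique : ∀ {rs} → All Prime rs → SquareFree (product rs) → Unique rs
primes-unique {[]}     []         sf = []
primes-unique {r ∷ rs} (pr ∷ prs) sf =
  All.tabulate (λ { r∈rs ≡.refl → sf r pr (ℕ.*-monoʳ-∣ r (∈⇒∣product r∈rs)) }) ∷
  primes-unique prs (λ q pq q²∣ → sf q pq (ℕ.∣n⇒∣m*n r q²∣))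

primeDivisors : ℕ → List ℕ
primeDivisors n = filter (λ r → prime? r ×-dec (r ℕ.∣? n)) (range1 n)

primeDivisors↭factors : ∀ {n rs} .{{_ : NonZero n}} → All Prime rs → n ≡ product rs → SquareFree n → primeDivisors n ↭ rs
primeDivisors↭factors {n} {rs} prs ≡.refl sf = ↭-fromSet
  (Unique.filter⁺ prime-divisor? (range1-unique n)) (primes-unique prs sf)
  (λ r∈ → let _ , pr , r∣n = ∈-filter⁻ prime-divisor? {xs = range1 n} r∈ in factorisationHasAllPrimeFactors pr r∣n prs)
  (λ r∈ → ∈-filter⁺ prime-divisor? (∈-range1⁺ (ℕ.>-nonZero⁻¹ _ {{prime⇒nonZero (All.lookup prs r∈)}}) (ℕ.∣⇒≤ (∈⇒∣product r∈)))
    (All.lookup prs r∈ , ∈⇒∣product r∈))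
  where
  prime-divisor? : Decidable (λ r → Prime r × r ∣ n)
  prime-divisor? r = prime? r ×-dec (r ℕ.∣? n)

divisors↭subsetProducts : ∀ {n rs} .{{_ : NonZero n}} → All Prime rs → n ≡ product rs → SquareFree n → divisors n ↭ subsetProducts rs
divisors↭subsetProducts {n} {rs} prs ≡.refl sf = ↭-fromSet
  (divisors-unique n) (subsetProducts-unique prs (primes-unique prs sf))
  (λ d∈ → ∣-subsetProducts prs (proj₂ (proj₂ (∈-divisors⁻ d∈))))
  (λ d∈ → ∈-divisors⁺ (ℕ.>-nonZero⁻¹ n) (subsetProducts-∣ rs d∈))

module MultiplicativeSums {c ℓ} (R : CommutativeRing c ℓ) (χ : ℕ → CommutativeRing.Carrier R)
  (χ-1 : CommutativeRing._≈_ R (χ 1) (CommutativeRing.1# R))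
  (χ-* : ∀ a b → CommutativeRing._≈_ R (χ (a ℕ.* b)) (CommutativeRing._*_ R (χ a) (χ b)))
  where
  open CommutativeRing R renaming (trans to ≈-trans; sym to ≈-sym)
  open BigOperator +-commutativeMonoid renaming (⨀ to ∑; ⨀-++ to ∑-++; ⨀-↭ to ∑-↭) using ()
  open BigOperator *-commutativeMonoid renaming (⨀ to ∏; ⨀-↭ to ∏-↭) using ()
  open import Relation.Binary.Reasoning.Setoid setoid

  ∑-scale : ∀ r ds → ∑ χ (map (r ℕ.*_) ds) ≈ χ r * ∑ χ ds
  ∑-scale r []       = ≈-sym (zeroʳ (χ r))
  ∑-scale r (d ∷ ds) = ≈-trans (+-cong (χ-* r d) (∑-scale r ds)) (≈-sym (distribˡ (χ r) (χ d) (∑ χ ds)))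

  ∏-subsetProducts : ∀ rs → ∏ (λ r → 1# + χ r) rs ≈ ∑ χ (subsetProducts rs)
  ∏-subsetProducts []       = ≈-sym (≈-trans (+-identityʳ (χ 1)) χ-1)
  ∏-subsetProducts (r ∷ rs) = begin
    (1# + χ r) * ∏ (λ r → 1# + χ r) rs                          ≈⟨ *-congˡ (∏-subsetProducts rs) ⟩
    (1# + χ r) * ∑ χ (subsetProducts rs)                        ≈⟨ distribʳ _ 1# (χ r) ⟩
    1# * ∑ χ (subsetProducts rs) + χ r * ∑ χ (subsetProducts rs) ≈⟨ +-cong (*-identityˡ _) (≈-sym (∑-scale r (subsetProducts rs))) ⟩
    ∑ χ (subsetProducts rs) + ∑ χ (map (r ℕ.*_) (subsetProducts rs)) ≈⟨ ∑-++ χ (subsetProducts rs) _ ⟨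
    ∑ χ (subsetProducts rs ++ map (r ℕ.*_) (subsetProducts rs)) ∎

  ∏-primeDivisors : ∀ {n} → 1 ≤ n → SquareFree n → ∏ (λ r → 1# + χ r) (primeDivisors n) ≈ ∑ χ (divisors n)
  ∏-primeDivisors {n} 1≤n sf = begin
    ∏ (λ r → 1# + χ r) (primeDivisors n)   ≈⟨ ∏-↭ _ (primeDivisors↭factors factorsPrime isFactorisation sf) ⟩
    ∏ (λ r → 1# + χ r) factors             ≈⟨ ∏-subsetProducts factors ⟩
    ∑ χ (subsetProducts factors)           ≈⟨ ∑-↭ χ (divisors↭subsetProducts factorsPrime isFactorisation sf) ⟨
    ∑ χ (divisors n)                       ∎
    where
    instance
      n≢0 : NonZero n
      n≢0 = ℕ.>-nonZero 1≤n
    open PrimeFactorisation (factorise n)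

-- Regrouping the factors of f by prime divisors of n

module Rearrangement {c ℓ} (M : CommutativeMonoid c ℓ) where
  open CommutativeMonoid M renaming (refl to ≈-refl; trans to ≈-trans; sym to ≈-sym)
  open BigOperator M
  open import Relation.Binary.Reasoning.Setoid setoid

  power : Carrier → ℕ → Carrier
  power y zero    = ε
  power y (suc k) = y ∙ power y k

  power-filter : ∀ {a p} {A : Set a} {P : Pred A p} (P? : Decidable P) y xs →
    power y (length (filter P? xs)) ≈ ⨀ (λ x → if does (P? x) then y else ε) xs
  power-filter P? y []       = ≈-refl
  power-filter P? y (x ∷ xs) with does (P? x)
  ... | true  = ∙-congˡ (power-filter P? y xs)
  ... | false = ≈-trans (power-filter P? y xs) (≈-sym (identityˡ _))

  -- The exponent counts primes, so the power of `y l` is a product with one factor for each prime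
  -- divisor `r` in the class of g^l; the two products are then interchanged.
  ⨀-power-omega : ∀ n s g (y : ℕ → Carrier) ls →
    ⨀ (λ l → power (y l) (omega n s (g ^ l))) ls ≈
    ⨀ (λ r → ⨀ (λ l → if does (s ℕ.∣? ℤ.∣ + r ℤ.- + (g ^ l) ∣) then y l else ε) ls) (primeDivisors n)
  ⨀-power-omega n s g y ls = begin
    ⨀ (λ l → power (y l) (omega n s (g ^ l))) ls
      ≈⟨ ⨀-cong ls (λ {l} _ → power-filter (λ r → prime? r ×-dec (r ℕ.∣? n) ×-dec (s ℕ.∣? ℤ.∣ + r ℤ.- + (g ^ l) ∣)) (y l) (range1 n)) ⟩
    ⨀ (λ l → ⨀ (λ r → if does (prime? r ×-dec (r ℕ.∣? n) ×-dec (s ℕ.∣? ℤ.∣ + r ℤ.- + (g ^ l) ∣)) then y l else ε) (range1 n)) ls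
      ≈⟨ ⨀-swap M _ ls (range1 n) ⟩
    ⨀ (λ r → ⨀ (λ l → if does (prime? r ×-dec (r ℕ.∣? n) ×-dec (s ℕ.∣? ℤ.∣ + r ℤ.- + (g ^ l) ∣)) then y l else ε) ls) (range1 n)
      ≈⟨ ⨀-cong (range1 n) (λ {r} _ → pull-out (does (prime? r)) (does (r ℕ.∣? n)) (λ l → does (s ℕ.∣? ℤ.∣ + r ℤ.- + (g ^ l) ∣))) ⟩
    ⨀ (λ r → if does (prime? r ×-dec (r ℕ.∣? n)) then ⨀ (λ l → if does (s ℕ.∣? ℤ.∣ + r ℤ.- + (g ^ l) ∣) then y l else ε) ls else ε) (range1 n)
      ≈⟨ ⨀-filter (λ r → prime? r ×-dec (r ℕ.∣? n)) _ (range1 n) ⟨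
    ⨀ (λ r → ⨀ (λ l → if does (s ℕ.∣? ℤ.∣ + r ℤ.- + (g ^ l) ∣) then y l else ε) ls) (primeDivisors n) ∎
    where
    -- The conditions that `r` is prime and divides `n` do not involve `l` and leave the inner
    -- product, where they become the filter defining `primeDivisors`.
    pull-out : ∀ a b (c : ℕ → Bool) →
      ⨀ (λ l → if a ∧ b ∧ c l then y l else ε) ls ≈ (if a ∧ b then ⨀ (λ l → if c l then y l else ε) ls else ε)
    pull-out false b     c = ⨀-ε ls λ _ → ≈-refl
    pull-out true  false c = ⨀-ε ls λ _ → ≈-refl
    pull-out true  true  c = ≈-refl

-- The congruence in ℤ[x]/(p, Φ_m)

module Reduction (n p s g j : ℕ) (almostPrime : AlmostPrime n) (prime : Prime p) (p∣n : p ∣ n)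
  (2<s : 2 < s) (s∣p-1 : s ∣ p ∸ 1) (generator : IsGenerator s g) where

  1<s : 1 < s
  1<s = ℕₚ.<⇒≤ 2<s

  open CyclotomicModulo p prime using (quotient; 1<p; N; N≋U; cyclotomic-∣; module _∼_; ≈⇒∼)
  open FermatLagrange p prime using (e; e≢0)
  open Characters p prime using (∑-divisors)
  open PrimitiveRoot s g 1<s generator using (m; 1≤m; _≅_; ≅-+*; module Character)

  0<e : 0 < e
  0<e = ℕₚ.m<n⇒0<n∸m 1<p

  s≤e : s ≤ e
  s≤e = ℕ.∣⇒≤ {{ℕ.>-nonZero 0<e}} s∣p-1

  2≤e : 2 ≤ e
  2≤e = ℕₚ.≤-trans (ℕₚ.<⇒≤ 2<s) s≤e

  -- This bounds the integers that have to be inverted modulo `p` in the factorisation of x^m - 1.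
  m<p : m < p
  m<p = ℕₚ.≤-<-trans (ℕₚ.≤-trans m≤s s≤e) (ℕₚ.∸-monoʳ-< {p} {1} {0} (s≤s z≤n) (ℕₚ.<⇒≤ 1<p))
    where
    m≤s : m ≤ s
    m≤s = ℕₚ.≤-trans (List.length-filter (λ k → coprime? k s) (range1 s))
      (ℕₚ.≤-reflexive (≡.trans (List.length-map suc (List.upTo s)) (List.length-upTo s)))

  module O/p = Quotient quotient (cyclotomic m)
  open CommutativeRing O/p.quotient
    renaming (refl to ≈-refl; trans to ≈-trans; sym to ≈-sym)
  open CommutativeRing ℤ[x] using () renaming (refl to ≋-refl; trans to ≋-trans; sym to ≋-sym; *-comm to *ₚ-comm; reflexive to ≋-reflexive)
  open import Relation.Binary.Reasoning.Setoid setoid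

  ≋⇒≈ : ∀ {P Q} → P ≋ Q → P ≈ Q
  ≋⇒≈ eq = O/p.≈⇒∼ (≈⇒∼ eq)

  mono-m≈1 : monoₚ m ≈ 1#
  mono-m≈1 = begin
    monoₚ m               ≈⟨ ≋⇒≈ (≋-sym shifted) ⟩
    N m +ₚ constₚ (+ 1)   ≈⟨ +-congʳ N≈0 ⟩
    1#                    ∎
    where
    q = proj₁ (cyclotomic-∣ 1≤m m<p)
    N≈0 : N m ≈ 0#
    N≈0 = ≈-trans (≋⇒≈ (N≋U m)) (O/p.congruent q (F.trans (proj₂ (cyclotomic-∣ 1≤m m<p)) (≈⇒∼ (*ₚ-comm q (cyclotomic m)))))
      where module F = CommutativeRing quotient
    shifted : N m +ₚ constₚ (+ 1) ≋ monoₚ m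
    shifted = ≋-trans (CommutativeRing.+-assoc ℤ[x] (monoₚ m) (constₚ (ℤ.- (+ 1))) (constₚ (+ 1)))
      (≋-trans (PolyRing.+ₚ-cong (≋-refl {monoₚ m}) (pointwise λ { zero → ≡.refl ; (suc i) → ≡.refl })) (PolyRing.+ₚ-identityʳ (monoₚ m)))

  -- Represents η^l for η = ζ^j.
  ψ : ℕ → Poly
  ψ l = monoₚ (j ℕ.* l)

  ψ-0 : ψ 0 ≈ 1#
  ψ-0 = reflexive (cong monoₚ (ℕₚ.*-zeroʳ j))

  ψ-+ : ∀ a b → ψ (a ℕ.+ b) ≈ ψ a * ψ b
  ψ-+ a b = ≋⇒≈ (≋-trans (≋-reflexive (cong monoₚ (ℕₚ.*-distribˡ-+ j a b))) (monoₚ-+ (j ℕ.* a) (j ℕ.* b)))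

  ψ-m : ψ m ≈ 1#
  ψ-m = multiple j
    where
    multiple : ∀ j → monoₚ (j ℕ.* m) ≈ 1#
    multiple zero    = ≈-refl
    multiple (suc j) = ≈-trans (≋⇒≈ (monoₚ-+ m (j ℕ.* m))) (≈-trans (*-cong mono-m≈1 (multiple j)) (*-identityˡ 1#))

  open Character O/p.quotient ψ ψ-0 ψ-+ ψ-m using (χ; χ-cong; χ-1; χ-*; 1+χ≈∏)
  open MultiplicativeSums O/p.quotient χ χ-1 χ-* using (∏-primeDivisors)
  open Rearrangement *-commutativeMonoid using (power; ⨀-power-omega)
  open BigOperator *-commutativeMonoid renaming (⨀ to ∏; ⨀-cong to ∏-cong) using ()
  open BigOperator +-commutativeMonoid renaming (⨀ to ∑; ⨀-cong to ∑-cong) using ()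

  ^ₚ≡power : ∀ y k → y ^ₚ k ≡ power y k
  ^ₚ≡power y zero    = ≡.refl
  ^ₚ≡power y (suc k) = cong (y *ₚ_) (^ₚ≡power y k)

  private instance
    period≢0 : NonZero e
    period≢0 = e≢0 2≤e

  -- As `s` divides `e`, the multiple of `e` that the reduction removes is a multiple of `s`; this
  -- reconciles the period of Fermat's theorem with that of `χ`.
  residue≅ : ∀ d → d ≅ (d ℕ.% e)
  residue≅ d = subst (_≅ (d ℕ.% e))
    (≡.sym (≡.trans (ℕ.m≡m%n+[m/n]*n d e) (cong (d ℕ.% e ℕ.+_)
      (≡.trans (cong (d ℕ./ e ℕ.*_) (ℕ.m∣n⇒n≡quotient*m s∣p-1)) (≡.sym (ℕₚ.*-assoc (d ℕ./ e) t s))))))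
    (≅-+* (d ℕ.% e) (d ℕ./ e ℕ.* t))
    where t = ℕ.quotient s∣p-1

  fAtPow≈numDiv : fAtPow n s g j ≈ constₚ (+ numDiv n)
  fAtPow≈numDiv = begin
    fAtPow n s g j
      ≈⟨ ∏-cong (range1 m) (λ {l} _ → reflexive (^ₚ≡power (1# + ψ l) (omega n s (g ^ l)))) ⟩
    ∏ (λ l → power (1# + ψ l) (omega n s (g ^ l))) (range1 m)
      ≈⟨ ⨀-power-omega n s g (λ l → 1# + ψ l) (range1 m) ⟩
    ∏ (λ r → ∏ (λ l → if does (s ℕ.∣? ℤ.∣ + r ℤ.- + (g ^ l) ∣) then 1# + ψ l else 1#) (range1 m)) (primeDivisors n)
      ≈⟨ ∏-cong (primeDivisors n) (λ {r} _ → 1+χ≈∏ r) ⟨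
    ∏ (λ r → 1# + χ r) (primeDivisors n)
      ≈⟨ ∏-primeDivisors (proj₁ (proj₁ almostPrime)) (proj₂ almostPrime) ⟩
    ∑ χ (divisors n)
      ≈⟨ ∑-cong (divisors n) (λ {d} _ → χ-cong (residue≅ d)) ⟩
    ∑ (λ d → χ (d ℕ.% e)) (divisors n)
      ≈⟨ O/p.≈⇒∼ (∑-divisors 2≤e χ n p∣n (proj₁ almostPrime)) ⟩
    constₚ (+ numDiv n) * χ 1
      ≈⟨ *-congˡ {constₚ (+ numDiv n)} χ-1 ⟩
    constₚ (+ numDiv n) * 1#
      ≈⟨ *-identityʳ _ ⟩
    constₚ (+ numDiv n) ∎

  difference≈0 : fAtPow n s g j +ₚ constₚ (ℤ.- (+ numDiv n)) ≈ 0#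
  difference≈0 = ≈-trans (+-congʳ fAtPow≈numDiv) (≋⇒≈ (pointwise λ { zero → ℤₚ.+-inverseʳ (+ numDiv n) ; (suc i) → ≡.refl }))

  -- The outer congruence says that the difference is Φ_m B modulo `p`, and the inner one supplies
  -- the multiple p A that makes this an equation in ℤ[x].
  inPIdeal : InPIdeal m p (fAtPow n s g j +ₚ constₚ (ℤ.- (+ numDiv n)))
  inPIdeal = A , B , at (≋-trans (_∼_.equality modulo-p) (≋-trans
    (PolyRing.+ₚ-comm (cyclotomic m *ₚ B) (constₚ (+ p) *ₚ A))
    (PolyRing.+ₚ-cong (PolyRing.constₚ-*ₚ (+ p) A) (≋-refl {cyclotomic m *ₚ B}))))
    where
    B = O/p._∼_.factor difference≈0
    modulo-p = O/p._∼_.equality difference≈0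
    A = _∼_.factor modulo-p

open import Data.Integer using (-_)

theorem1p7 : (n p q ν s g : ℕ) → AlmostPrime n → Prime p → p ∣ n
    → Prime q → 2 < q → 1 ≤ ν → s ≡ q ^ ν → s ∣ (p ∸ 1)
    → IsGenerator s g
    → (j : ℕ) → j < totient s
    → InPIdeal (totient s) p (fAtPow n s g j +ₚ constₚ (- (+ numDiv n)))
theorem1p7 n p q ν s g almostPrime p-prime p∣n _ 2<q 1≤ν s≡q^ν s∣p-1 generator j _ =
  Reduction.inPIdeal n p s g j almostPrime p-prime p∣n 2<s s∣p-1 generator
  where
  q≤q^ν : q ≤ q ^ ν
  q≤q^ν = subst (_≤ q ^ ν) (ℕₚ.*-identityʳ q) (ℕₚ.^-monoʳ-≤ q {{ℕ.>-nonZero (ℕₚ.<-trans (s≤s z≤n) 2<q)}} 1≤ν)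
  2<s : 2 < s
  2<s = subst (2 <_) (≡.sym s≡q^ν) (ℕₚ.<-≤-trans 2<q q≤q^ν)
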